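{- Let $\mathcal{F}$ be a finite family of graphs with $\min_{F\in\mathcal{F}}\chi(F)=r+1\geq 3$, set $t=\max_{F\in\mathcal{F}}|F|$ and $q=q(\mathcal{F})$. Assume that there are $F_1,F_2\in\mathcal{F}$ with $F_1\subseteq tK_2\bigotimes T(t(r-1),r-1)$ and $F_2\subseteq (K_{q-1,t}\cup K_{1,t})\bigotimes T(t(r-1),r-1)$. Then for sufficiently large $n$, every graph $G\in{\rm EX}(n,\mathcal{F})$ has a partition $V(G)=W\cup\bigcup_{1\leq i\leq r}S_i$ such that: (i) $|W|=q-1$ and $|S_i|\in\{\lfloor\frac{n-q+1}{r}\rfloor,\lceil\frac{n-q+1}{r}\rceil\}$ for every $1\leq i\leq r$; (ii) for every $1\leq i\leq r$ there is $S'_i\subseteq S_i$ with $|S_i\setminus S'_i|\leq t^2$ such that $N_G(v)=V(G)\setminus S_i$ for every $v\in S'_i$.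
   Context: All graphs are finite and simple. $F\subseteq G$ means $G$ contains a copy of $F$; $\mathcal{F}$-free means containing no member of $\mathcal{F}$; ${\rm EX}(n,\mathcal{F})$ is the set of $\mathcal{F}$-free $n$-vertex graphs with the maximum number of edges. $\chi$ is chromatic number, $|G|$ the number of vertices, $N_G(v)$ the neighbourhood. $\cup$ is disjoint union, $tH$ is $t$ disjoint copies of $H$, and $\bigotimes$ is the join (disjoint union plus all edges between different factors). $\overline{K_s}$ is the edgeless graph on $s$ vertices, $K_{a,b}$ the complete bipartite graph. $T(n,r)$ is the Turán graph (complete $r$-partite, parts of size $\lfloor n/r\rfloor$ or $\lceil n/r\rceil$), with $T(n,1)=\overline{K_n}$. For such $\mathcal{F}$, $q(\mathcal{F})$ is the minimum integer $s$ such that $F\subseteq\overline{K_s}\bigotimes T(tr,r)$ for some $F\in\mathcal{F}$. -}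

module Defs where

open import Data.Nat using (ℕ; zero; suc; _+_; _*_; _∸_; _≤_; _<_; _⊔_; _≡ᵇ_)
open import Data.Nat.DivMod using (_/_; _%_)
open import Data.Bool using (Bool; true; false; not; if_then_else_; _∧_)
open import Data.Fin using (Fin; toℕ; splitAt; _≟_) renaming (zero to fzero; suc to fsuc)
open import Data.Sum using (_⊎_; inj₁; inj₂)
open import Data.Product using (Σ; _×_; _,_; ∃; ∃-syntax; proj₁)
open import Data.List using (List; foldr; map)
open import Data.List.Membership.Propositional using (_∈_)
open import Relation.Binary.PropositionalEquality using (_≡_; _≢_)
open import Relation.Nullary using (¬_)
open import Relation.Nullary.Decidable using (⌊_⌋)
open import Function.Definitions using (Injective)
open import Function.Bundles using (_⇔_)

Graph : ℕ → Set
Graph n = Fin n → Fin n → Bool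

IsSimple : ∀ {n} → Graph n → Set
IsSimple {n} G = (∀ i j → G i j ≡ G j i) × (∀ i → G i i ≡ false)

_⊆ᴳ_ : ∀ {m n} → Graph m → Graph n → Set
_⊆ᴳ_ {m} {n} F G = Σ (Fin m → Fin n) λ f →
  Injective _≡_ _≡_ f × (∀ i j → F i j ≡ true → G (f i) (f j) ≡ true)

Family : Set
Family = List (Σ ℕ Graph)

Free : ∀ {n} → Family → Graph n → Set
Free ℱ G = ∀ {m} (F : Graph m) → (m , F) ∈ ℱ → ¬ (F ⊆ᴳ G)

count : ∀ {n} → (Fin n → Bool) → ℕ
count {zero} p = 0
count {suc n} p = (if p fzero then 1 else 0) + count (λ i → p (fsuc i))

edges : ∀ {n} → Graph n → ℕ
edges {n} G = foldr _+_ 0 (map (λ i → count (λ j → G i j ∧ (toℕ i Data.Nat.<ᵇ toℕ j)))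
              (Data.List.allFin n))

InEX : (n : ℕ) → Family → Graph n → Set
InEX n ℱ G = IsSimple G × Free ℱ G ×
  (∀ (H : Graph n) → IsSimple H → Free ℱ H → edges H ≤ edges G)

Colourable : ∀ {m} → ℕ → Graph m → Set
Colourable {m} k F = Σ (Fin m → Fin k) λ c → ∀ i j → F i j ≡ true → c i ≢ c j

MinChromatic : Family → ℕ → Set
MinChromatic ℱ k =
  (∀ {m} (F : Graph m) → (m , F) ∈ ℱ → ¬ Colourable (k ∸ 1) F) ×
  (∃[ m ] Σ (Graph m) λ F → (m , F) ∈ ℱ × Colourable k F)

maxOrder : Family → ℕ
maxOrder ℱ = foldr (λ x acc → proj₁ x ⊔ acc) 0 ℱ

Empty : (s : ℕ) → Graph s
Empty s i j = false

Multipartite : ∀ {n} → (Fin n → ℕ) → Graph n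
Multipartite p i j = not (p i ≡ᵇ p j)

-- Turán graph T(n,r): vertex i lies in part (i mod r); for r = 1 it is edgeless.
-- (T(n,0) is not used; it is set to the edgeless graph.)
Turan : (n r : ℕ) → Graph n
Turan n zero = Empty n
Turan n (suc k) = Multipartite (λ i → toℕ i % suc k)

Kbip : (a b : ℕ) → Graph (a + b)
Kbip a b = Multipartite (λ i → side (splitAt a i))
  where
  side : Fin a ⊎ Fin b → ℕ
  side (inj₁ _) = 0
  side (inj₂ _) = 1

K2 : Graph 2
K2 i j = not ⌊ i ≟ j ⌋

_∪ᴳ_ : ∀ {m n} → Graph m → Graph n → Graph (m + n)
_∪ᴳ_ {m} {n} G H i j = go (splitAt m i) (splitAt m j)
  where
  go : Fin m ⊎ Fin n → Fin m ⊎ Fin n → Bool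
  go (inj₁ a) (inj₁ b) = G a b
  go (inj₂ a) (inj₂ b) = H a b
  go _ _ = false

_⊗_ : ∀ {m n} → Graph m → Graph n → Graph (m + n)
_⊗_ {m} {n} G H i j = go (splitAt m i) (splitAt m j)
  where
  go : Fin m ⊎ Fin n → Fin m ⊎ Fin n → Bool
  go (inj₁ a) (inj₁ b) = G a b
  go (inj₂ a) (inj₂ b) = H a b
  go _ _ = true

copies : ∀ {m} (t : ℕ) → Graph m → Graph (t * m)
copies zero H ()
copies (suc t) H = H ∪ᴳ copies t H

QWitness : Family → ℕ → ℕ → ℕ → Set
QWitness ℱ t r s = ∃[ m ] Σ (Graph m) λ F → (m , F) ∈ ℱ × (F ⊆ᴳ (Empty s ⊗ Turan (t * r) r))

IsQ : Family → ℕ → ℕ → ℕ → Set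
IsQ ℱ t r q = QWitness ℱ t r q × (∀ s → s < q → ¬ QWitness ℱ t r s)

-- floor and ceiling of a / b (b ≥ 1; value 0 for b = 0, never used)
⌊_/_⌋ᶠ : ℕ → ℕ → ℕ
⌊ a / zero ⌋ᶠ = 0
⌊ a / suc b ⌋ᶠ = a / suc b

⌈_/_⌉ᶜ : ℕ → ℕ → ℕ
⌈ a / zero ⌉ᶜ = 0
⌈ a / suc b ⌉ᶜ = (a + b) / suc b

-- The conclusion: a partition V(G) = W ∪ S_1 ∪ … ∪ S_r, encoded by a labelling
-- part : Fin n → Fin (suc r) with W = part⁻¹(0) and S_i = part⁻¹(suc i).

inW : ∀ {n r} → (Fin n → Fin (suc r)) → Fin n → Bool
inW part v = ⌊ part v ≟ fzero ⌋

inS : ∀ {n r} → (Fin n → Fin (suc r)) → Fin r → Fin n → Bool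
inS part i v = ⌊ part v ≟ fsuc i ⌋

GoodPartition : (n r t q : ℕ) → Graph n → (Fin n → Fin (suc r)) → Set
GoodPartition n r t q G part =
  (count (inW part) ≡ q ∸ 1) ×
  (∀ (i : Fin r) → (count (inS part i) ≡ ⌊ (n + 1) ∸ q / r ⌋ᶠ)
                 ⊎ (count (inS part i) ≡ ⌈ (n + 1) ∸ q / r ⌉ᶜ)) ×
  (∀ (i : Fin r) → Σ (Fin n → Bool) λ S′ →
      (∀ v → S′ v ≡ true → inS part i v ≡ true) ×
      (count (λ v → inS part i v ∧ not (S′ v)) ≤ t * t) ×
      (∀ v → S′ v ≡ true → ∀ u → (G v u ≡ true) ⇔ (inS part i u ≡ false)))

{-# OPTIONS --safe #-}
module Submission where

-- Write r = suc r₁, q = suc p and φ(G) = r·Σdeg − (r₁n² + 2pn).  Suppose every degree is at least (1 − 1/r)n − O(1).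
-- Counting edges between V and a large K_r(T) ⊆ G colours all but O(1) vertices (the set D) with r independent
-- classes.  Let m i be the number of non-neighbours in D of a typical vertex of class i.  Since F ⊆ K̄_q ⊗ T(tr,r)
-- for some F ∈ ℱ, typical vertices of the r classes have at most p common neighbours in D, so |D| ≤ p + Σ m i; an
-- edge count turns this into φ(G) = O(1).  Deleting low-degree vertices removes the degree condition, so φ = O(1)
-- for all large host-free graphs; as φ ≥ −O(1) for extremal graphs, these satisfy the degree condition, and now
-- |D| = p + Σ m i.  Hence in every class i many vertices have the same neighbourhood, the complement of a set S i, and
-- these S i leave out exactly p vertices.  Finally, giving a vertex the neighbourhood of such a "perfect" vertex
-- creates no member of ℱ, so maximality forces balanced sizes and makes every vertex isolated in G[S i] perfect; the
-- hypotheses on F₁ and F₂ bound the matching number and the maximum degree of G[S i], hence its non-isolated vertices.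

-- The edge count has the form φ(G) ≤ 2n(|D| - p - Σ m i) + O(1). A vertex of D adds at most about
-- 2n to φ, while a class of size about n/r whose typical vertex misses m i vertices of D loses
-- about 2n · m i. Hence |D| ≤ p + Σ m i bounds φ, and φ ≥ -O(1) forces equality for large n,
-- because a deficit of one already costs 2n. An error of o(n) would not do, so every loss must stay
-- O(1); this is why the degree condition carries an additive constant and why classes are compared
-- through exact adjacency patterns on D, of which there are at most 2^|D|.
--
-- The degree condition for an extremal G comes from comparing G with G - v: φ(G) is bounded below
-- by a construction, φ(G - v) above. Since G - v need not be extremal, the upper bound must first
-- be proved for all host-free graphs. The structural argument is therefore run twice, with two
-- different degree slacks.
--
-- To stay in ℕ, inequalities are multiplied by r, degree sums replace edge numbers, and negative
-- terms move to the other side.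

open import Defs
open import Data.Nat using (ℕ; zero; suc; _+_; _*_; _∸_; _^_; _≤_; _<_; z≤n; s≤s; s≤s⁻¹; _≤?_; _⊔_; _≡ᵇ_; _<ᵇ_)
open import Data.Nat.Properties hiding (_≟_)
open import Data.Nat.DivMod using (_/_; _%_; m≡m%n+[m/n]*n; m%n<n; [m+kn]%n≡m%n; m<n⇒m%n≡m; m*n/n≡m; m<n*o⇒m/o<n; /-monoˡ-≤)
open import Data.Nat.Tactic.RingSolver using (solve-∀)
open import Data.Bool using (Bool; true; false; not; if_then_else_; _∧_; _∨_)
import Data.Bool.Properties as 𝔹
open import Data.Fin using (Fin; toℕ; splitAt; _≟_; punchIn; remQuot; combine; _↑ˡ_; _↑ʳ_; fromℕ<; inject≤) renaming (zero to fzero; suc to fsuc)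
import Data.Fin.Properties as 𝔽
open import Data.List using (List; _∷_; map; tabulate; foldr)
open import Data.List.Properties using (map-tabulate)
open import Data.List.Membership.Propositional using (_∈_)
open import Data.List.Relation.Unary.Any using (here; there)
open import Data.Product using (Σ; _×_; _,_; ∃-syntax; proj₁; proj₂)
open import Data.Sum using (_⊎_; inj₁; inj₂; [_,_]′)
open import Data.Empty using (⊥; ⊥-elim)
open import Data.Unit using (⊤; tt)
open import Relation.Nullary using (¬_; Dec; yes; no)
open import Relation.Nullary.Decidable using (⌊_⌋; _×-dec_; _⊎-dec_)
open import Relation.Binary.PropositionalEquality
open import Function using (_∘_; id; case_of_)
open import Function.Definitions using (Injective)
open import Function.Bundles using (mk⇔)
open import Algebra.Properties.Semiring.Sum +-*-semiring
  using (∑-distrib-+; ∑-comm; sum-remove; *-distribˡ-sum; *-distribʳ-sum)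
  renaming (sum to ∑; sum-cong-≗ to ∑-cong)
open import Relation.Binary.Definitions using (tri<; tri≈; tri>)

-- A certificate for linear arithmetic: s is the slack, and the equation is a ring identity.
lin : ∀ {A B L R} s → L ≤ R → A + R + s ≡ B + L → A ≤ B
lin {A} {B} {L} {R} s L≤R e = +-cancelʳ-≤ R A B (begin
  A + R      ≤⟨ m≤m+n (A + R) s ⟩
  A + R + s  ≡⟨ e ⟩
  B + L      ≤⟨ +-monoʳ-≤ B L≤R ⟩
  B + R      ∎)
  where open ≤-Reasoning

-- Sums and indicator functions

ι : Bool → ℕ
ι b = if b then 1 else 0

ι≤1 : ∀ b → ι b ≤ 1
ι≤1 true  = ≤-refl
ι≤1 false = z≤n

ι-mono : ∀ {a b} → (a ≡ true → b ≡ true) → ι a ≤ ι b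
ι-mono {false} h = z≤n
ι-mono {true} {b} h rewrite h refl = ≤-refl

ι-split : ∀ b → ι b + ι (not b) ≡ 1
ι-split true  = refl
ι-split false = refl

true≢false : ∀ {b : Bool} → b ≡ true → b ≡ false → ⊥
true≢false refl ()

not-true : ∀ {b} → ¬ b ≡ true → b ≡ false
not-true {true}  h = ⊥-elim (h refl)
not-true {false} h = refl

∧-intro : ∀ {a b} → a ≡ true → b ≡ true → a ∧ b ≡ true
∧-intro refl refl = refl

∧-elim : ∀ {a b} → a ∧ b ≡ true → a ≡ true × b ≡ true
∧-elim {true} {true} _ = refl , refl

module _ {ℓ} {P : Set ℓ} where
  ⌊⌋⁺ : (P? : Dec P) → P → ⌊ P? ⌋ ≡ true
  ⌊⌋⁺ (yes _) p = refl
  ⌊⌋⁺ (no ¬p) p = ⊥-elim (¬p p)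

  ⌊⌋⁻ : (P? : Dec P) → ⌊ P? ⌋ ≡ true → P
  ⌊⌋⁻ (yes p) _ = p

  ⌊⌋⁺′ : (P? : Dec P) → ¬ P → ⌊ P? ⌋ ≡ false
  ⌊⌋⁺′ (yes p) ¬p = ⊥-elim (¬p p)
  ⌊⌋⁺′ (no _)  ¬p = refl

  ⌊⌋⁻′ : (P? : Dec P) → ⌊ P? ⌋ ≡ false → ¬ P
  ⌊⌋⁻′ (no ¬p) _ = ¬p

∑-mono : ∀ {n} {f g : Fin n → ℕ} → (∀ i → f i ≤ g i) → ∑ f ≤ ∑ g
∑-mono {zero}  h = z≤n
∑-mono {suc n} h = +-mono-≤ (h fzero) (∑-mono (h ∘ fsuc))

∑-const : ∀ n c → ∑ {n} (λ _ → c) ≡ n * c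
∑-const zero    c = refl
∑-const (suc n) c = cong (c +_) (∑-const n c)

∑-bound : ∀ {n c} {f : Fin n → ℕ} → (∀ i → f i ≤ c) → ∑ f ≤ n * c
∑-bound {n} {c} h = ≤-trans (∑-mono h) (≤-reflexive (∑-const n c))

∑-lower : ∀ {n c} {f : Fin n → ℕ} → (∀ i → c ≤ f i) → n * c ≤ ∑ f
∑-lower {n} {c} h = ≤-trans (≤-reflexive (sym (∑-const n c))) (∑-mono h)

term≤∑ : ∀ {n} (f : Fin n → ℕ) i → f i ≤ ∑ f
term≤∑ f fzero    = m≤m+n _ _
term≤∑ f (fsuc i) = ≤-trans (term≤∑ (f ∘ fsuc) i) (m≤n+m _ _)

∑-*ˡ : ∀ {n} c (f : Fin n → ℕ) → ∑ (λ i → c * f i) ≡ c * ∑ f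
∑-*ˡ c f = sym (*-distribˡ-sum c f)

∑-*ʳ : ∀ {n} c (f : Fin n → ℕ) → ∑ (λ i → f i * c) ≡ ∑ f * c
∑-*ʳ c f = sym (*-distribʳ-sum c f)

∑-≟ : ∀ {n} (i : Fin n) c → ∑ (λ k → ι ⌊ k ≟ i ⌋ * c) ≡ c
∑-≟ {suc n} fzero c = begin
  c + 0 + ∑ {n} (λ k → ι ⌊ fsuc k ≟ fzero ⌋ * c) ≡⟨ cong (c + 0 +_) (trans (∑-const n 0) (*-zeroʳ n)) ⟩
  c + 0 + 0 ≡⟨ trans (+-identityʳ (c + 0)) (+-identityʳ c) ⟩
  c ∎
  where open ≡-Reasoning
∑-≟ {suc n} (fsuc i) c =
  trans (∑-cong {n} (λ k → cong (λ b → ι b * c) (lem k))) (∑-≟ i c)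
  where
  lem : ∀ k → ⌊ fsuc k ≟ fsuc i ⌋ ≡ ⌊ k ≟ i ⌋
  lem k with k ≟ i
  ... | yes _ = refl
  ... | no  _ = refl

# : ∀ {n} → (Fin n → Bool) → ℕ
# p = ∑ (λ v → ι (p v))

count≡# : ∀ {n} (p : Fin n → Bool) → count p ≡ # p
count≡# {zero}  p = refl
count≡# {suc n} p = cong (ι (p fzero) +_) (count≡# (p ∘ fsuc))

#-mono : ∀ {n} {p q : Fin n → Bool} → (∀ v → p v ≡ true → q v ≡ true) → # p ≤ # q
#-mono h = ∑-mono (λ v → ι-mono (h v))

#≤n : ∀ {n} (p : Fin n → Bool) → # p ≤ n
#≤n {n} p = ≤-trans (∑-bound (λ v → ι≤1 (p v))) (≤-reflexive (*-identityʳ n))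

#-compl : ∀ {n} (p : Fin n → Bool) → # p + # (not ∘ p) ≡ n
#-compl {n} p = begin
  # p + # (not ∘ p)                  ≡⟨ sym (∑-distrib-+ (ι ∘ p) (ι ∘ not ∘ p)) ⟩
  ∑ (λ v → ι (p v) + ι (not (p v)))  ≡⟨ ∑-cong (λ v → ι-split (p v)) ⟩
  ∑ {n} (λ _ → 1)                    ≡⟨ trans (∑-const n 1) (*-identityʳ n) ⟩
  n                                  ∎
  where open ≡-Reasoning

#-split : ∀ {n} (p q : Fin n → Bool) → # p ≤ # (λ v → p v ∧ q v) + # (λ v → p v ∧ not (q v))
#-split p q = ≤-trans (∑-mono (λ v → pw (p v) (q v))) (≤-reflexive (∑-distrib-+ (λ v → ι (p v ∧ q v)) (λ v → ι (p v ∧ not (q v)))))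
  where
  pw : ∀ a b → ι a ≤ ι (a ∧ b) + ι (a ∧ not b)
  pw true true = ≤-refl
  pw true false = ≤-refl
  pw false b = z≤n

#-≟ : ∀ {n} (i : Fin n) → # (λ k → ⌊ k ≟ i ⌋) ≡ 1
#-≟ i = trans (∑-cong (λ k → sym (*-identityʳ (ι ⌊ k ≟ i ⌋)))) (∑-≟ i 1)

pick : ∀ {n} (p : Fin n → Bool) k → k ≤ # p →
  Σ (Fin k → Fin n) λ f → Injective _≡_ _≡_ f × (∀ j → p (f j) ≡ true)
pick {zero} p zero h = (λ ()) , (λ {}) , λ ()
pick {suc n} p k h with p fzero in eq
pick {suc n} p zero    h | true = (λ ()) , (λ {}) , λ ()
pick {suc n} p (suc k) h | true with pick (p ∘ fsuc) k (s≤s⁻¹ h)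
... | f , inj , ok = g , ginj , gok
  where
  g : Fin (suc k) → Fin (suc n)
  g fzero    = fzero
  g (fsuc j) = fsuc (f j)
  ginj : Injective _≡_ _≡_ g
  ginj {fzero}  {fzero}  e = refl
  ginj {fsuc a} {fsuc b} e = cong fsuc (inj (𝔽.suc-injective e))
  gok : ∀ j → p (g j) ≡ true
  gok fzero    = eq
  gok (fsuc j) = ok j
pick {suc n} p k h | false with pick (p ∘ fsuc) k h
... | f , inj , ok = fsuc ∘ f , (λ e → inj (𝔽.suc-injective e)) , ok

#-witness : ∀ {n} (p : Fin n → Bool) → 1 ≤ # p → ∃[ v ] p v ≡ true
#-witness p h with pick p 1 h
... | f , _ , ok = f fzero , ok fzero

#-unique : ∀ {n} (p : Fin n → Bool) → (∀ a b → p a ≡ true → p b ≡ true → a ≡ b) → # p ≤ 1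
#-unique p u with # p ≤? 1
... | yes h = h
... | no h with pick p 2 (≰⇒> h)
...   | f , inj , ok with inj {fzero} {fsuc fzero} (u _ _ (ok _) (ok _))
...     | ()

#-pullback : ∀ {k n} (f : Fin k → Fin n) → Injective _≡_ _≡_ f → (p : Fin n → Bool) → # (p ∘ f) ≤ # p
#-pullback {k} {n} f inj p = begin
  # (p ∘ f)                                          ≡⟨ ∑-cong (λ b → sym (∑-≟ (f b) (ι (p (f b))))) ⟩
  ∑ (λ b → ∑ (λ v → ι ⌊ v ≟ f b ⌋ * ι (p (f b))))    ≤⟨ ∑-mono (λ b → ∑-mono (λ v → pw b v)) ⟩
  ∑ (λ b → ∑ (λ v → ι ⌊ v ≟ f b ⌋ * ι (p v)))        ≡⟨ ∑-comm (λ b v → ι ⌊ v ≟ f b ⌋ * ι (p v)) ⟩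
  ∑ (λ v → ∑ (λ b → ι ⌊ v ≟ f b ⌋ * ι (p v)))        ≡⟨ ∑-cong (λ v → ∑-*ʳ (ι (p v)) (λ b → ι ⌊ v ≟ f b ⌋)) ⟩
  ∑ (λ v → # (λ b → ⌊ v ≟ f b ⌋) * ι (p v))          ≤⟨ ∑-mono (λ v → *-monoˡ-≤ (ι (p v)) (#-unique (λ b → ⌊ v ≟ f b ⌋) (uniq v))) ⟩
  ∑ (λ v → 1 * ι (p v))                              ≡⟨ ∑-cong (λ v → *-identityˡ (ι (p v))) ⟩
  # p                                                ∎
  where
  open ≤-Reasoning
  pw : ∀ b v → ι ⌊ v ≟ f b ⌋ * ι (p (f b)) ≤ ι ⌊ v ≟ f b ⌋ * ι (p v)
  pw b v with v ≟ f b
  ... | yes refl = ≤-refl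
  ... | no _ = z≤n
  uniq : ∀ v a b → ⌊ v ≟ f a ⌋ ≡ true → ⌊ v ≟ f b ⌋ ≡ true → a ≡ b
  uniq v a b x y = inj (trans (sym (⌊⌋⁻ (v ≟ f a) x)) (⌊⌋⁻ (v ≟ f b) y))

none : ∀ {L n} → (Fin L → Fin n → Bool) → Fin n → Bool
none conf v = ⌊ 𝔽.all? (λ k → conf k v 𝔹.≟ false) ⌋

none⁻ : ∀ {L n} (conf : Fin L → Fin n → Bool) v → none conf v ≡ true → ∀ k → conf k v ≡ false
none⁻ conf v h = ⌊⌋⁻ (𝔽.all? (λ k → conf k v 𝔹.≟ false)) h

-- A union bound over the conflict sets `conf k`.
#-avoid : ∀ {L n} (p : Fin n → Bool) (conf : Fin L → Fin n → Bool) →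
  # p ≤ # (λ v → p v ∧ none conf v) + ∑ (λ k → # (conf k))
#-avoid {L} {n} p conf = begin
  # p                                                    ≤⟨ ∑-mono pw ⟩
  ∑ (λ v → ι (p v ∧ none conf v) + # (λ k → conf k v))   ≡⟨ ∑-distrib-+ (λ v → ι (p v ∧ none conf v)) (λ v → # (λ k → conf k v)) ⟩
  # (λ v → p v ∧ none conf v) + ∑ (λ v → # (λ k → conf k v)) ≡⟨ cong (# (λ v → p v ∧ none conf v) +_) (∑-comm (λ v k → ι (conf k v))) ⟩
  # (λ v → p v ∧ none conf v) + ∑ (λ k → # (conf k))     ∎
  where
  open ≤-Reasoning
  pw : ∀ v → ι (p v) ≤ ι (p v ∧ none conf v) + # (λ k → conf k v)
  pw v with 𝔽.all? (λ k → conf k v 𝔹.≟ false)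
  ... | yes _ = ≤-trans (≤-reflexive (cong ι (sym (𝔹.∧-identityʳ (p v))))) (m≤m+n _ _)
  ... | no ¬all with 𝔽.¬∀⟶∃¬ L _ (λ k → conf k v 𝔹.≟ false) ¬all
  ...   | k , c = ≤-trans (ι≤1 (p v)) (≤-trans (≤-trans (≤-reflexive (cong ι (sym (𝔹.¬-not c)))) (term≤∑ (λ k → ι (conf k v)) k)) (m≤n+m _ _))

-- Cauchy-Schwarz, obtained by summing 2ab ≤ a² + b² over all ordered pairs of indices.
∑-sq-≤ : ∀ {r} (s : Fin r → ℕ) → ∑ s * ∑ s ≤ r * ∑ (λ i → s i * s i)
∑-sq-≤ {r} s = *-cancelˡ-≤ 2 (begin
  2 * (∑ s * ∑ s)                                         ≡⟨ cong (2 *_) (sym expand) ⟩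
  2 * ∑ (λ i → ∑ (λ j → s i * s j))                       ≡⟨ sym (∑-*ˡ 2 (λ i → ∑ (λ j → s i * s j))) ⟩
  ∑ (λ i → 2 * ∑ (λ j → s i * s j))                       ≡⟨ ∑-cong (λ i → sym (∑-*ˡ 2 (λ j → s i * s j))) ⟩
  ∑ (λ i → ∑ (λ j → 2 * (s i * s j)))                     ≤⟨ ∑-mono (λ i → ∑-mono (λ j → amgm (s i) (s j))) ⟩
  ∑ (λ i → ∑ (λ j → s i * s i + s j * s j))               ≡⟨ ∑-cong (λ i → trans (∑-distrib-+ (λ j → s i * s i) (λ j → s j * s j)) (cong (_+ S) (∑-const r (s i * s i)))) ⟩
  ∑ (λ i → r * (s i * s i) + S)                           ≡⟨ ∑-distrib-+ (λ i → r * (s i * s i)) (λ _ → S) ⟩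
  ∑ (λ i → r * (s i * s i)) + ∑ {r} (λ _ → S)             ≡⟨ cong₂ _+_ (∑-*ˡ r (λ i → s i * s i)) (∑-const r S) ⟩
  r * S + r * S                                           ≡⟨ dbl (r * S) ⟩
  2 * (r * S)                                             ∎)
  where
  open ≤-Reasoning
  S = ∑ (λ i → s i * s i)
  dbl : ∀ a → a + a ≡ 2 * a
  dbl = solve-∀
  expand : ∑ (λ i → ∑ (λ j → s i * s j)) ≡ ∑ s * ∑ s
  expand = trans (∑-cong (λ i → ∑-*ˡ (s i) s)) (∑-*ʳ (∑ s) s)
  amgm : ∀ a b → 2 * (a * b) ≤ a * a + b * b
  amgm a b with ≤-total a b
  ... | inj₁ h with m≤n⇒∃[o]m+o≡n h
  ...   | c , refl = ≤-trans (m≤m+n _ (c * c)) (≤-reflexive (id₁ a c))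
    where
    id₁ : ∀ a c → 2 * (a * (a + c)) + c * c ≡ a * a + (a + c) * (a + c)
    id₁ = solve-∀
  amgm a b | inj₂ h with m≤n⇒∃[o]m+o≡n h
  ...   | c , refl = ≤-trans (m≤m+n _ (c * c)) (≤-reflexive (id₂ b c))
    where
    id₂ : ∀ b c → 2 * ((b + c) * b) + c * c ≡ (b + c) * (b + c) + b * b
    id₂ = solve-∀

-- Degrees

deg : ∀ {n} → Graph n → Fin n → ℕ
deg G v = # (G v)

degSum : ∀ {n} → Graph n → ℕ
degSum G = ∑ (deg G)

foldr-tabulate : ∀ {n} (f : Fin n → ℕ) → foldr _+_ 0 (tabulate f) ≡ ∑ f
foldr-tabulate {zero}  f = refl
foldr-tabulate {suc n} f = cong (f fzero +_) (foldr-tabulate (f ∘ fsuc))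

edges≡∑ : ∀ {n} (G : Graph n) → edges G ≡ ∑ (λ i → # (λ j → G i j ∧ (toℕ i <ᵇ toℕ j)))
edges≡∑ {n} G = begin
  foldr _+_ 0 (map f (tabulate id)) ≡⟨ cong (foldr _+_ 0) (map-tabulate id f) ⟩
  foldr _+_ 0 (tabulate f)          ≡⟨ foldr-tabulate f ⟩
  ∑ f                               ≡⟨ ∑-cong (λ i → count≡# (λ j → G i j ∧ (toℕ i <ᵇ toℕ j))) ⟩
  ∑ (λ i → # (λ j → G i j ∧ (toℕ i <ᵇ toℕ j))) ∎
  where
  open ≡-Reasoning
  f : Fin n → ℕ
  f i = count (λ j → G i j ∧ (toℕ i <ᵇ toℕ j))

handshake : ∀ {n} (G : Graph n) → IsSimple G → degSum G ≡ 2 * edges G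
handshake {n} G (sym-G , irr) = begin
  ∑ (λ i → ∑ (λ j → ι (G i j)))                 ≡⟨ ∑-cong (λ i → ∑-cong (λ j → pw i j)) ⟩
  ∑ (λ i → ∑ (λ j → up i j + up j i))           ≡⟨ ∑-cong (λ i → ∑-distrib-+ (up i) (λ j → up j i)) ⟩
  ∑ (λ i → ∑ (up i) + ∑ (λ j → up j i))         ≡⟨ ∑-distrib-+ (λ i → ∑ (up i)) (λ i → ∑ (λ j → up j i)) ⟩
  U + ∑ (λ i → ∑ (λ j → up j i))                ≡⟨ cong (U +_) (∑-comm (λ i j → up j i)) ⟩
  U + U                                         ≡⟨ cong (U +_) (sym (+-identityʳ U)) ⟩
  2 * U                                         ≡⟨ cong (2 *_) (sym (edges≡∑ G)) ⟩
  2 * edges G                                   ∎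
  where
  open ≡-Reasoning
  up : Fin n → Fin n → ℕ
  up i j = ι (G i j ∧ (toℕ i <ᵇ toℕ j))
  U = ∑ (λ i → ∑ (up i))
  <ᵇ⁺ : ∀ {a b} → a < b → (a <ᵇ b) ≡ true
  <ᵇ⁺ {a} {b} h with a <ᵇ b | <⇒<ᵇ h
  ... | true | _ = refl
  <ᵇ⁻ : ∀ {a b} → ¬ a < b → (a <ᵇ b) ≡ false
  <ᵇ⁻ {a} {b} h with a <ᵇ b in eq
  ... | true = ⊥-elim (h (<ᵇ⇒< a b (subst Data.Bool.T (sym eq) tt)))
  ... | false = refl
  pw : ∀ i j → ι (G i j) ≡ up i j + up j i
  pw i j with <-cmp (toℕ i) (toℕ j)
  ... | tri< h _ h′ rewrite <ᵇ⁺ h | <ᵇ⁻ h′ | 𝔹.∧-zeroʳ (G j i) | 𝔹.∧-identityʳ (G i j) = sym (+-identityʳ _)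
  ... | tri> h′ _ h rewrite <ᵇ⁺ h | <ᵇ⁻ h′ | 𝔹.∧-zeroʳ (G i j) | 𝔹.∧-identityʳ (G j i) = cong ι (sym-G i j)
  ... | tri≈ _ e _ with 𝔽.toℕ-injective e
  ...   | refl rewrite irr i = refl

delete : ∀ {n} → Graph (suc n) → Fin (suc n) → Graph n
delete G v i j = G (punchIn v i) (punchIn v j)

delete-simple : ∀ {n} (G : Graph (suc n)) v → IsSimple G → IsSimple (delete G v)
delete-simple G v (s , irr) = (λ i j → s _ _) , (λ i → irr _)

delete-⊆ : ∀ {n} (G : Graph (suc n)) v → delete G v ⊆ᴳ G
delete-⊆ G v = punchIn v , 𝔽.punchIn-injective v _ _ , λ i j h → h

degSum-delete : ∀ {n} (G : Graph (suc n)) v → IsSimple G → degSum G ≡ degSum (delete G v) + 2 * deg G v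
degSum-delete {n} G v (s , irr) = begin
  degSum G                                      ≡⟨ sum-remove {i = v} (deg G) ⟩
  deg G v + ∑ (λ i → deg G (punchIn v i))        ≡⟨ cong (deg G v +_) (∑-cong (λ i → sum-remove {i = v} (λ j → ι (G (punchIn v i) j)))) ⟩
  deg G v + ∑ (λ i → ι (G (punchIn v i) v) + deg (delete G v) i) ≡⟨ cong (deg G v +_) (∑-distrib-+ (λ i → ι (G (punchIn v i) v)) (deg (delete G v))) ⟩
  deg G v + (∑ (λ i → ι (G (punchIn v i) v)) + degSum (delete G v)) ≡⟨ cong (λ z → deg G v + (z + degSum (delete G v))) row ⟩
  deg G v + (deg G v + degSum (delete G v))      ≡⟨ alg (deg G v) (degSum (delete G v)) ⟩
  degSum (delete G v) + 2 * deg G v              ∎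
  where
  open ≡-Reasoning
  alg : ∀ a b → a + (a + b) ≡ b + 2 * a
  alg = solve-∀
  row : ∑ (λ i → ι (G (punchIn v i) v)) ≡ deg G v
  row = begin
    ∑ (λ i → ι (G (punchIn v i) v))             ≡⟨ ∑-cong (λ i → cong ι (s (punchIn v i) v)) ⟩
    ∑ (λ i → ι (G v (punchIn v i)))             ≡⟨ cong (λ b → ι b + ∑ (λ i → ι (G v (punchIn v i)))) (sym (irr v)) ⟩
    ι (G v v) + ∑ (λ i → ι (G v (punchIn v i))) ≡⟨ sym (sum-remove {i = v} (λ j → ι (G v j))) ⟩
    deg G v                                     ∎

⊆ᴳ-trans : ∀ {l m n} {F : Graph l} {G : Graph m} {H : Graph n} → F ⊆ᴳ G → G ⊆ᴳ H → F ⊆ᴳ H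
⊆ᴳ-trans (f , fi , fe) (g , gi , ge) = g ∘ f , (λ e → fi (gi e)) , λ i j h → ge _ _ (fe i j h)

-- Vertex replacement

rewire : ∀ {n} → Graph n → Fin n → (Fin n → Bool) → Graph n
rewire G x ν i j = if ⌊ i ≟ x ⌋ then ν j else if ⌊ j ≟ x ⌋ then ν i else G i j

rewire-row : ∀ {n} (G : Graph n) x ν j → rewire G x ν x j ≡ ν j
rewire-row G x ν j with x ≟ x
... | yes _ = refl
... | no ¬p = ⊥-elim (¬p refl)

rewire-off : ∀ {n} (G : Graph n) x ν i j → i ≢ x → j ≢ x → rewire G x ν i j ≡ G i j
rewire-off G x ν i j p q with i ≟ x
... | yes e = ⊥-elim (p e)
... | no _ with j ≟ x
...   | yes e = ⊥-elim (q e)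
...   | no _ = refl

rewire-simple : ∀ {n} (G : Graph n) x ν → IsSimple G → ν x ≡ false → IsSimple (rewire G x ν)
rewire-simple G x ν (s , irr) νx = sy , ir
  where
  sy : ∀ i j → rewire G x ν i j ≡ rewire G x ν j i
  sy i j with i ≟ x | j ≟ x
  ... | yes refl | yes refl = refl
  ... | yes _ | no _ = refl
  ... | no _  | yes _ = refl
  ... | no _  | no _ = s i j
  ir : ∀ i → rewire G x ν i i ≡ false
  ir i with i ≟ x
  ... | yes refl = νx
  ... | no ¬p with i ≟ x
  ...   | yes e = ⊥-elim (¬p e)
  ...   | no _ = irr i

-- Deleting `x` gives the same graph before and after rewiring, so only the degree of `x` matters.
degSum-rewire : ∀ {n} (G : Graph n) x ν → IsSimple G → ν x ≡ false →
  degSum (rewire G x ν) + 2 * deg G x ≡ degSum G + 2 * # ν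
degSum-rewire {suc n} G x ν sG νx = begin
  degSum H + 2 * deg G x                          ≡⟨ cong (_+ 2 * deg G x) (degSum-delete H x (rewire-simple G x ν sG νx)) ⟩
  degSum (delete H x) + 2 * deg H x + 2 * deg G x ≡⟨ cong₂ (λ a b → a + 2 * b + 2 * deg G x) same (∑-cong (λ j → cong ι (rewire-row G x ν j))) ⟩
  degSum (delete G x) + 2 * # ν + 2 * deg G x     ≡⟨ alg (degSum (delete G x)) (# ν) (deg G x) ⟩
  degSum (delete G x) + 2 * deg G x + 2 * # ν     ≡⟨ cong (_+ 2 * # ν) (sym (degSum-delete G x sG)) ⟩
  degSum G + 2 * # ν                              ∎
  where
  open ≡-Reasoning
  H = rewire G x ν
  alg : ∀ a b c → a + 2 * b + 2 * c ≡ a + 2 * c + 2 * b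
  alg = solve-∀
  same : degSum (delete H x) ≡ degSum (delete G x)
  same = ∑-cong (λ i → ∑-cong (λ j → cong ι (rewire-off G x ν _ _ (𝔽.punchInᵢ≢i x i) (𝔽.punchInᵢ≢i x j))))

-- An embedding into the rewired graph that uses x can use a twin x′ instead, so rewiring creates no new subgraphs on at most t vertices.
rewire-embed : ∀ {m n} (F : Graph m) (G : Graph n) x ν (P : Fin n → Bool) →
  IsSimple G → ν x ≡ false → m < # P →
  (∀ x′ → P x′ ≡ true → ∀ z → ν z ≡ true → G x′ z ≡ true) →
  F ⊆ᴳ rewire G x ν → F ⊆ᴳ G
rewire-embed {m} {n} F G x ν P (s , irr) νx m<P tw (f , fi , fe) with #-witness Q Q≥1
  where
  Q : Fin n → Bool
  Q v = P v ∧ none (λ k v → ⌊ v ≟ f k ⌋) v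
  Q≥1 : 1 ≤ # Q
  Q≥1 = +-cancelʳ-≤ m 1 (# Q) (≤-trans m<P (≤-trans (#-avoid P (λ k v → ⌊ v ≟ f k ⌋)) (+-monoʳ-≤ (# Q)
          (≤-trans (∑-bound {c = 1} (λ k → ≤-reflexive (#-≟ (f k)))) (≤-reflexive (*-identityʳ m))))))
... | x′ , Qx′ = g , gi , ge
  where
  Px′ : P x′ ≡ true
  Px′ = proj₁ (∧-elim Qx′)
  fresh : ∀ k → x′ ≢ f k
  fresh k = ⌊⌋⁻′ (x′ ≟ f k) (none⁻ (λ k v → ⌊ v ≟ f k ⌋) x′ (proj₂ (∧-elim {P x′} Qx′)) k)
  g : Fin m → Fin n
  g k = if ⌊ f k ≟ x ⌋ then x′ else f k
  gi : Injective _≡_ _≡_ g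
  gi {a} {b} e with f a ≟ x | f b ≟ x
  ... | yes p | yes q = fi (trans p (sym q))
  ... | yes p | no q  = ⊥-elim (fresh b e)
  ... | no p  | yes q = ⊥-elim (fresh a (sym e))
  ... | no p  | no q  = fi e
  row : ∀ {u w} → u ≡ x → rewire G x ν u w ≡ true → ν w ≡ true
  row {w = w} refl e = trans (sym (rewire-row G x ν w)) e
  ge : ∀ a b → F a b ≡ true → G (g a) (g b) ≡ true
  ge a b h with f a ≟ x | f b ≟ x
  ... | yes p | yes q = ⊥-elim (true≢false (subst (λ z → ν z ≡ true) q (row p (fe a b h))) νx)
  ... | yes p | no q  = tw x′ Px′ (f b) (row p (fe a b h))
  ... | no p  | yes q = trans (s (f a) x′) (tw x′ Px′ (f a) (row q (trans (proj₁ (rewire-simple G x ν (s , irr) νx) (f b) (f a)) (fe a b h))))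
  ... | no p  | no q  = trans (sym (rewire-off G x ν (f a) (f b) p q)) (fe a b h)

-- Pigeonhole over the 2^d outcomes of d tests, and greedy selection

agree : ∀ {d n} → (Fin d → Fin n → Bool) → Fin n → Fin n → Bool
agree test x₀ x = ⌊ 𝔽.all? (λ k → test k x 𝔹.≟ test k x₀) ⌋

-- Each test splits `X` in two, and the recursion continues in a part that keeps half of the
-- required size. Points surviving all tests agree with `x₀` on every one.
popular : ∀ {n T} d (test : Fin d → Fin n → Bool) (X : Fin n → Bool) → suc T * 2 ^ d ≤ # X →
  ∃[ x₀ ] X x₀ ≡ true × suc T ≤ # (λ x → X x ∧ agree test x₀ x)
popular {n} {T} zero test X h with #-witness X (≤-trans (s≤s z≤n) (≤-trans (≤-reflexive (sym (*-identityʳ (suc T)))) h))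
... | x₀ , e = x₀ , e , ≤-trans (≤-trans (≤-reflexive (sym (*-identityʳ (suc T)))) h)
      (#-mono (λ v Xv → ∧-intro Xv (⌊⌋⁺ (𝔽.all? (λ k → test k v 𝔹.≟ test k x₀)) (λ ()))))
popular {n} {T} (suc d) test X h = go (suc T * 2 ^ d ≤? # X₁)
  where
  X₁ X₀ : Fin n → Bool
  X₁ v = X v ∧ test fzero v
  X₀ v = X v ∧ not (test fzero v)
  lift : ∀ (Y : Fin n → Bool) b → (∀ v → Y v ≡ true → X v ≡ true × test fzero v ≡ b) → suc T * 2 ^ d ≤ # Y →
    ∃[ x₀ ] X x₀ ≡ true × suc T ≤ # (λ x → X x ∧ agree test x₀ x)
  lift Y b hY big with popular d (test ∘ fsuc) Y big
  ... | x₀ , Yx₀ , c = x₀ , proj₁ (hY x₀ Yx₀) , ≤-trans c (#-mono mono)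
    where
    mono : ∀ v → Y v ∧ agree (test ∘ fsuc) x₀ v ≡ true → X v ∧ agree test x₀ v ≡ true
    mono v e with ∧-elim {Y v} e
    ... | Yv , ag = ∧-intro (proj₁ (hY v Yv)) (⌊⌋⁺ (𝔽.all? (λ k → test k v 𝔹.≟ test k x₀)) all)
      where
      all : ∀ k → test k v ≡ test k x₀
      all fzero    = trans (proj₂ (hY v Yv)) (sym (proj₂ (hY x₀ Yx₀)))
      all (fsuc k) = ⌊⌋⁻ (𝔽.all? (λ k → test (fsuc k) v 𝔹.≟ test (fsuc k) x₀)) ag k
  go : Dec (suc T * 2 ^ d ≤ # X₁) → ∃[ x₀ ] X x₀ ≡ true × suc T ≤ # (λ x → X x ∧ agree test x₀ x)
  go (yes big) = lift X₁ true (λ v e → ∧-elim {X v} e) big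
  go (no small) = lift X₀ false (λ v e → proj₁ (∧-elim {X v} e) , flip (proj₂ (∧-elim {X v} e))) (+-cancelˡ-≤ (suc T * 2 ^ d) _ _ (begin
      suc T * 2 ^ d + suc T * 2 ^ d ≡⟨ alg (suc T) (2 ^ d) ⟩
      suc T * (2 ^ d + (2 ^ d + 0)) ≤⟨ h ⟩
      # X                           ≤⟨ #-split X (test fzero) ⟩
      # X₁ + # X₀                   ≤⟨ +-monoˡ-≤ (# X₀) (<⇒≤ (≰⇒> small)) ⟩
      suc T * 2 ^ d + # X₀          ∎))
    where
    open ≤-Reasoning
    alg : ∀ a b → a * b + a * b ≡ a * (b + (b + 0))
    alg = solve-∀
    flip : ∀ {b} → not b ≡ true → b ≡ false
    flip {false} _ = refl

agree⁻ : ∀ {d n} (test : Fin d → Fin n → Bool) x₀ x → agree test x₀ x ≡ true → ∀ k → test k x ≡ test k x₀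
agree⁻ test x₀ x h = ⌊⌋⁻ (𝔽.all? (λ k → test k x 𝔹.≟ test k x₀)) h

-- Each vertex already chosen rules out at most `K` candidates, so more than `L * K` candidates
-- always leave a free one.
greedy : ∀ {n K} L (cand : Fin L → Fin n → Bool) (conf : Fin n → Fin n → Bool) →
  (∀ u v → conf u v ≡ conf v u) → (∀ u → # (conf u) ≤ K) → (∀ k → suc (L * K) ≤ # (cand k)) →
  Σ (Fin L → Fin n) λ f → (∀ k → cand k (f k) ≡ true) × (∀ k l → k ≢ l → conf (f k) (f l) ≡ false)
greedy zero cand conf sy cK h = (λ ()) , (λ ()) , λ ()
greedy {n} {K} (suc L) cand conf sy cK h
  with greedy L (cand ∘ fsuc) conf sy cK (λ k → ≤-trans (s≤s (m≤n+m (L * K) K)) (h (fsuc k)))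
... | f , fc , fn with #-witness Q Q≥1
  where
  Q : Fin n → Bool
  Q v = cand fzero v ∧ none (λ k → conf (f k)) v
  Q≥1 : 1 ≤ # Q
  Q≥1 = +-cancelʳ-≤ (L * K) 1 (# Q) (begin
    suc (L * K)     ≤⟨ s≤s (m≤n+m (L * K) K) ⟩
    suc (K + L * K) ≤⟨ h fzero ⟩
    # (cand fzero)  ≤⟨ #-avoid (cand fzero) (λ k → conf (f k)) ⟩
    # Q + ∑ (λ k → # (conf (f k))) ≤⟨ +-monoʳ-≤ (# Q) (∑-bound (λ k → cK (f k))) ⟩
    # Q + L * K     ∎)
    where open ≤-Reasoning
... | v , Qv = g , gc , gn
  where
  g : Fin (suc L) → Fin n
  g fzero    = v
  g (fsuc k) = f k
  gc : ∀ k → cand k (g k) ≡ true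
  gc fzero    = proj₁ (∧-elim Qv)
  gc (fsuc k) = fc k
  ok : ∀ k → conf (f k) v ≡ false
  ok = none⁻ (λ k → conf (f k)) v (proj₂ (∧-elim {cand fzero v} Qv))
  gn : ∀ k l → k ≢ l → conf (g k) (g l) ≡ false
  gn fzero fzero ne = ⊥-elim (ne refl)
  gn fzero (fsuc l) ne = trans (sy v (f l)) (ok l)
  gn (fsuc k) fzero ne = ok k
  gn (fsuc k) (fsuc l) ne = fn k l (ne ∘ cong fsuc)

-- Matchings

_∖_,_ : ∀ {n} → (Fin n → Bool) → Fin n → Fin n → Fin n → Bool
(X ∖ u , v) w = X w ∧ not (⌊ w ≟ u ⌋ ∨ ⌊ w ≟ v ⌋)

∖⁺ : ∀ {n} (X : Fin n → Bool) {u v w} → X w ≡ true → w ≢ u → w ≢ v → (X ∖ u , v) w ≡ true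
∖⁺ X {u} {v} {w} Xw p q rewrite Xw | ⌊⌋⁺′ (w ≟ u) p | ⌊⌋⁺′ (w ≟ v) q = refl

∖⁻ : ∀ {n} (X : Fin n → Bool) {u v w} → (X ∖ u , v) w ≡ true → X w ≡ true × w ≢ u × w ≢ v
∖⁻ X {u} {v} {w} h with X w | w ≟ u | w ≟ v
∖⁻ X h | true | no p | no q = refl , p , q

-- A matching of size `k` inside `X`, peeled off edge by edge, so that covers, lower bounds and
-- embeddings can all recurse on `k`.
Match : ∀ {n} → Graph n → (Fin n → Bool) → ℕ → Set
Match G X zero    = ⊤
Match G X (suc k) = ∃[ u ] ∃[ v ] X u ≡ true × X v ≡ true × G u v ≡ true × Match G (X ∖ u , v) k

-- Edges are taken greedily. If none remains before the `k`-th, the ends of those taken meet every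
-- edge inside `X`.
match-or-cover : ∀ {n} (G : Graph n) k X → Match G X k ⊎
  Σ (Fin n → Bool) λ M → # M ≤ k * 2 ×
    (∀ x y → X x ≡ true → X y ≡ true → M x ≡ false → M y ≡ false → G x y ≡ false)
match-or-cover G zero X = inj₁ tt
match-or-cover {n} G (suc k) X with 𝔽.any? (λ u → 𝔽.any? (λ v → (X u ∧ (X v ∧ G u v)) 𝔹.≟ true))
... | no ¬e = inj₂ ((λ _ → false) , ≤-trans (≤-reflexive (trans (∑-const n 0) (*-zeroʳ n))) z≤n ,
                 λ x y Xx Xy _ _ → not-true (λ Gxy → ¬e (x , y , ∧-intro Xx (∧-intro Xy Gxy))))
... | yes (u , v , e) with ∧-elim {X u} e
...   | Xu , e′ with ∧-elim {X v} e′ | match-or-cover G k (X ∖ u , v)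
...     | Xv , Guv | inj₁ m = inj₁ (u , v , Xu , Xv , Guv , m)
...     | Xv , Guv | inj₂ (M , small , cov) = inj₂ (M′ , size , cov′)
  where
  M′ : Fin n → Bool
  M′ w = (⌊ w ≟ u ⌋ ∨ ⌊ w ≟ v ⌋) ∨ M w
  pw : ∀ a b c → ι ((a ∨ b) ∨ c) ≤ (ι a + ι b) + ι c
  pw true b c = s≤s z≤n
  pw false true c = s≤s z≤n
  pw false false c = ≤-refl
  size : # M′ ≤ suc k * 2
  size = begin
    # M′ ≤⟨ ∑-mono (λ w → pw ⌊ w ≟ u ⌋ ⌊ w ≟ v ⌋ (M w)) ⟩
    ∑ (λ w → (ι ⌊ w ≟ u ⌋ + ι ⌊ w ≟ v ⌋) + ι (M w)) ≡⟨ ∑-distrib-+ (λ w → ι ⌊ w ≟ u ⌋ + ι ⌊ w ≟ v ⌋) (ι ∘ M) ⟩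
    ∑ (λ w → ι ⌊ w ≟ u ⌋ + ι ⌊ w ≟ v ⌋) + # M ≡⟨ cong (_+ # M) (∑-distrib-+ (λ w → ι ⌊ w ≟ u ⌋) (λ w → ι ⌊ w ≟ v ⌋)) ⟩
    (# (λ w → ⌊ w ≟ u ⌋) + # (λ w → ⌊ w ≟ v ⌋)) + # M ≡⟨ cong₂ (λ a b → (a + b) + # M) (#-≟ u) (#-≟ v) ⟩
    2 + # M ≤⟨ +-monoʳ-≤ 2 small ⟩
    2 + k * 2 ∎
    where open ≤-Reasoning
  off : ∀ w → M′ w ≡ false → w ≢ u × w ≢ v × M w ≡ false
  off w h with w ≟ u | w ≟ v | M w
  off w h | no p | no q | false = p , q , refl
  cov′ : ∀ x y → X x ≡ true → X y ≡ true → M′ x ≡ false → M′ y ≡ false → G x y ≡ false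
  cov′ x y Xx Xy mx my with off x mx | off y my
  ... | p , q , m | p′ , q′ , m′ = cov x y (∖⁺ X Xx p q) (∖⁺ X Xy p′ q′) m m′

#≤1⇒unique : ∀ {n} (p : Fin n → Bool) → # p ≤ 1 → ∀ a b → p a ≡ true → p b ≡ true → a ≡ b
#≤1⇒unique p h a b pa pb with a ≟ b
... | yes e = e
... | no ne = ⊥-elim (1+n≰n (≤-trans two h))
  where
  pw : ∀ k → ι ⌊ k ≟ a ⌋ + ι ⌊ k ≟ b ⌋ ≤ ι (p k)
  pw k with k ≟ a | k ≟ b
  ... | yes refl | yes q = ⊥-elim (ne q)
  ... | yes refl | no _ = ≤-reflexive (cong ι (sym pa))
  ... | no _ | yes refl = ≤-reflexive (cong ι (sym pb))
  ... | no _ | no _ = z≤n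
  two : 2 ≤ # p
  two = ≤-trans (≤-reflexive (sym (trans (∑-distrib-+ (λ k → ι ⌊ k ≟ a ⌋) (λ k → ι ⌊ k ≟ b ⌋)) (cong₂ _+_ (#-≟ a) (#-≟ b))))) (∑-mono pw)

#≥2⇒other : ∀ {n} (p : Fin n → Bool) → 2 ≤ # p → ∀ v → ∃[ z ] p z ≡ true × z ≢ v
#≥2⇒other p h v with pick p 2 h
... | f , inj , ok with f fzero ≟ v
...   | no ne = f fzero , ok fzero , ne
...   | yes e = f (fsuc fzero) , ok (fsuc fzero) , λ e′ → 𝔽.0≢1+n (inj (trans e (sym e′)))

nonIsolated : ∀ {n} → Graph n → (Fin n → Bool) → Fin n → Bool
nonIsolated G X v = X v ∧ ⌊ 𝔽.any? (λ u → (X u ∧ G v u) 𝔹.≟ true) ⌋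

nonIsolated⁺ : ∀ {n} (G : Graph n) X {v u} → X v ≡ true → X u ≡ true → G v u ≡ true → nonIsolated G X v ≡ true
nonIsolated⁺ G X {v} {u} Xv Xu e = ∧-intro Xv (⌊⌋⁺ (𝔽.any? (λ u → (X u ∧ G v u) 𝔹.≟ true)) (u , ∧-intro Xu e))

nonIsolated⁻ : ∀ {n} (G : Graph n) X {v} → nonIsolated G X v ≡ true → X v ≡ true × ∃[ u ] X u ≡ true × G v u ≡ true
nonIsolated⁻ G X {v} h with ∧-elim {X v} h
... | Xv , h′ with ⌊⌋⁻ (𝔽.any? (λ u → (X u ∧ G v u) 𝔹.≟ true)) h′
...   | u , e = Xv , u , ∧-elim {X u} e

-- Choosing v pendant whenever possible, removing an edge uv isolates only u and neighbours of u.
cheap-edge : ∀ {n} (G : Graph n) X → IsSimple G → 1 ≤ # (nonIsolated G X) →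
  ∃[ u ] ∃[ v ] X u ≡ true × X v ≡ true × G u v ≡ true ×
    (∀ w → nonIsolated G X w ≡ true →
      nonIsolated G (X ∖ u , v) w ≡ true ⊎ (w ≡ u ⊎ (X w ∧ G u w) ≡ true))
cheap-edge {n} G X (sG , irr) h = go (𝔽.any? (λ v → (X v 𝔹.≟ true) ×-dec (nb v Data.Nat.≟ 1)))
  where
  nbr : Fin n → Fin n → Bool
  nbr v w = X w ∧ G v w
  nb : Fin n → ℕ
  nb v = # (nbr v)
  Result = ∃[ u ] ∃[ v ] X u ≡ true × X v ≡ true × G u v ≡ true ×
    (∀ w → nonIsolated G X w ≡ true →
      nonIsolated G (X ∖ u , v) w ≡ true ⊎ (w ≡ u ⊎ (X w ∧ G u w) ≡ true))
  finish : ∀ u v → X u ≡ true → X v ≡ true → G u v ≡ true →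
    (∀ w → nonIsolated G X w ≡ true → w ≢ u → ∃[ z ] nbr w z ≡ true × z ≢ v) → Result
  finish u v Xu Xv Guv other = u , v , Xu , Xv , Guv , lost
    where
    lost : ∀ w → nonIsolated G X w ≡ true →
      nonIsolated G (X ∖ u , v) w ≡ true ⊎ (w ≡ u ⊎ (X w ∧ G u w) ≡ true)
    lost w nw = decide (w ≟ u) ((X w ∧ G u w) 𝔹.≟ true)
      where
      Xw : X w ≡ true
      Xw = proj₁ (nonIsolated⁻ G X nw)
      decide : Dec (w ≡ u) → Dec ((X w ∧ G u w) ≡ true) →
        nonIsolated G (X ∖ u , v) w ≡ true ⊎ (w ≡ u ⊎ (X w ∧ G u w) ≡ true)
      decide (yes e) _ = inj₂ (inj₁ e)
      decide (no _) (yes e) = inj₂ (inj₂ e)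
      decide (no w≢u) (no ¬e) with other w nw w≢u
      ... | z , e , z≢v with ∧-elim {X z} e
      ...   | Xz , Gwz = inj₁ (nonIsolated⁺ G (X ∖ u , v) (∖⁺ X Xw w≢u w≢v) (∖⁺ X Xz z≢u z≢v) Gwz)
        where
        w≢v : w ≢ v
        w≢v refl = ¬e (∧-intro Xw Guv)
        z≢u : z ≢ u
        z≢u refl = ¬e (∧-intro Xw (trans (sG u w) Gwz))
  go : Dec (∃[ v ] X v ≡ true × nb v ≡ 1) → Result
  go (yes (v , Xv , one)) with #-witness (nbr v) (≤-reflexive (sym one))
  ... | u , e with ∧-elim {X u} e
  ...   | Xu , Gvu = finish u v Xu Xv (trans (sG u v) Gvu) λ w nw w≢u → other w w≢u (nonIsolated⁻ G X nw)
    where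
    other : ∀ w → w ≢ u → X w ≡ true × ∃[ z ] X z ≡ true × G w z ≡ true → ∃[ z ] nbr w z ≡ true × z ≢ v
    other w w≢u (Xw , z , Xz , Gwz) = z , ∧-intro Xz Gwz ,
      λ { refl → w≢u (#≤1⇒unique (nbr v) (≤-reflexive one) w u (∧-intro Xw (trans (sG v w) Gwz)) e) }
  go (no ¬pend) with #-witness (nonIsolated G X) h
  ... | u , nu with nonIsolated⁻ G X nu
  ...   | Xu , v , Xv , Guv = finish u v Xu Xv Guv λ w nw _ → #≥2⇒other (nbr w) (two w (nonIsolated⁻ G X nw)) v
    where
    two : ∀ w → X w ≡ true × ∃[ z ] X z ≡ true × G w z ≡ true → 2 ≤ nb w
    two w (Xw , z , Xz , Gwz) = ≤∧≢⇒< (≤-trans (≤-reflexive (cong ι (sym (∧-intro Xz Gwz)))) (term≤∑ (λ z → ι (nbr w z)) z)) (λ e → ¬pend (w , Xw , sym e))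

ι-≤₃ : ∀ a b c d → (a ≡ true → b ≡ true ⊎ (c ≡ true ⊎ d ≡ true)) → ι a ≤ ι b + (ι c + ι d)
ι-≤₃ false b c d h = z≤n
ι-≤₃ true b c d h with h refl
... | inj₁ refl        = s≤s z≤n
... | inj₂ (inj₁ refl) = ≤-trans (s≤s z≤n) (m≤n+m _ (ι b))
... | inj₂ (inj₂ refl) = ≤-trans (m≤n+m 1 (ι c)) (m≤n+m _ (ι b))

-- A cheap edge `uv` spoils at most `suc Δ` non-isolated vertices: `u` and its at most `Δ`
-- neighbours in `X`, among them `v`.
nonIsolated⇒Match : ∀ {n} (G : Graph n) Δ → IsSimple G → ∀ k X →
  (∀ u → X u ≡ true → # (λ v → X v ∧ G u v) ≤ Δ) → suc Δ * k < # (nonIsolated G X) → Match G X (suc k)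
nonIsolated⇒Match {n} G Δ sG k X bd h with cheap-edge G X sG (≤-trans (s≤s z≤n) h)
... | u , v , Xu , Xv , Guv , lost = u , v , Xu , Xv , Guv , rest k h
  where
  X′ = X ∖ u , v
  pw : ∀ w → ι (nonIsolated G X w) ≤ ι (nonIsolated G X′ w) + (ι ⌊ w ≟ u ⌋ + ι (X w ∧ G u w))
  pw w = ι-≤₃ (nonIsolated G X w) (nonIsolated G X′ w) ⌊ w ≟ u ⌋ (X w ∧ G u w) λ nw →
    case lost w nw of λ where
      (inj₁ e)        → inj₁ e
      (inj₂ (inj₁ e)) → inj₂ (inj₁ (⌊⌋⁺ (w ≟ u) e))
      (inj₂ (inj₂ e)) → inj₂ (inj₂ e)
  few : # (nonIsolated G X) ≤ # (nonIsolated G X′) + suc Δ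
  few = begin
    # (nonIsolated G X) ≤⟨ ∑-mono pw ⟩
    ∑ (λ w → ι (nonIsolated G X′ w) + (ι ⌊ w ≟ u ⌋ + ι (X w ∧ G u w))) ≡⟨ ∑-distrib-+ (ι ∘ nonIsolated G X′) (λ w → ι ⌊ w ≟ u ⌋ + ι (X w ∧ G u w)) ⟩
    # (nonIsolated G X′) + ∑ (λ w → ι ⌊ w ≟ u ⌋ + ι (X w ∧ G u w)) ≡⟨ cong (# (nonIsolated G X′) +_) (trans (∑-distrib-+ (λ w → ι ⌊ w ≟ u ⌋) (λ w → ι (X w ∧ G u w))) (cong (_+ # (λ w → X w ∧ G u w)) (#-≟ u))) ⟩
    # (nonIsolated G X′) + suc (# (λ w → X w ∧ G u w)) ≤⟨ +-monoʳ-≤ (# (nonIsolated G X′)) (s≤s (bd u Xu)) ⟩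
    # (nonIsolated G X′) + suc Δ ∎
    where open ≤-Reasoning
  bd′ : ∀ w → X′ w ≡ true → # (λ z → X′ z ∧ G w z) ≤ Δ
  bd′ w e = ≤-trans (#-mono (λ z e′ → ∧-intro (proj₁ (∖⁻ X (proj₁ (∧-elim {X′ z} e′)))) (proj₂ (∧-elim {X′ z} e′)))) (bd w (proj₁ (∖⁻ X e)))
  rest : ∀ k → suc Δ * k < # (nonIsolated G X) → Match G X′ k
  rest zero    _ = tt
  rest (suc k) h = nonIsolated⇒Match G Δ sG k X′ bd′ (+-cancelʳ-≤ (suc Δ) _ _ (≤-trans (≤-trans (≤-reflexive (alg Δ k)) h) few))
    where
    alg : ∀ Δ k → suc (suc Δ * k) + suc Δ ≡ suc (suc Δ * suc k)
    alg = solve-∀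

-- Embeddings of the host graphs

glue : ∀ {a b n} → (Fin a → Fin n) → (Fin b → Fin n) → Fin (a + b) → Fin n
glue {a} f g i = [ f , g ]′ (splitAt a i)

glue-injective : ∀ {a b n} (f : Fin a → Fin n) (g : Fin b → Fin n) → Injective _≡_ _≡_ f → Injective _≡_ _≡_ g →
  (∀ i j → f i ≢ g j) → Injective _≡_ _≡_ (glue f g)
glue-injective {a} {b} f g fi gi d {x} {y} e with splitAt a x in ex | splitAt a y in ey
... | inj₁ i | inj₁ j = trans (sym (𝔽.splitAt⁻¹-↑ˡ ex)) (trans (cong (_↑ˡ b) (fi e)) (𝔽.splitAt⁻¹-↑ˡ ey))
... | inj₁ i | inj₂ j = ⊥-elim (d i j e)
... | inj₂ i | inj₁ j = ⊥-elim (d j i (sym e))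
... | inj₂ i | inj₂ j = trans (sym (𝔽.splitAt⁻¹-↑ʳ ex)) (trans (cong (a ↑ʳ_) (gi e)) (𝔽.splitAt⁻¹-↑ʳ ey))

module _ {a b n} {H₁ : Graph a} {H₂ : Graph b} {G : Graph n} where

  ∪ᴳ-embed : (e₁ : H₁ ⊆ᴳ G) (e₂ : H₂ ⊆ᴳ G) → (∀ i j → proj₁ e₁ i ≢ proj₁ e₂ j) → (H₁ ∪ᴳ H₂) ⊆ᴳ G
  ∪ᴳ-embed (f , fi , fe) (g , gi , ge) d = glue f g , glue-injective f g fi gi d , edge
    where
    edge : ∀ x y → (H₁ ∪ᴳ H₂) x y ≡ true → G (glue f g x) (glue f g y) ≡ true
    edge x y h with splitAt a x | splitAt a y
    ... | inj₁ i | inj₁ j = fe i j h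
    ... | inj₂ i | inj₂ j = ge i j h

  -- The two images are disjoint, since a common vertex would be adjacent to itself.
  ⊗-embed : IsSimple G → (e₁ : H₁ ⊆ᴳ G) (e₂ : H₂ ⊆ᴳ G) →
    (∀ i j → G (proj₁ e₁ i) (proj₁ e₂ j) ≡ true) → (H₁ ⊗ H₂) ⊆ᴳ G
  ⊗-embed (sG , irr) (f , fi , fe) (g , gi , ge) adj =
    glue f g , glue-injective f g fi gi (λ i j e → true≢false (subst (λ z → G (f i) z ≡ true) (sym e) (adj i j)) (irr (f i))) , edge
    where
    edge : ∀ x y → (H₁ ⊗ H₂) x y ≡ true → G (glue f g x) (glue f g y) ≡ true
    edge x y h with splitAt a x | splitAt a y
    ... | inj₁ i | inj₁ j = fe i j h
    ... | inj₁ i | inj₂ j = adj i j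
    ... | inj₂ i | inj₁ j = trans (sG (g i) (f j)) (adj j i)
    ... | inj₂ i | inj₂ j = ge i j h

Empty-embed : ∀ {s n} {G : Graph n} (f : Fin s → Fin n) → Injective _≡_ _≡_ f → Empty s ⊆ᴳ G
Empty-embed f fi = f , fi , λ i j ()

Kbip-embed : ∀ {a b n} {G : Graph n} → IsSimple G → (f : Fin a → Fin n) (g : Fin b → Fin n) →
  Injective _≡_ _≡_ f → Injective _≡_ _≡_ g → (∀ i j → G (f i) (g j) ≡ true) → Kbip a b ⊆ᴳ G
Kbip-embed {a} {b} {n} {G} sG f g fi gi adj = glue f g , proj₁ (proj₂ e) , edge
  where
  e = ⊗-embed {H₁ = Empty a} {H₂ = Empty b} {G = G} sG (Empty-embed {G = G} f fi) (Empty-embed {G = G} g gi) adj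
  edge : ∀ x y → Kbip a b x y ≡ true → G (glue f g x) (glue f g y) ≡ true
  edge x y h with splitAt a x | splitAt a y
  ... | inj₁ i | inj₂ j = adj i j
  ... | inj₂ i | inj₁ j = trans (proj₁ sG (g i) (f j)) (adj j i)

Match-embed : ∀ {n} (G : Graph n) → IsSimple G → ∀ k X → Match G X k →
  Σ (copies k K2 ⊆ᴳ G) λ e → ∀ i → X (proj₁ e i) ≡ true
Match-embed G sG zero X _ = ((λ ()) , (λ {}) , λ ()) , λ ()
Match-embed {n} G (sG , irr) (suc k) X (u , v , Xu , Xv , Guv , m) with Match-embed G (sG , irr) k (X ∖ u , v) m
... | (g , gi , ge) , gX = ∪ᴳ-embed {H₁ = K2} {H₂ = copies k K2} {G = G} (f , fi , fe) (g , gi , ge) disj , inX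
  where
  f : Fin 2 → Fin n
  f fzero = u
  f (fsuc _) = v
  u≢v : u ≢ v
  u≢v refl = true≢false Guv (irr u)
  fi : Injective _≡_ _≡_ f
  fi {fzero} {fzero} e = refl
  fi {fzero} {fsuc fzero} e = ⊥-elim (u≢v e)
  fi {fsuc fzero} {fzero} e = ⊥-elim (u≢v (sym e))
  fi {fsuc fzero} {fsuc fzero} e = refl
  fe : ∀ i j → K2 i j ≡ true → G (f i) (f j) ≡ true
  fe fzero (fsuc fzero) h = Guv
  fe (fsuc fzero) fzero h = trans (sG v u) Guv
  fe fzero fzero ()
  fe (fsuc fzero) (fsuc fzero) ()
  disj : ∀ i j → f i ≢ g j
  disj fzero j e = proj₁ (proj₂ (∖⁻ X (gX j))) (sym e)
  disj (fsuc _) j e = proj₂ (proj₂ (∖⁻ X (gX j))) (sym e)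
  inX : ∀ i → X (glue f g i) ≡ true
  inX i with splitAt 2 i
  ... | inj₁ fzero = Xu
  ... | inj₁ (fsuc _) = Xv
  ... | inj₂ j = proj₁ (∖⁻ X (gX j))

-- A copy of the complete `s`-partite graph with classes of size `t`, not necessarily induced: edges
-- inside a class are allowed.
KPart : ∀ {n} → Graph n → (s t : ℕ) → (Fin s → Fin t → Fin n) → Set
KPart G s t A = (∀ i → Injective _≡_ _≡_ (A i)) × (∀ i j a b → i ≢ j → G (A i a) (A j b) ≡ true)

toℕ-remQuot : ∀ t s (k : Fin (t * s)) → toℕ k ≡ s * toℕ (proj₁ (remQuot {t} s k)) + toℕ (proj₂ (remQuot {t} s k))
toℕ-remQuot t s k = trans (cong toℕ (sym (𝔽.combine-remQuot {t} s k))) (𝔽.toℕ-combine (proj₁ (remQuot {t} s k)) (proj₂ (remQuot {t} s k)))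

-- `remQuot` splits an index as `suc s * b + i`, so its second component is the Turán class and its
-- first the position in that class.
residue : ∀ t s (k : Fin (t * suc s)) → toℕ k % suc s ≡ toℕ (proj₂ (remQuot {t} (suc s) k))
residue t s k = begin
  toℕ k % suc s                    ≡⟨ cong (_% suc s) (trans (toℕ-remQuot t (suc s) k) (alg (suc s) (toℕ b) (toℕ i))) ⟩
  (toℕ i + toℕ b * suc s) % suc s  ≡⟨ [m+kn]%n≡m%n (toℕ i) (toℕ b) (suc s) ⟩
  toℕ i % suc s                    ≡⟨ m<n⇒m%n≡m (𝔽.toℕ<n i) ⟩
  toℕ i                            ∎
  where
  open ≡-Reasoning
  b = proj₁ (remQuot {t} (suc s) k)
  i = proj₂ (remQuot {t} (suc s) k)
  alg : ∀ s b i → s * b + i ≡ i + b * s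
  alg = solve-∀

≡ᵇ-refl : ∀ m → (m ≡ᵇ m) ≡ true
≡ᵇ-refl zero = refl
≡ᵇ-refl (suc m) = ≡ᵇ-refl m

Turan⇒≢ : ∀ t s (k l : Fin (t * suc s)) → Turan (t * suc s) (suc s) k l ≡ true →
  proj₂ (remQuot {t} (suc s) k) ≢ proj₂ (remQuot {t} (suc s) l)
Turan⇒≢ t s k l h e = true≢false h (cong not (trans (cong₂ _≡ᵇ_ (trans (residue t s k) (cong toℕ e)) (residue t s l)) (≡ᵇ-refl (toℕ (proj₂ (remQuot {t} (suc s) l))))))

Turan-embed : ∀ {n} (G : Graph n) s t (A : Fin (suc s) → Fin t → Fin n) → IsSimple G → KPart G (suc s) t A →
  Σ (Turan (t * suc s) (suc s) ⊆ᴳ G) λ e → ∀ k → ∃[ i ] ∃[ b ] proj₁ e k ≡ A i b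
Turan-embed {n} G s t A (sG , irr) (inj , adj) = (f , fi , fe) , λ k → _ , _ , refl
  where
  cls : Fin (t * suc s) → Fin (suc s)
  cls k = proj₂ (remQuot {t} (suc s) k)
  pos : Fin (t * suc s) → Fin t
  pos k = proj₁ (remQuot {t} (suc s) k)
  f : Fin (t * suc s) → Fin n
  f k = A (cls k) (pos k)
  fe : ∀ k l → Turan (t * suc s) (suc s) k l ≡ true → G (f k) (f l) ≡ true
  fe k l h = adj _ _ _ _ (Turan⇒≢ t s k l h)
  same : ∀ i j a b → A i a ≡ A j b → i ≡ j × a ≡ b
  same i j a b e with i ≟ j
  ... | yes refl = refl , inj i e
  ... | no ne = ⊥-elim (true≢false (adj i j a b ne) (trans (cong (λ z → G z (A j b)) e) (irr (A j b))))
  fi : Injective _≡_ _≡_ f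
  fi {k} {l} e with same _ _ _ _ e
  ... | p , q = trans (sym (𝔽.combine-remQuot {t} (suc s) k)) (trans (cong₂ combine q p) (𝔽.combine-remQuot {t} (suc s) l))

-- Large complete multipartite subgraphs and near-colourings under a minimum degree condition

∑-drop₁ : ∀ {s T T′} (f : Fin s → ℕ) i → (∀ k → f k ≤ T) → f i ≤ T′ → ∑ f + T ≤ s * T + T′
∑-drop₁ {s} {T} {T′} f i h hi = begin
  ∑ f + T                                       ≡⟨ cong (∑ f +_) (sym (∑-≟ i T)) ⟩
  ∑ f + ∑ (λ k → ι ⌊ k ≟ i ⌋ * T)               ≡⟨ sym (∑-distrib-+ f (λ k → ι ⌊ k ≟ i ⌋ * T)) ⟩
  ∑ (λ k → f k + ι ⌊ k ≟ i ⌋ * T)               ≤⟨ ∑-mono pw ⟩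
  ∑ (λ k → T + ι ⌊ k ≟ i ⌋ * T′)                ≡⟨ ∑-distrib-+ (λ _ → T) (λ k → ι ⌊ k ≟ i ⌋ * T′) ⟩
  ∑ {s} (λ _ → T) + ∑ (λ k → ι ⌊ k ≟ i ⌋ * T′)  ≡⟨ cong₂ _+_ (∑-const s T) (∑-≟ i T′) ⟩
  s * T + T′                                    ∎
  where
  open ≤-Reasoning
  pw : ∀ k → f k + ι ⌊ k ≟ i ⌋ * T ≤ T + ι ⌊ k ≟ i ⌋ * T′
  pw k with k ≟ i
  ... | yes refl = ≤-trans (+-mono-≤ hi (≤-reflexive (+-identityʳ T))) (≤-reflexive (trans (+-comm T′ T) (cong (T +_) (sym (+-identityʳ T′)))))
  ... | no _ = +-monoˡ-≤ 0 (h k)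

∑-drop₂ : ∀ {s T a b} (f : Fin s → ℕ) i j → i ≢ j → (∀ k → f k ≤ T) → f i ≤ a → f j ≤ b → a ≤ T →
  ∑ f + T + T ≤ s * T + a + b
∑-drop₂ {s} {T} {a} {b} f i j i≢j h hi hj a≤T = begin
  ∑ f + T + T                    ≡⟨ cong (_+ T) (cong (∑ f +_) (sym (∑-≟ i T))) ⟩
  ∑ f + ∑ (λ k → ι ⌊ k ≟ i ⌋ * T) + T ≡⟨ cong (_+ T) (sym (∑-distrib-+ f (λ k → ι ⌊ k ≟ i ⌋ * T))) ⟩
  ∑ f′ + T                       ≤⟨ +-monoˡ-≤ T (∑-mono pw) ⟩
  ∑ (λ k → g k + ι ⌊ k ≟ i ⌋ * a) + T ≡⟨ cong (_+ T) (trans (∑-distrib-+ g (λ k → ι ⌊ k ≟ i ⌋ * a)) (cong (∑ g +_) (∑-≟ i a))) ⟩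
  ∑ g + a + T                    ≡⟨ alg (∑ g) a T ⟩
  ∑ g + T + a                    ≤⟨ +-monoˡ-≤ a (∑-drop₁ g j gT gj) ⟩
  s * T + b + a                  ≡⟨ alg (s * T) b a ⟩
  s * T + a + b                  ∎
  where
  open ≤-Reasoning
  alg : ∀ x y z → x + y + z ≡ x + z + y
  alg = solve-∀
  f′ g : Fin s → ℕ
  f′ k = f k + ι ⌊ k ≟ i ⌋ * T
  g k = if ⌊ k ≟ i ⌋ then T else f k
  gT : ∀ k → g k ≤ T
  gT k with k ≟ i
  ... | yes _ = ≤-refl
  ... | no _ = h k
  gj : g j ≤ b
  gj with j ≟ i
  ... | yes e = ⊥-elim (i≢j (sym e))
  ... | no _ = hj
  pw : ∀ k → f′ k ≤ g k + ι ⌊ k ≟ i ⌋ * a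
  pw k with k ≟ i
  ... | yes refl = ≤-trans (+-mono-≤ hi (≤-reflexive (+-identityʳ T))) (≤-reflexive (trans (+-comm a T) (cong (T +_) (sym (+-identityʳ a)))))
  ... | no _ = ≤-refl

module _ {n} (G : Graph n) {s T} (A : Fin s → Fin T → Fin n) where

  nbrs : Fin s → Fin n → ℕ
  nbrs i x = # (λ b → G x (A i b))

  allNbrs : Fin n → ℕ
  allNbrs x = ∑ (λ i → nbrs i x)

  nbrs≤ : ∀ i x → nbrs i x ≤ T
  nbrs≤ i x = #≤n (λ b → G x (A i b))

  -- Double counting of the edges between `A` and the whole vertex set, with the degree condition
  -- applied to the vertices of `A`.
  allNbrs-lower : IsSimple G → ∀ {r₁ c} → (∀ v → r₁ * n ≤ suc r₁ * deg G v + c) →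
    s * (T * (r₁ * n)) ≤ suc r₁ * ∑ allNbrs + s * (T * c)
  allNbrs-lower (sG , _) {r₁} {c} δ = begin
    s * (T * (r₁ * n))                                        ≤⟨ ∑-lower (λ i → ∑-lower (λ b → δ (A i b))) ⟩
    ∑ (λ i → ∑ (λ b → suc r₁ * deg G (A i b) + c))            ≡⟨ ∑-cong (λ i → trans (∑-distrib-+ (λ b → suc r₁ * deg G (A i b)) (λ _ → c)) (cong₂ _+_ (∑-*ˡ (suc r₁) (λ b → deg G (A i b))) (∑-const T c))) ⟩
    ∑ (λ i → suc r₁ * ∑ (λ b → deg G (A i b)) + T * c)        ≡⟨ trans (∑-distrib-+ (λ i → suc r₁ * ∑ (λ b → deg G (A i b))) (λ _ → T * c)) (cong₂ _+_ (∑-*ˡ (suc r₁) (λ i → ∑ (λ b → deg G (A i b)))) (∑-const s (T * c))) ⟩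
    suc r₁ * ∑ (λ i → ∑ (λ b → deg G (A i b))) + s * (T * c)  ≡⟨ cong (λ z → suc r₁ * z + s * (T * c)) (∑-cong (λ i → trans (∑-cong (λ b → ∑-cong (λ x → cong ι (sG (A i b) x)))) (∑-comm (λ b x → ι (G x (A i b)))))) ⟩
    suc r₁ * ∑ (λ i → ∑ (nbrs i)) + s * (T * c)               ≡⟨ cong (λ z → suc r₁ * z + s * (T * c)) (∑-comm nbrs) ⟩
    suc r₁ * ∑ allNbrs + s * (T * c)                          ∎
    where open ≤-Reasoning

  rich : ℕ → Fin n → Bool
  rich k x = ⌊ 𝔽.all? (λ i → k ≤? nbrs i x) ⌋

  -- The tests are the adjacencies to all `s * T` vertices of `A`. Rich vertices with equal outcomes
  -- share `k` neighbours in every class, hence are completely joined to a smaller complete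
  -- `s`-partite graph.
  rich-popular : ∀ k m → suc m * 2 ^ (s * T) ≤ # (rich k) →
    Σ (Fin s → Fin k → Fin T) λ g → Σ (Fin (suc m) → Fin n) λ f →
      (∀ i → Injective _≡_ _≡_ (g i)) × Injective _≡_ _≡_ f × (∀ a i b → G (f a) (A i (g i b)) ≡ true)
  rich-popular k m big with popular (s * T) test (rich k) big
    where
    test : Fin (s * T) → Fin n → Bool
    test j x = G x (A (proj₁ (remQuot {s} T j)) (proj₂ (remQuot {s} T j)))
  ... | x₀ , rx₀ , many with pick _ (suc m) many
  ...   | f , fi , fok = (λ i → proj₁ (choose i)) , f , (λ i → proj₁ (proj₂ (choose i))) , fi , adj
    where
    test : Fin (s * T) → Fin n → Bool
    test j x = G x (A (proj₁ (remQuot {s} T j)) (proj₂ (remQuot {s} T j)))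
    choose : ∀ i → Σ (Fin k → Fin T) λ g → Injective _≡_ _≡_ g × (∀ b → G x₀ (A i (g b)) ≡ true)
    choose i = pick (λ b → G x₀ (A i b)) k (⌊⌋⁻ (𝔽.all? (λ i → k ≤? nbrs i x₀)) rx₀ i)
    adj : ∀ a i b → G (f a) (A i (proj₁ (choose i) b)) ≡ true
    adj a i b = trans (same (combine i (proj₁ (choose i) b)) (𝔽.remQuot-combine i (proj₁ (choose i) b))) (proj₂ (proj₂ (choose i)) b)
      where
      same : ∀ j → remQuot {s} T j ≡ (i , proj₁ (choose i) b) → G (f a) (A i (proj₁ (choose i) b)) ≡ G x₀ (A i (proj₁ (choose i) b))
      same j e = subst (λ ib → G (f a) (A (proj₁ ib) (proj₂ ib)) ≡ G x₀ (A (proj₁ ib) (proj₂ ib))) e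
        (agree⁻ test x₀ (f a) (proj₂ (∧-elim {rich k (f a)} (fok a))) j)

  KPart-restrict : KPart G s T A → ∀ {k} (g : Fin s → Fin k → Fin T) → (∀ i → Injective _≡_ _≡_ (g i)) →
    KPart G s k (λ i b → A i (g i b))
  KPart-restrict (inj , adj) g gi = (λ i e → gi i (inj i e)) , λ i j a b → adj i j (g i a) (g j b)

  rich-bound : ∀ k m → KPart G s T A →
    (∀ (f : Fin (suc m) → Fin n) (B : Fin s → Fin k → Fin n) → Injective _≡_ _≡_ f → KPart G s k B → (∀ a i b → G (f a) (B i b) ≡ true) → ⊥) →
    # (rich k) ≤ suc m * 2 ^ (s * T)
  rich-bound k m kA avoid = ≮⇒≥ λ big → case rich-popular k m (<⇒≤ big) of λ where
    (g , f , gi , fi , adj) → avoid f (λ i b → A i (g i b)) fi (KPart-restrict kA g gi) adj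

-- Induction on the number of classes: many vertices rich towards a much larger `s`-partite graph
-- supply the next class. If there were few, the double count would bound `n`.
KPart-exists : ∀ r₁ c s → s ≤ suc r₁ → ∀ T′ → ∃[ n₀ ] ∀ n → n₀ ≤ n → (G : Graph n) → IsSimple G →
  (∀ v → r₁ * n ≤ suc r₁ * deg G v + c) → Σ (Fin s → Fin T′ → Fin n) (KPart G s T′)
KPart-exists r₁ c zero _ T′ = 0 , λ n _ G _ _ → (λ ()) , (λ ()) , λ ()
KPart-exists r₁ c (suc s) (s≤s s≤r₁) T′ with m≤n⇒∃[o]m+o≡n s≤r₁ | KPart-exists r₁ c s (m≤n⇒m≤1+n s≤r₁) (suc (suc r₁ * T′))
... | e , refl | n₁ , find = n₁ ⊔ suc B , build
  where
  r T N B : ℕ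
  r = suc (s + e)
  -- A vertex has on average about `s * T * r₁ / r` neighbours in `A`, that is,
  -- `(s − 1) * T + (r − s) * T / r`. This exceeds the limit `(s − 1) * T + T′` for vertices that
  -- are not rich, because `r > s` and `T > r * T′`.
  T = suc (r * T′)
  N = suc T′ * 2 ^ (s * T)
  B = r * (N * T) + s * (T * c)
  build : ∀ n → n₁ ⊔ suc B ≤ n → (G : Graph n) → IsSimple G →
    (∀ v → (s + e) * n ≤ r * deg G v + c) → Σ (Fin (suc s) → Fin T′ → Fin n) (KPart G (suc s) T′)
  build n n≥ G sG δ with find n (≤-trans (m≤m⊔n n₁ (suc B)) n≥) G sG δ
  ... | A , kA with N ≤? # (rich G A T′)
  ...   | yes big with rich-popular G A T′ T′ big
  ...     | g , f , gi , fi , adj = A′ , inj , adj′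
    where
    A′ : Fin (suc s) → Fin T′ → Fin n
    A′ fzero    b = f (fsuc b)
    A′ (fsuc i) b = A i (g i b)
    k′ = KPart-restrict G A kA g gi
    inj : ∀ i → Injective _≡_ _≡_ (A′ i)
    inj fzero    e = 𝔽.suc-injective (fi e)
    inj (fsuc i) e = proj₁ k′ i e
    adj′ : ∀ i j a b → i ≢ j → G (A′ i a) (A′ j b) ≡ true
    adj′ fzero fzero a b ne = ⊥-elim (ne refl)
    adj′ fzero (fsuc j) a b ne = adj (fsuc a) j b
    adj′ (fsuc i) fzero a b ne = trans (proj₁ sG _ _) (adj (fsuc b) i a)
    adj′ (fsuc i) (fsuc j) a b ne = proj₂ k′ i j a b (ne ∘ cong fsuc)
  build n n≥ G sG δ | A , kA | no small = ⊥-elim (1+n≰n (≤-trans (≤-trans (m≤n⊔m n₁ (suc B)) n≥) n≤B))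
    where
    X = rich G A T′
    S = ∑ (allNbrs G A)
    pw : ∀ x → allNbrs G A x + T ≤ s * T + T′ + ι (X x) * T
    pw x with 𝔽.all? (λ i → T′ ≤? nbrs G A i x)
    ... | yes _ = ≤-trans (+-monoˡ-≤ T (≤-trans (∑-bound (λ i → nbrs≤ G A i x)) (m≤m+n (s * T) T′))) (≤-reflexive (cong (s * T + T′ +_) (sym (+-identityʳ T))))
    ... | no ¬all with 𝔽.¬∀⟶∃¬ s _ (λ i → T′ ≤? nbrs G A i x) ¬all
    ...   | i , ¬h = ≤-trans (∑-drop₁ (λ i → nbrs G A i x) i (λ i → nbrs≤ G A i x) (<⇒≤ (≰⇒> ¬h))) (m≤m+n _ 0)
    upper : S + n * T ≤ n * (s * T + T′) + # X * T
    upper = begin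
      S + n * T                                     ≡⟨ cong (S +_) (sym (∑-const n T)) ⟩
      S + ∑ {n} (λ _ → T)                           ≡⟨ sym (∑-distrib-+ (allNbrs G A) (λ _ → T)) ⟩
      ∑ (λ x → allNbrs G A x + T)                   ≤⟨ ∑-mono pw ⟩
      ∑ (λ x → s * T + T′ + ι (X x) * T)            ≡⟨ ∑-distrib-+ (λ _ → s * T + T′) (λ x → ι (X x) * T) ⟩
      ∑ {n} (λ _ → s * T + T′) + ∑ (λ x → ι (X x) * T) ≡⟨ cong₂ _+_ (∑-const n (s * T + T′)) (∑-*ʳ T (ι ∘ X)) ⟩
      n * (s * T + T′) + # X * T                    ∎
      where open ≤-Reasoning
    n≤B : n ≤ B
    n≤B = lin (n * T * e) (+-mono-≤ (+-mono-≤ (allNbrs-lower G A sG {s + e} {c} δ) (*-monoʳ-≤ r upper)) (*-monoʳ-≤ r (*-monoˡ-≤ T (<⇒≤ (≰⇒> small)))))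
      (alg n s e T′ c (# X) S N)
      where
      alg : ∀ n s e T′ c x S N → let r = suc (s + e) ; T = suc (r * T′) in
        n + (r * S + s * (T * c) + r * (n * (s * T + T′) + x * T) + r * (N * T)) + n * T * e
        ≡ r * (N * T) + s * (T * c) + (s * (T * ((s + e) * n)) + r * (S + n * T) + r * (x * T))
      alg = solve-∀

⊗Turan-embed : ∀ {n m s t} {H : Graph m} (G : Graph n) → IsSimple G → (e : H ⊆ᴳ G) (A : Fin (suc s) → Fin t → Fin n) →
  KPart G (suc s) t A → (∀ k i b → G (proj₁ e k) (A i b) ≡ true) → (H ⊗ Turan (t * suc s) (suc s)) ⊆ᴳ G
⊗Turan-embed {s = s} {t} G sG e A kA adj with Turan-embed G s t A sG kA
... | e′ , im = ⊗-embed {G = G} sG e e′ λ k l → subst (λ z → G (proj₁ e k) z ≡ true) (sym (proj₂ (proj₂ (im l)))) (adj k _ _)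

-- `C i` holds the vertices almost complete to all classes of `A` but the `i`-th. It contains no
-- large matching, so removing a small cover `M i` makes it independent; what is left provides
-- colour `i`.
module NearColouring {n} (G : Graph n) (sG : IsSimple G) (r₁ c t μ T′ N : ℕ)
  (δ : ∀ v → r₁ * n ≤ suc r₁ * deg G v + c) (μ≥ : 3 * t ≤ μ) (T′≥ : t + (t * 2) * μ ≤ T′)
  (A : Fin (suc r₁) → Fin (T′ + t * 2) → Fin n) (kA : KPart G (suc r₁) (T′ + t * 2) A)
  (fewRich : # (rich G A t) ≤ N)
  (noX₁ : (e : copies t K2 ⊆ᴳ G) (B : Fin r₁ → Fin t → Fin n) → KPart G r₁ t B →
    (∀ k i b → G (proj₁ e k) (B i b) ≡ true) → ⊥) where

  r T : ℕ
  r = suc r₁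
  T = T′ + t * 2

  miss : Fin r → Fin n → ℕ
  miss j x = # (λ b → not (G x (A j b)))
  near? : ∀ i x → Dec (∀ j → j ≡ i ⊎ miss j x ≤ μ)
  near? i x = 𝔽.all? (λ j → (j ≟ i) ⊎-dec (miss j x ≤? μ))
  C : Fin r → Fin n → Bool
  C i x = ⌊ near? i x ⌋

  -- The `t * 2` ends of such a matching miss at most `(t * 2) * μ` vertices of any other class, so
  -- `t` common neighbours remain in each: the host of `F₁`.
  noMatch : ∀ i → ¬ Match G (C i) t
  noMatch i m with Match-embed G sG t (C i) m
  ... | e , inC = noX₁ e (λ j b → A (punchIn i j) (g j b))
          ((λ j e → gi j (proj₁ kA _ e)) , λ j k a b ne → proj₂ kA _ _ _ _ (ne ∘ 𝔽.punchIn-injective i j k))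
          (λ k j b → gok j b k)
    where
    bad : Fin r₁ → Fin (t * 2) → Fin T → Bool
    bad j k b = not (G (proj₁ e k) (A (punchIn i j) b))
    enough : ∀ j → t ≤ # (λ b → none (bad j) b)
    enough j = +-cancelʳ-≤ ((t * 2) * μ) t _ (begin
      t + (t * 2) * μ                               ≤⟨ T′≥ ⟩
      T′                                            ≤⟨ m≤m+n T′ (t * 2) ⟩
      T                                             ≡⟨ sym (trans (∑-const T 1) (*-identityʳ T)) ⟩
      # {T} (λ _ → true)                            ≤⟨ #-avoid (λ _ → true) (bad j) ⟩
      # (none (bad j)) + ∑ (λ k → # (bad j k))      ≤⟨ +-monoʳ-≤ (# (none (bad j))) (∑-bound bd) ⟩
      # (none (bad j)) + (t * 2) * μ                ∎)
      where
      open ≤-Reasoning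
      bd : ∀ k → # (bad j k) ≤ μ
      bd k with ⌊⌋⁻ (near? i (proj₁ e k)) (inC k) (punchIn i j)
      ... | inj₁ eq = ⊥-elim (𝔽.punchInᵢ≢i i j eq)
      ... | inj₂ h = h
    choose : ∀ j → Σ (Fin t → Fin T) λ g → Injective _≡_ _≡_ g × (∀ b → none (bad j) (g b) ≡ true)
    choose j = pick (none (bad j)) t (enough j)
    g : Fin r₁ → Fin t → Fin T
    g j = proj₁ (choose j)
    gi : ∀ j → Injective _≡_ _≡_ (g j)
    gi j = proj₁ (proj₂ (choose j))
    gok : ∀ j b k → G (proj₁ e k) (A (punchIn i j) (g j b)) ≡ true
    gok j b k = trans (sym (𝔹.not-involutive _)) (cong not (none⁻ (bad j) (g j b) (proj₂ (proj₂ (choose j)) b) k))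

  abstract
    cover : ∀ i → Σ (Fin n → Bool) λ M → # M ≤ t * 2 ×
      (∀ x y → C i x ≡ true → C i y ≡ true → M x ≡ false → M y ≡ false → G x y ≡ false)
    cover i with match-or-cover G t (C i)
    ... | inj₁ m = ⊥-elim (noMatch i m)
    ... | inj₂ c = c
  M : Fin r → Fin n → Bool
  M i = proj₁ (cover i)

  good? : ∀ x → Dec (∃[ i ] (C i x ∧ not (M i x)) ≡ true)
  good? x = 𝔽.any? (λ i → (C i x ∧ not (M i x)) 𝔹.≟ true)
  ℓ : Fin n → Fin (suc r)
  ℓ x with good? x
  ... | yes (i , _) = fsuc i
  ... | no _ = fzero
  ℓ⁻ : ∀ x i → ℓ x ≡ fsuc i → C i x ≡ true × M i x ≡ false
  ℓ⁻ x i e with good? x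
  ℓ⁻ x i refl | yes (.i , h) with ∧-elim {C i x} h
  ... | Cx , nM = Cx , trans (sym (𝔹.not-involutive _)) (cong not nM)
  ℓ-cases : ∀ x → (∃[ i ] ℓ x ≡ fsuc i) ⊎ (∀ i → ¬ (C i x ∧ not (M i x)) ≡ true)
  ℓ-cases x with good? x
  ... | yes (i , _) = inj₁ (i , refl)
  ... | no ¬g = inj₂ λ i h → ¬g (i , h)
  indep : ∀ x y i → ℓ x ≡ fsuc i → ℓ y ≡ fsuc i → G x y ≡ false
  indep x y i ex ey with ℓ⁻ x i ex | ℓ⁻ y i ey
  ... | Cx , Mx | Cy , My = proj₂ (proj₂ (cover i)) x y Cx Cy Mx My
  bad : Fin n → Bool
  bad x = ⌊ ℓ x ≟ fzero ⌋

  abstract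
    -- The `t * 2` spare vertices in each class of `A` make up for those lost to the cover `M i`.
    chooseA : ∀ i → Σ (Fin T′ → Fin T) λ g → Injective _≡_ _≡_ g × (∀ b → not (M i (A i (g b))) ≡ true)
    chooseA i = pick (λ b → not (M i (A i b))) T′ (+-cancelˡ-≤ (t * 2) _ _ (begin
      t * 2 + T′                                            ≡⟨ +-comm (t * 2) T′ ⟩
      T                                                     ≡⟨ sym (#-compl (λ b → M i (A i b))) ⟩
      # (M i ∘ A i) + # (λ b → not (M i (A i b)))           ≤⟨ +-monoˡ-≤ _ (≤-trans (#-pullback (A i) (proj₁ kA i) (M i)) (proj₁ (proj₂ (cover i)))) ⟩
      t * 2 + # (λ b → not (M i (A i b)))                   ∎))
      where open ≤-Reasoning
  A′ : Fin r → Fin T′ → Fin n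
  A′ i b = A i (proj₁ (chooseA i) b)
  A∈C : ∀ i b → C i (A i b) ≡ true
  A∈C i b = ⌊⌋⁺ (near? i (A i b)) in-near
    where
    in-near : ∀ j → j ≡ i ⊎ miss j (A i b) ≤ μ
    in-near j with j ≟ i
    ... | yes e = inj₁ e
    ... | no ne = inj₂ (≤-trans (≤-reflexive (trans (∑-cong (λ a → cong (ι ∘ not) (proj₂ kA i j b a (ne ∘ sym)))) (trans (∑-const T 0) (*-zeroʳ T)))) z≤n)
  nb = nbrs G A′
  nb≤ : ∀ i x → nb i x ≤ nbrs G A i x
  nb≤ i x = #-pullback (proj₁ (chooseA i)) (proj₁ (proj₂ (chooseA i))) (λ b → G x (A i b))

  W = rich G A t
  exc : Fin n → ℕ
  exc x = ι (W x) + ∑ (λ i → ι (M i x))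
  -- A coloured vertex sees nothing of `A′` in its own colour, and an uncoloured unexceptional one
  -- sees strictly less than `r₁ * T′` in all. The term with `exc x` pays for rich vertices and
  -- members of covers, of which there are boundedly many.
  pw : ∀ x → allNbrs G A′ x + ι (bad x) ≤ r₁ * T′ + suc T′ * exc x
  pw x = byExc (1 ≤? exc x)
    where
    byExc : Dec (1 ≤ exc x) → allNbrs G A′ x + ι (bad x) ≤ r₁ * T′ + suc T′ * exc x
    byExc (yes h) = begin
      allNbrs G A′ x + ι (bad x) ≤⟨ +-mono-≤ (∑-bound (λ i → nbrs≤ G A′ i x)) (ι≤1 (bad x)) ⟩
      r * T′ + 1                 ≡⟨ alg r₁ T′ ⟩
      r₁ * T′ + suc T′ * 1       ≤⟨ +-monoʳ-≤ (r₁ * T′) (*-monoʳ-≤ (suc T′) h) ⟩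
      r₁ * T′ + suc T′ * exc x   ∎
      where
      open ≤-Reasoning
      alg : ∀ r₁ T′ → suc r₁ * T′ + 1 ≡ r₁ * T′ + suc T′ * 1
      alg = solve-∀
    byExc (no h) = ≤-trans main (m≤m+n _ _)
      where
      exc0 : exc x ≡ 0
      exc0 = n<1⇒n≡0 (≰⇒> h)
      notRich : W x ≡ false
      notRich = not-true λ e → 1+n≰n (≤-trans (≤-trans (≤-reflexive (cong ι (sym e))) (m≤m+n (ι (W x)) _)) (≤-reflexive exc0))
      notM : ∀ i → M i x ≡ false
      notM i = not-true λ e → 1+n≰n (≤-trans (≤-trans (≤-trans (≤-reflexive (cong ι (sym e))) (term≤∑ (λ i → ι (M i x)) i)) (m≤n+m _ (ι (W x)))) (≤-reflexive exc0))
      main : allNbrs G A′ x + ι (bad x) ≤ r₁ * T′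
      main = go (ℓ-cases x)
        where
        go : (∃[ i ] ℓ x ≡ fsuc i) ⊎ (∀ i → ¬ (C i x ∧ not (M i x)) ≡ true) → allNbrs G A′ x + ι (bad x) ≤ r₁ * T′
        go (inj₁ (i , eq)) = +-cancelʳ-≤ T′ _ _ (begin
          allNbrs G A′ x + ι (bad x) + T′  ≡⟨ cong (λ b → allNbrs G A′ x + ι b + T′) (⌊⌋⁺′ (ℓ x ≟ fzero) (λ e → 𝔽.0≢1+n (trans (sym e) eq))) ⟩
          allNbrs G A′ x + 0 + T′  ≡⟨ cong (_+ T′) (+-identityʳ _) ⟩
          allNbrs G A′ x + T′      ≤⟨ ∑-drop₁ (λ i → nb i x) i (λ i → nbrs≤ G A′ i x) none′ ⟩
          r * T′ + 0               ≡⟨ alg r₁ T′ ⟩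
          r₁ * T′ + T′             ∎)
          where
          open ≤-Reasoning
          alg : ∀ r₁ T′ → suc r₁ * T′ + 0 ≡ r₁ * T′ + T′
          alg = solve-∀
          none′ : nb i x ≤ 0
          none′ = ≤-reflexive (trans (∑-cong (λ b → cong ι (proj₂ (proj₂ (cover i)) x (A′ i b) (proj₁ (ℓ⁻ x i eq)) (A∈C i _) (proj₂ (ℓ⁻ x i eq))
                    (trans (sym (𝔹.not-involutive _)) (cong not (proj₂ (proj₂ (chooseA i)) b)))))) (trans (∑-const T′ 0) (*-zeroʳ T′)))
        go (inj₂ ¬good) = ≤-trans (+-monoʳ-≤ (allNbrs G A′ x) (ι≤1 (bad x))) far
          where
          notC : ∀ i → C i x ≡ false
          notC i = not-true λ e → ¬good i (∧-intro e (cong not (notM i)))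
          far : allNbrs G A′ x + 1 ≤ r₁ * T′
          far with 𝔽.¬∀⟶∃¬ r _ (λ i → t ≤? nbrs G A i x) (⌊⌋⁻′ (𝔽.all? (λ i → t ≤? nbrs G A i x)) notRich)
          ... | i , few with 𝔽.¬∀⟶∃¬ r _ (λ j → (j ≟ i) ⊎-dec (miss j x ≤? μ)) (⌊⌋⁻′ (near? i x) (notC i))
          -- Class `i` contributes fewer than `t` neighbours, and class `j` has more than `μ`
          -- non-neighbours in `A`, of which at most `t * 2` lie outside `A′`. With `μ ≥ 3 * t` the
          -- total loss exceeds a full class `T′`.
          ...   | j , ¬h = lin 0 (+-mono-≤ (∑-drop₂ (λ i → nb i x) i j (λ e → ¬h (inj₁ (sym e))) (λ i → nbrs≤ G A′ i x) (≤-trans (nb≤ i x) (<⇒≤ (≰⇒> few))) ≤-refl t≤T′) (+-mono-≤ jbound μ≥))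
                      (alg (allNbrs G A′ x) r₁ T′ t (nb j x) μ)
            where
            t≤T′ : t ≤ T′
            t≤T′ = ≤-trans (m≤m+n t _) T′≥
            jbound : nb j x + suc μ ≤ T
            jbound = begin
              nb j x + suc μ             ≤⟨ +-mono-≤ (nb≤ j x) (≰⇒> (λ h → ¬h (inj₂ h))) ⟩
              nbrs G A j x + miss j x    ≡⟨ #-compl (λ b → G x (A j b)) ⟩
              T                          ∎
              where open ≤-Reasoning
            alg : ∀ a r₁ T′ t b μ → a + 1 + (suc r₁ * T′ + t + b + (T′ + t * 2 + μ)) + 0 ≡ r₁ * T′ + (a + T′ + T′ + (b + suc μ + 3 * t))
            alg = solve-∀
  upper : ∑ (allNbrs G A′) + # bad ≤ n * (r₁ * T′) + suc T′ * (N + r * (t * 2))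
  upper = begin
    ∑ (allNbrs G A′) + # bad                         ≡⟨ sym (∑-distrib-+ (allNbrs G A′) (ι ∘ bad)) ⟩
    ∑ (λ x → allNbrs G A′ x + ι (bad x))             ≤⟨ ∑-mono pw ⟩
    ∑ (λ x → r₁ * T′ + suc T′ * exc x)               ≡⟨ trans (∑-distrib-+ (λ _ → r₁ * T′) (λ x → suc T′ * exc x)) (cong₂ _+_ (∑-const n (r₁ * T′)) (∑-*ˡ (suc T′) exc)) ⟩
    n * (r₁ * T′) + suc T′ * ∑ exc                   ≤⟨ +-monoʳ-≤ (n * (r₁ * T′)) (*-monoʳ-≤ (suc T′) excSum) ⟩
    n * (r₁ * T′) + suc T′ * (N + r * (t * 2))       ∎
    where
    open ≤-Reasoning
    excSum : ∑ exc ≤ N + r * (t * 2)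
    excSum = begin
      ∑ exc                            ≡⟨ ∑-distrib-+ (ι ∘ W) (λ x → ∑ (λ i → ι (M i x))) ⟩
      # W + ∑ (λ x → ∑ (λ i → ι (M i x))) ≡⟨ cong (# W +_) (∑-comm (λ x i → ι (M i x))) ⟩
      # W + ∑ (λ i → # (M i))          ≤⟨ +-mono-≤ fewRich (∑-bound (λ i → proj₁ (proj₂ (cover i)))) ⟩
      N + r * (t * 2)                  ∎
  lower : T′ * (r₁ * n) ≤ ∑ (allNbrs G A′) + T′ * c
  lower = *-cancelˡ-≤ r (≤-trans (allNbrs-lower G A′ sG {r₁} {c} δ) (≤-reflexive (sym (*-distribˡ-+ r (∑ (allNbrs G A′)) (T′ * c)))))
  -- The degree condition forces an average of `r₁ * T′` neighbours in `A′`, up to a constant in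
  -- total. By `upper` every uncoloured vertex lowers that total by one.
  fewBad : # bad ≤ T′ * c + suc T′ * (N + r * (t * 2))
  fewBad = lin 0 (+-mono-≤ lower upper) (alg (# bad) (∑ (allNbrs G A′)) T′ c n r₁ (N + r * (t * 2)))
    where
    alg : ∀ b S T′ c n r₁ N → b + (S + T′ * c + (n * (r₁ * T′) + suc T′ * N)) + 0 ≡ T′ * c + suc T′ * N + (T′ * (r₁ * n) + (S + b))
    alg = solve-∀

NearColourable : (r₂ c t p : ℕ) → Set
NearColourable r₂ c t p = let r₁ = suc r₂ ; r = suc r₁ in
  ∃[ n₀ ] ∃[ d ] ∀ n → n₀ ≤ n → (G : Graph n) → IsSimple G → (∀ v → r₁ * n ≤ r * deg G v + c) →
  ¬ ((Empty (suc p) ⊗ Turan (t * r) r) ⊆ᴳ G) → ¬ ((copies t K2 ⊗ Turan (t * r₁) r₁) ⊆ᴳ G) →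
  Σ (Fin n → Fin (suc r)) λ ℓ → # (λ v → ⌊ ℓ v ≟ fzero ⌋) ≤ d ×
    (∀ x y i → ℓ x ≡ fsuc i → ℓ y ≡ fsuc i → G x y ≡ false)

near-colouring : ∀ r₂ c t p → NearColourable r₂ c t p
near-colouring r₂ c t p with KPart-exists (suc r₂) c (suc (suc r₂)) ≤-refl (t + (t * 2) * (3 * t) + t * 2)
... | n₀ , find = n₀ , _ , λ n n≥ G sG δ noX₀ noX₁ → build n n≥ G sG δ noX₀ noX₁
  where
  r₁ r μ T′ T N : ℕ
  r₁ = suc r₂
  r = suc r₁
  μ = 3 * t
  T′ = t + (t * 2) * μ
  T = T′ + t * 2
  N = suc p * 2 ^ (r * T)
  build : ∀ n → n₀ ≤ n → (G : Graph n) → IsSimple G → (∀ v → r₁ * n ≤ r * deg G v + c) →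
    ¬ ((Empty (suc p) ⊗ Turan (t * r) r) ⊆ᴳ G) → ¬ ((copies t K2 ⊗ Turan (t * r₁) r₁) ⊆ᴳ G) →
    Σ (Fin n → Fin (suc r)) λ ℓ → # (λ v → ⌊ ℓ v ≟ fzero ⌋) ≤ T′ * c + suc T′ * (N + r * (t * 2)) ×
      (∀ x y i → ℓ x ≡ fsuc i → ℓ y ≡ fsuc i → G x y ≡ false)
  build n n≥ G sG δ noX₀ noX₁ with find n n≥ G sG δ
  ... | A , kA = NC.ℓ , NC.fewBad , NC.indep
    where
    fewRich : # (rich G A t) ≤ N
    fewRich = rich-bound G A t p kA λ f B fi kB adj →
      noX₀ (⊗Turan-embed {H = Empty (suc p)} G sG (Empty-embed {G = G} f fi) B kB adj)
    module NC = NearColouring G sG r₁ c t μ T′ N δ ≤-refl ≤-refl A kA fewRich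
      (λ e B kB adj → noX₁ (⊗Turan-embed {H = copies t K2} G sG e B kB adj))

-- Counting edges in a near-coloured graph

≟-comm : ∀ {n} (i j : Fin n) → ⌊ i ≟ j ⌋ ≡ ⌊ j ≟ i ⌋
≟-comm i j with i ≟ j
... | yes e = sym (⌊⌋⁺ (j ≟ i) (sym e))
... | no ne = sym (⌊⌋⁺′ (j ≟ i) (ne ∘ sym))

∑-classes : ∀ {n m} (ℓ : Fin n → Fin m) (f : Fin n → ℕ) → ∑ (λ k → ∑ (λ v → ι ⌊ ℓ v ≟ k ⌋ * f v)) ≡ ∑ f
∑-classes ℓ f = trans (∑-comm (λ k v → ι ⌊ ℓ v ≟ k ⌋ * f v))
  (∑-cong (λ v → trans (∑-cong (λ k → cong (λ b → ι b * f v) (≟-comm (ℓ v) k))) (∑-≟ (ℓ v) (f v))))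

-- The source of all later rigidity: a termwise inequality whose sums agree is termwise an equality.
∑-tight : ∀ {n} {f g : Fin n → ℕ} → (∀ v → f v ≤ g v) → ∑ g ≤ ∑ f → ∀ v → g v ≤ f v
∑-tight {suc n} {f} {g} h e fzero = +-cancelʳ-≤ (∑ (g ∘ fsuc)) _ _ (≤-trans e (+-monoʳ-≤ (f fzero) (∑-mono (h ∘ fsuc))))
∑-tight {suc n} {f} {g} h e (fsuc v) = ∑-tight (h ∘ fsuc) (+-cancelˡ-≤ (g fzero) _ _ (≤-trans e (+-monoˡ-≤ _ (h fzero)))) v

pick-surjective : ∀ {n} (p : Fin n → Bool) (f : Fin (# p) → Fin n) → Injective _≡_ _≡_ f → (∀ j → p (f j) ≡ true) →
  ∀ v → p v ≡ true → ∃[ j ] f j ≡ v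
pick-surjective {n} p f fi fp v pv with 𝔽.any? (λ j → f j ≟ v)
... | yes h = h
... | no ¬h = ⊥-elim (1+n≰n (≤-trans (≤-reflexive (sym full)) (#-pullback g gi p)))
  where
  g : Fin (suc (# p)) → Fin n
  g fzero = v
  g (fsuc j) = f j
  gi : Injective _≡_ _≡_ g
  gi {fzero} {fzero} e = refl
  gi {fzero} {fsuc j} e = ⊥-elim (¬h (j , sym e))
  gi {fsuc i} {fzero} e = ⊥-elim (¬h (i , e))
  gi {fsuc i} {fsuc j} e = cong fsuc (fi e)
  gp : ∀ j → p (g j) ≡ true
  gp fzero = pv
  gp (fsuc j) = fp j
  full : # (p ∘ g) ≡ suc (# p)
  full = trans (∑-cong (cong ι ∘ gp)) (trans (∑-const (suc (# p)) 1) (*-identityʳ _))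

-- The neighbourhood of `v` is exactly the complement of class `i`; these vertices will form the set
-- `S′` of the conclusion.
perfect : ∀ {n r} → Graph n → (Fin n → Fin (suc r)) → Fin r → Fin n → Bool
perfect G part i v = ⌊ 𝔽.all? (λ u → G v u 𝔹.≟ not ⌊ part u ≟ fsuc i ⌋) ⌋

-- With `suc t` perfect vertices in a class, any copy of a graph on at most `t` vertices leaves one
-- of them free to serve as a twin.
PerfectPartition : ∀ {n} → Graph n → (r p t : ℕ) → (Fin n → Fin (suc r)) → Set
PerfectPartition G r p t part = # (λ v → ⌊ part v ≟ fzero ⌋) ≡ p × (∀ i → suc t ≤ # (perfect G part i))

-- Structure of a near-coloured graph: typical vertices, representatives, perfect vertices

module Constants (r₁ c t d : ℕ) where
  r K₁ K T₁ Θ₁ : ℕ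
  r = suc r₁
  -- `K₁` is the defect in class sizes, `K` bounds the conflicts of one vertex, `T₁` is what the
  -- greedy choice of `t * r` vertices consumes, and `Θ₁` makes the pigeonhole over adjacencies to
  -- `D` yield more than `T₁` alike vertices.
  K₁ = r * d + r₁ * c
  K = suc (c + K₁)
  T₁ = (t * r) * K
  Θ₁ = suc T₁ * 2 ^ d

  CA : ℕ → ℕ
  -- The two summands are the error terms of `missing-lower`, taken `2 * r` times, and of
  -- `weighted-sizes`, taken twice.
  CA Θ = 2 * (r * (r * (d * Θ))) + 2 * (r * (d * K₁))

  T₂ size₁ : ℕ → ℕ
  -- Beyond the greedy choice, up to `E` vertices may be spoiled by missing cross pairs, and more
  -- than `t` perfect ones must be left.
  T₂ E = T₁ + (E + t)
  size₁ Θ = r * Θ + K₁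

module Structure {n} (G : Graph n) (sG : IsSimple G) (r₁ c p t d : ℕ)
  (δ : ∀ v → r₁ * n ≤ suc r₁ * deg G v + c)
  (noX₀ : ∀ (f : Fin (suc p) → Fin n) (B : Fin (suc r₁) → Fin t → Fin n) → Injective _≡_ _≡_ f →
    KPart G (suc r₁) t B → (∀ a i b → G (f a) (B i b) ≡ true) → ⊥)
  (ℓ : Fin n → Fin (suc (suc r₁))) (fewD : # (λ v → ⌊ ℓ v ≟ fzero ⌋) ≤ d)
  (indep : ∀ x y i → ℓ x ≡ fsuc i → ℓ y ≡ fsuc i → G x y ≡ false) where

  open Constants r₁ c t d

  D : Fin n → Bool
  D v = ⌊ ℓ v ≟ fzero ⌋
  S : Fin r → Fin n → Bool
  S i v = ⌊ ℓ v ≟ fsuc i ⌋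
  s : Fin r → ℕ
  s i = # (S i)
  dD : ℕ
  dD = # D

  -- Missing edges between different classes. Defects towards `D` are kept apart in `nD`, since they
  -- may be of linear total size.
  crossPair : Fin n → Fin n → Bool
  crossPair u v = not (G u v) ∧ (not (D u) ∧ (not (D v) ∧ not ⌊ ℓ u ≟ ℓ v ⌋))
  cross nD : Fin n → ℕ
  cross u = # (crossPair u)
  nD x = # (λ y → D y ∧ not (G x y))

  S⁻ : ∀ {i v} → S i v ≡ true → ℓ v ≡ fsuc i
  S⁻ {i} {v} = ⌊⌋⁻ (ℓ v ≟ fsuc i)
  D-S : ∀ {i v} → ℓ v ≡ fsuc i → D v ≡ false
  D-S {i} {v} e = ⌊⌋⁺′ (ℓ v ≟ fzero) (λ e′ → 𝔽.0≢1+n (trans (sym e′) e))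

  crossPair⁻ : ∀ {u v i j} → ℓ u ≡ fsuc i → ℓ v ≡ fsuc j → i ≢ j → crossPair u v ≡ false → G u v ≡ true
  crossPair⁻ {u} {v} {i} {j} eu ev ne h with G u v
  ... | true = refl
  ... | false rewrite D-S {i} {u} eu | D-S {j} {v} ev | ⌊⌋⁺′ (ℓ u ≟ ℓ v) (λ e → ne (𝔽.suc-injective (trans (sym eu) (trans e ev)))) with h
  ...   | ()

  crossPair-comm : ∀ u v → crossPair u v ≡ crossPair v u
  crossPair-comm u v rewrite proj₁ sG u v | ≟-comm (ℓ u) (ℓ v) = comm (not (G v u)) (not (D u)) (not (D v)) _
    where
    comm : ∀ a b c d → a ∧ (b ∧ (c ∧ d)) ≡ a ∧ (c ∧ (b ∧ d))
    comm false _ _ _ = refl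
    comm true true true _ = refl
    comm true true false _ = refl
    comm true false true _ = refl
    comm true false false _ = refl

  size-total : dD + ∑ s ≡ n
  size-total = trans (cong₂ _+_ (∑-cong (λ v → sym (*-identityʳ (ι (D v))))) (∑-cong (λ i → ∑-cong (λ v → sym (*-identityʳ (ι (S i v)))))))
    (trans (∑-classes ℓ (λ _ → 1)) (trans (∑-const n 1) (*-identityʳ n)))

  -- Every vertex is exactly one of: a neighbour of `x`, in the class of `x`, missing from another
  -- class, a non-neighbour in `D`.
  row : ∀ {x i} → ℓ x ≡ fsuc i → ((deg G x + s i) + cross x) + nD x ≡ n
  row {x} {i} ex = begin
    ((deg G x + s i) + cross x) + nD x ≡⟨ cong (λ z → (z + cross x) + nD x) (sym (∑-distrib-+ (ι ∘ G x) (ι ∘ S i))) ⟩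
    (∑ (λ u → ι (G x u) + ι (S i u)) + cross x) + nD x ≡⟨ cong (_+ nD x) (sym (∑-distrib-+ (λ u → ι (G x u) + ι (S i u)) (ι ∘ crossPair x))) ⟩
    ∑ (λ u → (ι (G x u) + ι (S i u)) + ι (crossPair x u)) + nD x ≡⟨ sym (∑-distrib-+ (λ u → (ι (G x u) + ι (S i u)) + ι (crossPair x u)) (λ u → ι (D u ∧ not (G x u)))) ⟩
    ∑ (λ u → ((ι (G x u) + ι (S i u)) + ι (crossPair x u)) + ι (D u ∧ not (G x u))) ≡⟨ ∑-cong pw ⟩
    ∑ {n} (λ _ → 1) ≡⟨ trans (∑-const n 1) (*-identityʳ n) ⟩
    n ∎
    where
    open ≡-Reasoning
    pw : ∀ u → ((ι (G x u) + ι (S i u)) + ι (crossPair x u)) + ι (D u ∧ not (G x u)) ≡ 1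
    pw u rewrite D-S {i} {x} ex | ex with ℓ u in eu
    ... | fzero with G x u
    ...   | true = refl
    ...   | false = refl
    pw u | fsuc j with i ≟ j
    ...   | yes refl rewrite indep x u i ex eu | ⌊⌋⁺ (Data.Fin._≟_ (fsuc i) (fsuc i)) refl = refl
    ...   | no ne rewrite ⌊⌋⁺′ (Data.Fin._≟_ (fsuc j) (fsuc i)) (λ e → ne (sym (𝔽.suc-injective e))) with G x u
    ...     | true = refl
    ...     | false = refl

  size-upper : ∀ i → r * s i ≤ n + c
  size-upper i with 1 ≤? s i
  ... | no h = ≤-trans (≤-reflexive (trans (cong (r *_) (n<1⇒n≡0 (≰⇒> h))) (*-zeroʳ r))) z≤n
  ... | yes h with #-witness (S i) h
  ...   | x , Sx = lin (r * cross x + r * nD x) (+-mono-≤ (δ x) (≤-reflexive (cong (r *_) (row (S⁻ {i} Sx))))) (alg r₁ (s i) n (deg G x) c (cross x) (nD x))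
    where
    alg : ∀ r₁ s n g c k m → suc r₁ * s + (suc r₁ * g + c + suc r₁ * n) + (suc r₁ * k + suc r₁ * m) ≡ n + c + (r₁ * n + suc r₁ * (((g + s) + k) + m))
    alg = solve-∀

  -- The other `r₁` classes have at most `(n + c) / r` vertices each and `D` at most `d`; clearing
  -- the denominator gives `K₁`.
  size-lower : ∀ i → n ≤ r * s i + K₁
  size-lower i = lin 0 (+-mono-≤ (+-mono-≤ (∑-drop₁ (λ j → r * s j) i size-upper ≤-refl) (≤-reflexive (sym total))) (*-monoʳ-≤ r fewD))
    (alg n r₁ (s i) d c (∑ (λ j → r * s j)) dD)
    where
    total : r * dD + ∑ (λ j → r * s j) ≡ r * n
    total = trans (cong (r * dD +_) (∑-*ˡ r s)) (trans (sym (*-distribˡ-+ r dD (∑ s))) (cong (r *_) size-total))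
    alg : ∀ n r₁ s d c X dD → n + (suc r₁ * (n + c) + suc r₁ * s + (suc r₁ * dD + X) + suc r₁ * d) + 0
      ≡ suc r₁ * s + (suc r₁ * d + r₁ * c) + (X + (n + c) + suc r₁ * n + suc r₁ * dD)
    alg = solve-∀

  cross-bound : ∀ {x i} → ℓ x ≡ fsuc i → cross x ≤ c + K₁
  cross-bound {x} {i} ex = lin (r₁ * cross x + r * nD x) (+-mono-≤ (+-mono-≤ (δ x) (size-lower i)) (≤-reflexive (cong (r *_) (row ex))))
    (alg r₁ (s i) n (deg G x) c (cross x) (nD x) K₁)
    where
    alg : ∀ r₁ s n g c k m K₁ → k + (suc r₁ * g + c + (suc r₁ * s + K₁) + suc r₁ * n) + (r₁ * k + suc r₁ * m) ≡ c + K₁ + (r₁ * n + n + suc r₁ * (((g + s) + k) + m))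
    alg = solve-∀

  -- Agreement on `D` is enough: elsewhere, vertices of one class differ only through boundedly many
  -- missing cross pairs.
  like : Fin n → Fin n → Bool
  like x y = ⌊ 𝔽.all? (λ u → (D u 𝔹.≟ false) ⊎-dec (G y u 𝔹.≟ G x u)) ⌋

  like⁻ : ∀ {x y u} → like x y ≡ true → D u ≡ true → G y u ≡ G x u
  like⁻ {x} {y} {u} h Du with ⌊⌋⁻ (𝔽.all? (λ u → (D u 𝔹.≟ false) ⊎-dec (G y u 𝔹.≟ G x u))) h u
  ... | inj₁ ¬D = ⊥-elim (true≢false Du ¬D)
  ... | inj₂ e = e

  like-popular : ∀ (X : Fin n → Bool) T → suc T * 2 ^ d ≤ # X →
    ∃[ x₀ ] X x₀ ≡ true × suc T ≤ # (λ x → X x ∧ like x₀ x)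
  like-popular X T big with pick D dD ≤-refl
  ... | f , fi , fD with popular dD (λ j x → G x (f j)) X (≤-trans (*-monoʳ-≤ (suc T) (^-monoʳ-≤ 2 fewD)) big)
  ...   | x₀ , Xx₀ , many = x₀ , Xx₀ , ≤-trans many (#-mono λ v h → ∧-intro (proj₁ (∧-elim {X v} h)) (⌊⌋⁺ (𝔽.all? (λ u → (D u 𝔹.≟ false) ⊎-dec (G v u 𝔹.≟ G x₀ u))) (same v (proj₂ (∧-elim {X v} h)))))
    where
    same : ∀ v → agree (λ j x → G x (f j)) x₀ v ≡ true → ∀ u → D u ≡ false ⊎ G v u ≡ G x₀ u
    same v h u with D u 𝔹.≟ false
    ... | yes e = inj₁ e
    ... | no ne with pick-surjective D f fi fD u (trans (sym (𝔹.not-involutive (D u))) (cong not (sym (𝔹.¬-not (ne ∘ sym)))))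
    ...   | j , refl = inj₂ (agree⁻ (λ j x → G x (f j)) x₀ v h j)

  module Representatives (x : Fin r → Fin n)
    (many : ∀ i → suc ((t * r) * K) ≤ # (λ v → S i v ∧ like (x i) v)) where

    W : Fin n → Bool
    W y = D y ∧ ⌊ 𝔽.all? (λ i → G (x i) y 𝔹.≟ true) ⌋

    -- Equality counts as a conflict so that the greedy choice also gives distinct vertices within a
    -- class.
    conf : Fin n → Fin n → Bool
    conf u v = ⌊ v ≟ u ⌋ ∨ crossPair u v

    conf-comm : ∀ u v → conf u v ≡ conf v u
    conf-comm u v = cong₂ _∨_ (≟-comm v u) (crossPair-comm u v)

    conf-bound : ∀ u → # (conf u) ≤ K
    conf-bound u = ≤-trans (∑-mono (λ v → pw ⌊ v ≟ u ⌋ (crossPair u v))) (≤-trans (≤-reflexive (∑-distrib-+ (λ v → ι ⌊ v ≟ u ⌋) (ι ∘ crossPair u)))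
        (+-mono-≤ (≤-reflexive (#-≟ u)) (cb (ℓ u) refl)))
      where
      pw : ∀ a b → ι (a ∨ b) ≤ ι a + ι b
      pw true b = s≤s z≤n
      pw false b = ≤-refl
      cb : ∀ k → ℓ u ≡ k → cross u ≤ c + K₁
      cb (fsuc i) e = cross-bound e
      cb fzero e = ≤-trans (≤-reflexive (trans (∑-cong (λ v → cong ι (zeroed (not (G u v)) _ (⌊⌋⁺ (ℓ u ≟ fzero) e)))) (trans (∑-const n 0) (*-zeroʳ n)))) z≤n
        where
        zeroed : ∀ a b {D} → D ≡ true → a ∧ (not D ∧ b) ≡ false
        zeroed true b refl = refl
        zeroed false b refl = refl

    -- Vertices like the representatives inherit their adjacency to `W`. A conflict-free choice of
    -- `t` of them per class, joined to `suc p` vertices of `W`, would be the host that defines `q`.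
    W-small : # W ≤ p
    W-small = ≮⇒≥ λ big → contra (pick W (suc p) big)
      where
      cls : Fin (t * r) → Fin r
      cls k = proj₂ (remQuot {t} r k)
      contra : (Σ (Fin (suc p) → Fin n) λ w → Injective _≡_ _≡_ w × (∀ j → W (w j) ≡ true)) → ⊥
      contra (w , wi , wW) with greedy (t * r) (λ k v → S (cls k) v ∧ like (x (cls k)) v) conf conf-comm conf-bound (λ k → many (cls k))
      ... | f , fc , fn = noX₀ w A wi (inj , adj) wadj
        where
        A : Fin r → Fin t → Fin n
        A i b = f (combine b i)
        clsA : ∀ i b → cls (combine b i) ≡ i
        clsA i b = cong proj₂ (𝔽.remQuot-combine b i)
        inClass : ∀ i b → (S i (A i b) ∧ like (x i) (A i b)) ≡ true
        inClass i b = subst (λ k → (S k (A i b) ∧ like (x k) (A i b)) ≡ true) (clsA i b) (fc (combine b i))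
        ℓA : ∀ i b → ℓ (A i b) ≡ fsuc i
        ℓA i b = S⁻ {i} (proj₁ (∧-elim {S i (A i b)} (inClass i b)))
        inj : ∀ i → Injective _≡_ _≡_ (A i)
        inj i {a} {b} e with a ≟ b
        ... | yes q = q
        ... | no ne = ⊥-elim (true≢false (cong (_∨ crossPair (A i a) (A i b)) (⌊⌋⁺ (A i b ≟ A i a) (sym e)))
                (fn _ _ (λ q → ne (𝔽.combine-injectiveˡ a i b i q))))
        adj : ∀ i j a b → i ≢ j → G (A i a) (A j b) ≡ true
        adj i j a b ne = crossPair⁻ (ℓA i a) (ℓA j b) ne (∨-false (fn _ _ (λ q → ne (𝔽.combine-injectiveʳ a i b j q))))
          where
          ∨-false : ∀ {a b} → a ∨ b ≡ false → b ≡ false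
          ∨-false {false} e = e
        wadj : ∀ a i b → G (w a) (A i b) ≡ true
        wadj a i b = trans (proj₁ sG _ _) (trans (like⁻ {x i} {A i b} (proj₂ (∧-elim {S i (A i b)} (inClass i b))) (proj₁ (∧-elim (wW a))))
          (⌊⌋⁻ (𝔽.all? (λ i → G (x i) (w a) 𝔹.≟ true)) (proj₂ (∧-elim {D (w a)} (wW a))) i))

    missed : Fin n → ℕ
    missed y = ∑ (λ i → ι (D y ∧ not (G (x i) y)))

    D-cover : ∀ y → ι (D y) ≤ ι (W y) + missed y
    D-cover y with D y in eD
    ... | false = z≤n
    ... | true with 𝔽.all? (λ i → G (x i) y 𝔹.≟ true)
    ...   | yes _ = s≤s z≤n
    ...   | no ¬all with 𝔽.¬∀⟶∃¬ r _ (λ i → G (x i) y 𝔹.≟ true) ¬all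
    ...     | i , ¬h = ≤-trans (≤-reflexive (cong (ι ∘ not) (sym (not-true ¬h)))) (term≤∑ (λ i → ι (not (G (x i) y))) i)

    ∑-missed : ∑ missed ≡ ∑ (λ i → nD (x i))
    ∑-missed = ∑-comm (λ y i → ι (D y ∧ not (G (x i) y)))

    D-count : dD ≤ # W + ∑ (λ i → nD (x i))
    D-count = begin
      dD                             ≤⟨ ∑-mono D-cover ⟩
      ∑ (λ y → ι (W y) + missed y)   ≡⟨ ∑-distrib-+ (ι ∘ W) missed ⟩
      # W + ∑ missed                 ≡⟨ cong (# W +_) ∑-missed ⟩
      # W + ∑ (λ i → nD (x i))       ∎
      where open ≤-Reasoning

  nD≤d : ∀ x → nD x ≤ d
  nD≤d x = ≤-trans (#-mono (λ y h → proj₁ (∧-elim {D y} h))) fewD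

  below above : ℕ → Fin r → Fin n → Bool
  below k i x = S i x ∧ ⌊ nD x ≤? k ⌋
  above k i x = S i x ∧ ⌊ suc k ≤? nD x ⌋
  strictlyBelow : ℕ → Fin r → Fin n → Bool
  strictlyBelow k i x = S i x ∧ ⌊ suc (nD x) ≤? k ⌋

  below⁻ : ∀ {k i x} → below k i x ≡ true → S i x ≡ true × nD x ≤ k
  below⁻ {k} {i} {x} h with ∧-elim {S i x} h
  ... | Sx , h′ = Sx , ⌊⌋⁻ (nD x ≤? k) h′

  -- Descending from `d`, where the whole class qualifies, stop at the last level that still holds
  -- `Θ` vertices. Then at most `Θ` vertices lie strictly below `m`, so `m` is the typical number of
  -- non-neighbours in `D`.
  threshold : ∀ Θ i → Θ ≤ s i → ∃[ m ] m ≤ d × Θ ≤ # (below m i) × # (strictlyBelow m i) ≤ Θ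
  threshold Θ i big = search d (≤-trans big (#-mono λ x Sx → ∧-intro Sx (⌊⌋⁺ (nD x ≤? d) (nD≤d x))))
    where
    search : ∀ k → Θ ≤ # (below k i) → ∃[ m ] m ≤ k × Θ ≤ # (below m i) × # (strictlyBelow m i) ≤ Θ
    search zero h = zero , z≤n , h , ≤-trans (≤-reflexive (trans (∑-cong (λ x → cong ι (𝔹.∧-zeroʳ (S i x)))) (trans (∑-const n 0) (*-zeroʳ n)))) z≤n
    search (suc k) h = step (Θ ≤? # (below k i))
      where
      step : Dec (Θ ≤ # (below k i)) → ∃[ m ] m ≤ suc k × Θ ≤ # (below m i) × # (strictlyBelow m i) ≤ Θ
      step (yes h′) with search k h′
      ... | m , m≤k , rest = m , m≤n⇒m≤1+n m≤k , rest
      step (no ¬h) = suc k , ≤-refl , h , ≤-trans (#-mono λ x e → ∧-intro (proj₁ (∧-elim {S i x} e))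
        (⌊⌋⁺ (nD x ≤? k) (s≤s⁻¹ (⌊⌋⁻ (suc (nD x) ≤? suc k) (proj₂ (∧-elim {S i x} e)))))) (<⇒≤ (≰⇒> ¬h))

  module Thresholds (m : Fin r → ℕ) (Θ : ℕ) (m≤d : ∀ i → m i ≤ d)
    (low : ∀ i → # (strictlyBelow (m i) i) ≤ Θ) where

    over : (Fin n → ℕ) → Fin r → ℕ
    over f i = ∑ (λ x → ι (S i x) * f x)
    M Crs ND ms sq Bad : ℕ
    M = ∑ m
    Crs = ∑ (over cross)
    ND = ∑ (over nD)
    ms = ∑ (λ i → m i * s i)
    sq = ∑ (λ i → s i * s i)
    Bad = ∑ (λ i → # (above (m i) i))

    class-count : ∀ i → ((over (deg G) i + s i * s i) + over cross i) + over nD i ≡ s i * n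
    class-count i = begin
      ((over (deg G) i + s i * s i) + over cross i) + over nD i
        ≡⟨ cong (λ z → ((over (deg G) i + z) + over cross i) + over nD i) (sym (∑-*ʳ (s i) (ι ∘ S i))) ⟩
      ((over (deg G) i + ∑ (λ x → ι (S i x) * s i)) + over cross i) + over nD i
        ≡⟨ cong (λ z → (z + over cross i) + over nD i) (sym (∑-distrib-+ (λ x → ι (S i x) * deg G x) (λ x → ι (S i x) * s i))) ⟩
      (∑ (λ x → ι (S i x) * deg G x + ι (S i x) * s i) + over cross i) + over nD i
        ≡⟨ cong (_+ over nD i) (sym (∑-distrib-+ (λ x → ι (S i x) * deg G x + ι (S i x) * s i) (λ x → ι (S i x) * cross x))) ⟩
      ∑ (λ x → (ι (S i x) * deg G x + ι (S i x) * s i) + ι (S i x) * cross x) + over nD i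
        ≡⟨ sym (∑-distrib-+ (λ x → (ι (S i x) * deg G x + ι (S i x) * s i) + ι (S i x) * cross x) (λ x → ι (S i x) * nD x)) ⟩
      ∑ (λ x → ((ι (S i x) * deg G x + ι (S i x) * s i) + ι (S i x) * cross x) + ι (S i x) * nD x)
        ≡⟨ ∑-cong pw ⟩
      ∑ (λ x → ι (S i x) * n)
        ≡⟨ ∑-*ʳ n (ι ∘ S i) ⟩
      s i * n ∎
      where
      open ≡-Reasoning
      pw : ∀ x → ((ι (S i x) * deg G x + ι (S i x) * s i) + ι (S i x) * cross x) + ι (S i x) * nD x ≡ ι (S i x) * n
      pw x = trans (alg (ι (S i x)) (deg G x) (s i) (cross x) (nD x)) (sx (S i x) refl)
        where
        alg : ∀ b g s c k → ((b * g + b * s) + b * c) + b * k ≡ b * (((g + s) + c) + k)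
        alg = solve-∀
        sx : ∀ b → S i x ≡ b → ι b * (((deg G x + s i) + cross x) + nD x) ≡ ι b * n
        sx false _ = refl
        sx true e = cong (1 *_) (row (S⁻ {i} e))

    D-degrees : ∑ (λ y → ι (D y) * deg G y) + ND ≤ n * dD
    D-degrees = begin
      ∑ (λ y → ι (D y) * deg G y) + ND
        ≡⟨ cong₂ _+_ (trans (∑-cong (λ y → sym (∑-*ˡ (ι (D y)) (ι ∘ G y)))) (∑-comm (λ y x → ι (D y) * ι (G y x)))) (∑-comm (λ i x → ι (S i x) * nD x)) ⟩
      ∑ (λ x → ∑ (λ y → ι (D y) * ι (G y x))) + ∑ (λ x → ∑ (λ i → ι (S i x) * nD x))
        ≤⟨ +-monoʳ-≤ _ (∑-mono one) ⟩
      ∑ (λ x → ∑ (λ y → ι (D y) * ι (G y x))) + ∑ nD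
        ≡⟨ sym (∑-distrib-+ (λ x → ∑ (λ y → ι (D y) * ι (G y x))) nD) ⟩
      ∑ (λ x → ∑ (λ y → ι (D y) * ι (G y x)) + nD x)
        ≡⟨ ∑-cong (λ x → trans (sym (∑-distrib-+ (λ y → ι (D y) * ι (G y x)) (λ y → ι (D y ∧ not (G x y))))) (∑-cong (λ y → pw (D y) x y))) ⟩
      ∑ {n} (λ x → dD)
        ≡⟨ ∑-const n dD ⟩
      n * dD ∎
      where
      open ≤-Reasoning
      pw : ∀ b x y → ι b * ι (G y x) + ι (b ∧ not (G x y)) ≡ ι b
      pw false x y = refl
      pw true x y rewrite proj₁ sG y x with G x y
      ... | true = refl
      ... | false = refl
      one : ∀ x → ∑ (λ i → ι (S i x) * nD x) ≤ nD x
      one x = ≤-trans (m≤n+m _ (ι (D x) * nD x)) (≤-reflexive (trans (∑-cong (λ k → cong (λ b → ι b * nD x) (≟-comm (ℓ x) k))) (∑-≟ (ℓ x) (nD x))))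

    -- Non-adjacent ordered pairs: inside a class, across classes, and between a class and `D` in
    -- both orders, hence `ND` twice. Those inside `D` are discarded.
    degSum-count : degSum G + sq + Crs + (ND + ND) ≤ n * n
    degSum-count = begin
      degSum G + sq + Crs + (ND + ND)
        ≡⟨ cong (λ z → z + sq + Crs + (ND + ND)) (sym (∑-classes ℓ (deg G))) ⟩
      (X + Y) + sq + Crs + (ND + ND)
        ≡⟨ alg X Y sq Crs ND ⟩
      (X + ND) + (((Y + sq) + Crs) + ND)
        ≡⟨ cong (X + ND +_) classes ⟩
      (X + ND) + ∑ s * n
        ≤⟨ +-monoˡ-≤ (∑ s * n) D-degrees ⟩
      n * dD + ∑ s * n
        ≡⟨ trans (cong (_+ ∑ s * n) (*-comm n dD)) (sym (*-distribʳ-+ n dD (∑ s))) ⟩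
      (dD + ∑ s) * n
        ≡⟨ cong (_* n) size-total ⟩
      n * n ∎
      where
      open ≤-Reasoning
      X Y : ℕ
      X = ∑ (λ y → ι (D y) * deg G y)
      Y = ∑ (over (deg G))
      alg : ∀ X Y q c k → (X + Y) + q + c + (k + k) ≡ (X + k) + (((Y + q) + c) + k)
      alg = solve-∀
      classes : ((Y + sq) + Crs) + ND ≡ ∑ s * n
      classes = trans (cong (λ z → (z + Crs) + ND) (sym (∑-distrib-+ (over (deg G)) (λ i → s i * s i))))
        (trans (cong (_+ ND) (sym (∑-distrib-+ (λ i → over (deg G) i + s i * s i) (over cross))))
        (trans (sym (∑-distrib-+ (λ i → (over (deg G) i + s i * s i) + over cross i) (over nD)))
        (trans (∑-cong class-count) (∑-*ʳ n s))))

    -- Per class, at most `Θ` vertices fall below the threshold, each by at most `d`, while every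
    -- vertex above it gains at least one, recorded in `Bad`.
    missing-lower : ms + Bad ≤ ND + r * (d * Θ)
    missing-lower = begin
      ms + Bad                                            ≡⟨ sym (∑-distrib-+ (λ i → m i * s i) (λ i → # (above (m i) i))) ⟩
      ∑ (λ i → m i * s i + # (above (m i) i))             ≤⟨ ∑-mono each ⟩
      ∑ (λ i → over nD i + d * Θ)                         ≡⟨ trans (∑-distrib-+ (over nD) (λ _ → d * Θ)) (cong (ND +_) (∑-const r (d * Θ))) ⟩
      ND + r * (d * Θ)                                    ∎
      where
      open ≤-Reasoning
      pw : ∀ b a k → ι b * k + ι (⌊ suc k ≤? a ⌋) * ι b ≤ ι b * a + k * (ι b * ι ⌊ suc a ≤? k ⌋)
      pw false a k = ≤-trans (≤-reflexive (*-zeroʳ (ι ⌊ suc k ≤? a ⌋))) z≤n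
      pw true a k with suc k ≤? a | suc a ≤? k
      ... | yes h | _ = ≤-trans (≤-reflexive (alg k)) (≤-trans h (≤-trans (≤-reflexive (sym (+-identityʳ a))) (m≤m+n (a + 0) _)))
        where
        alg : ∀ k → k + 0 + 1 ≡ suc k
        alg = solve-∀
      ... | no _ | yes h = ≤-trans (≤-reflexive (alg k)) (m≤n+m _ (a + 0))
        where
        alg : ∀ k → k + 0 + 0 ≡ k * 1
        alg = solve-∀
      ... | no _ | no h = ≤-trans (≤-reflexive (trans (+-identityʳ (k + 0)) (+-identityʳ k))) (≤-trans (≮⇒≥ h) (≤-trans (≤-reflexive (sym (+-identityʳ a))) (m≤m+n (a + 0) _)))
      each : ∀ i → m i * s i + # (above (m i) i) ≤ over nD i + d * Θ
      each i = begin
        m i * s i + # (above (m i) i)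
          ≡⟨ cong₂ _+_ (trans (*-comm (m i) (s i)) (sym (∑-*ʳ (m i) (ι ∘ S i)))) (∑-cong (λ x → ι-∧ (S i x) ⌊ suc (m i) ≤? nD x ⌋)) ⟩
        ∑ (λ x → ι (S i x) * m i) + ∑ (λ x → ι ⌊ suc (m i) ≤? nD x ⌋ * ι (S i x))
          ≡⟨ sym (∑-distrib-+ (λ x → ι (S i x) * m i) (λ x → ι ⌊ suc (m i) ≤? nD x ⌋ * ι (S i x))) ⟩
        ∑ (λ x → ι (S i x) * m i + ι ⌊ suc (m i) ≤? nD x ⌋ * ι (S i x))
          ≤⟨ ∑-mono (λ x → pw (S i x) (nD x) (m i)) ⟩
        ∑ (λ x → ι (S i x) * nD x + m i * (ι (S i x) * ι ⌊ suc (nD x) ≤? m i ⌋))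
          ≡⟨ trans (∑-distrib-+ (λ x → ι (S i x) * nD x) (λ x → m i * (ι (S i x) * ι ⌊ suc (nD x) ≤? m i ⌋))) (cong (over nD i +_) (∑-*ˡ (m i) (λ x → ι (S i x) * ι ⌊ suc (nD x) ≤? m i ⌋))) ⟩
        over nD i + m i * ∑ (λ x → ι (S i x) * ι ⌊ suc (nD x) ≤? m i ⌋)
          ≡⟨ cong (λ z → over nD i + m i * z) (∑-cong (λ x → sym (trans (ι-∧ (S i x) ⌊ suc (nD x) ≤? m i ⌋) (*-comm (ι ⌊ suc (nD x) ≤? m i ⌋) (ι (S i x)))))) ⟩
        over nD i + m i * # (strictlyBelow (m i) i)
          ≤⟨ +-monoʳ-≤ (over nD i) (*-mono-≤ (m≤d i) (low i)) ⟩
        over nD i + d * Θ ∎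
        where
        ι-∧ : ∀ a b → ι (a ∧ b) ≡ ι b * ι a
        ι-∧ false b = sym (*-zeroʳ (ι b))
        ι-∧ true b = sym (*-identityʳ (ι b))

    weighted-sizes : M * n ≤ r * ms + r * (d * K₁)
    weighted-sizes = begin
      M * n                                          ≡⟨ sym (∑-*ʳ n m) ⟩
      ∑ (λ i → m i * n)                              ≤⟨ ∑-mono each ⟩
      ∑ (λ i → r * (m i * s i) + d * K₁)             ≡⟨ trans (∑-distrib-+ (λ i → r * (m i * s i)) (λ _ → d * K₁)) (cong₂ _+_ (∑-*ˡ r (λ i → m i * s i)) (∑-const r (d * K₁))) ⟩
      r * ms + r * (d * K₁)                          ∎
      where
      open ≤-Reasoning
      each : ∀ i → m i * n ≤ r * (m i * s i) + d * K₁
      each i = ≤-trans (*-monoʳ-≤ (m i) (size-lower i)) (≤-trans (≤-reflexive (alg (m i) r (s i) K₁)) (+-monoʳ-≤ (r * (m i * s i)) (*-monoˡ-≤ K₁ (m≤d i))))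
        where
        alg : ∀ m r s k → m * (r * s + k) ≡ r * (m * s) + m * k
        alg = solve-∀

    -- Cauchy-Schwarz gives `r * sq ≥ (n − dD)²`, which turns `r * (n * n)` into `r₁ * (n * n)` at
    -- the price `2 * (n * dD)`. The non-edges to `D` contribute `2 * (M * n)`, since classes have
    -- size about `n / r`.
    main-count : r * degSum G + (r * Crs + 2 * (r * Bad)) + 2 * (M * n) ≤ r₁ * (n * n) + 2 * (n * dD) + CA Θ
    main-count = lin 0 (+-mono-≤ (+-mono-≤ (+-mono-≤ (+-mono-≤ (*-monoʳ-≤ r degSum-count) (∑-sq-≤ s)) (*-monoʳ-≤ 2 (*-monoʳ-≤ r missing-lower))) (*-monoʳ-≤ 2 weighted-sizes)) square)
      (alg r₁ (degSum G) Crs Bad M n sq ND ms dD (∑ s) (d * Θ) (d * K₁))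
      where
      square : n * n ≤ ∑ s * ∑ s + 2 * (n * dD)
      square = subst (λ z → z * z ≤ ∑ s * ∑ s + 2 * (z * dD)) size-total (≤-trans (m≤m+n _ (dD * dD)) (≤-reflexive (sqalg dD (∑ s))))
        where
        sqalg : ∀ a b → (a + b) * (a + b) + a * a ≡ b * b + 2 * ((a + b) * a)
        sqalg = solve-∀
      alg : ∀ r₁ g C B M n q k ms dD N x y → let r = suc r₁ in
        r * g + (r * C + 2 * (r * B)) + 2 * (M * n) +
          (r * (n * n) + r * q + 2 * (r * (k + r * x)) + 2 * (r * ms + r * y) + (N * N + 2 * (n * dD))) + 0
        ≡ r₁ * (n * n) + 2 * (n * dD) + (2 * (r * (r * x)) + 2 * (r * y)) +
          (r * (g + q + C + (k + k)) + N * N + 2 * (r * (ms + B)) + 2 * (M * n) + n * n)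
      alg = solve-∀

  class-large : ∀ Θ → size₁ Θ ≤ n → ∀ i → Θ ≤ s i
  class-large Θ h i = *-cancelˡ-≤ r (+-cancelʳ-≤ K₁ _ _ (≤-trans h (size-lower i)))

  module Conclusion (n-large : size₁ Θ₁ ≤ n) where

    abstract
      thresholds : ∀ i → ∃[ m ] m ≤ d × Θ₁ ≤ # (below m i) × # (strictlyBelow m i) ≤ Θ₁
      thresholds i = threshold Θ₁ i (class-large Θ₁ n-large i)

    m : Fin r → ℕ
    m i = proj₁ (thresholds i)

    open Thresholds m Θ₁ (λ i → proj₁ (proj₂ (thresholds i))) (λ i → proj₂ (proj₂ (proj₂ (thresholds i))))

    Reps : ℕ → Set
    Reps T = Σ (Fin r → Fin n) λ x → (∀ i → below (m i) i (x i) ≡ true) × (∀ i → suc T ≤ # (λ v → S i v ∧ like (x i) v))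

    reps : ∀ T → (∀ i → suc T * 2 ^ d ≤ # (below (m i) i)) → Reps T
    reps T big = (λ i → proj₁ (each i)) , (λ i → proj₁ (proj₂ (each i))) , λ i →
      ≤-trans (proj₂ (proj₂ (each i))) (#-mono λ v h → ∧-intro (proj₁ (below⁻ {m i} {i} (proj₁ (∧-elim {below (m i) i v} h)))) (proj₂ (∧-elim {below (m i) i v} h)))
      where
      each : ∀ i → ∃[ x₀ ] below (m i) i x₀ ≡ true × suc T ≤ # (λ v → below (m i) i v ∧ like x₀ v)
      each i = like-popular (below (m i) i) T (big i)

    missed-total : (R : Reps T₁) → ∑ (λ i → nD (proj₁ R i)) ≤ M
    missed-total (x , xb , _) = ∑-mono (λ i → proj₂ (below⁻ {m i} {i} {x i} (xb i)))

    -- Representatives are picked at or below the thresholds, so together they miss at most `M`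
    -- vertices of `D`; the vertices missed by none form `W`.
    D≤p+M : dD ≤ p + M
    D≤p+M = go (reps T₁ (λ i → proj₁ (proj₂ (proj₂ (thresholds i)))))
      where
      go : Reps T₁ → dD ≤ p + M
      go R@(x , _ , xm) = ≤-trans (Representatives.D-count x xm) (+-mono-≤ (Representatives.W-small x xm) (missed-total R))

    degSum-upper : r * degSum G ≤ r₁ * (n * n) + 2 * (n * p) + CA Θ₁
    degSum-upper = lin (r * Crs + 2 * (r * Bad)) (+-mono-≤ main-count (*-monoʳ-≤ 2 (*-monoʳ-≤ n D≤p+M))) (alg (r * degSum G) (r * Crs + 2 * (r * Bad)) M n (r₁ * (n * n)) dD (CA Θ₁) p)
      where
      alg : ∀ g e M n q d a p → g + (q + 2 * (n * d) + a + 2 * (n * (p + M))) + e ≡ q + 2 * (n * p) + a + (g + e + 2 * (M * n) + 2 * (n * d))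
      alg = solve-∀

    module Extremal (C₁ : ℕ) (dense : r₁ * (n * n) + 2 * (n * p) ≤ r * degSum G + C₁) where

      E : ℕ
      E = CA Θ₁ + C₁

      excess : r * Crs + 2 * (r * Bad) + 2 * (n * (M + p)) ≤ 2 * (n * dD) + E
      excess = lin 0 (+-mono-≤ main-count dense) (alg (r * degSum G) (r * Crs + 2 * (r * Bad)) M n (r₁ * (n * n)) dD (CA Θ₁) p C₁)
        where
        alg : ∀ g e M n q d a p c → e + 2 * (n * (M + p)) + (q + 2 * (n * d) + a + (g + c)) + 0 ≡ 2 * (n * d) + (a + c) + (g + e + 2 * (M * n) + (q + 2 * (n * p)))
        alg = solve-∀

      module _ (n-large₂ : size₁ (suc (T₂ E) * 2 ^ d + E) ≤ n) (n>E : E < n) where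

        -- Integrality: a shortfall of one would raise the left side of `excess` by `2 * n`, which
        -- is more than `E`.
        M+p≤D : M + p ≤ dD
        M+p≤D = ≮⇒≥ λ h → 1+n≰n (≤-trans n>E (lin (n + (r * Crs + 2 * (r * Bad)))
          (+-mono-≤ excess (*-monoʳ-≤ 2 (*-monoʳ-≤ n h))) (alg n (r * Crs + 2 * (r * Bad)) (M + p) dD E)))
          where
          alg : ∀ n e M d E → n + (2 * (n * d) + E + 2 * (n * M)) + (n + e) ≡ E + (e + 2 * (n * M) + 2 * (n * suc d))
          alg = solve-∀

        excess≤E : r * Crs + 2 * (r * Bad) ≤ E
        excess≤E = lin 0 (+-mono-≤ excess (*-monoʳ-≤ 2 (*-monoʳ-≤ n D≤p+M))) (alg (r * Crs + 2 * (r * Bad)) n M p dD E)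
          where
          alg : ∀ e n M p d E → e + (2 * (n * d) + E + 2 * (n * (p + M))) + 0 ≡ E + (e + 2 * (n * (M + p)) + 2 * (n * d))
          alg = solve-∀

        Crs≤E : Crs ≤ E
        Crs≤E = ≤-trans (≤-trans (m≤m+n Crs (r₁ * Crs)) (m≤m+n (r * Crs) _)) excess≤E
        Bad≤E : Bad ≤ E
        Bad≤E = ≤-trans (≤-trans (≤-trans (m≤m+n Bad (r₁ * Bad)) (m≤m+n (r * Bad) _)) (m≤n+m _ (r * Crs))) excess≤E

        below-large : ∀ i → suc (T₂ E) * 2 ^ d ≤ # (below (m i) i)
        below-large i = +-cancelʳ-≤ E _ _ (begin
          suc (T₂ E) * 2 ^ d + E                         ≤⟨ class-large (suc (T₂ E) * 2 ^ d + E) n-large₂ i ⟩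
          s i                                        ≤⟨ ∑-mono pw ⟩
          ∑ (λ x → ι (below (m i) i x) + ι (above (m i) i x)) ≡⟨ ∑-distrib-+ (ι ∘ below (m i) i) (ι ∘ above (m i) i) ⟩
          # (below (m i) i) + # (above (m i) i)      ≤⟨ +-monoʳ-≤ (# (below (m i) i)) (≤-trans (term≤∑ (λ i → # (above (m i) i)) i) Bad≤E) ⟩
          # (below (m i) i) + E                      ∎)
          where
          open ≤-Reasoning
          pw : ∀ x → ι (S i x) ≤ ι (below (m i) i x) + ι (above (m i) i x)
          pw x = aux (S i x) (nD x ≤? m i) (suc (m i) ≤? nD x)
            where
            aux : ∀ b (h : Dec (nD x ≤ m i)) (h′ : Dec (m i < nD x)) → ι b ≤ ι (b ∧ ⌊ h ⌋) + ι (b ∧ ⌊ h′ ⌋)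
            aux false _ _ = z≤n
            aux true (yes _) _ = s≤s z≤n
            aux true (no h) (yes _) = ≤-refl
            aux true (no h) (no h′) = ⊥-elim (h (≮⇒≥ h′))

        abstract
          R : Reps (T₂ E)
          R = reps (T₂ E) below-large
        x : Fin r → Fin n
        x = proj₁ R
        like-many : ∀ i → suc (T₂ E) ≤ # (λ v → S i v ∧ like (x i) v)
        like-many = proj₂ (proj₂ R)
        many : ∀ i → suc T₁ ≤ # (λ v → S i v ∧ like (x i) v)
        many i = ≤-trans (s≤s (m≤m+n T₁ (E + t))) (like-many i)

        open Representatives x many

        ∑-missed≤M : ∑ missed ≤ M
        ∑-missed≤M = ≤-trans (≤-reflexive ∑-missed) (missed-total (x , proj₁ (proj₂ R) , many))

        W-size : # W ≡ p
        W-size = ≤-antisym W-small (+-cancelʳ-≤ M _ _ (begin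
          p + M              ≡⟨ +-comm p M ⟩
          M + p              ≤⟨ M+p≤D ⟩
          dD                 ≤⟨ D-count ⟩
          # W + ∑ (λ i → nD (x i)) ≤⟨ +-monoʳ-≤ (# W) (≤-trans (≤-reflexive (sym ∑-missed)) ∑-missed≤M) ⟩
          # W + M            ∎))
          where open ≤-Reasoning

        -- The bound in `D-cover` is tight in total, hence for each vertex: every vertex of `D` is
        -- in `W` or is missed by exactly one representative.
        D-partition : ∀ y → ι (W y) + missed y ≤ ι (D y)
        D-partition = ∑-tight D-cover (begin
          ∑ (λ y → ι (W y) + missed y)   ≡⟨ ∑-distrib-+ (ι ∘ W) missed ⟩
          # W + ∑ missed                 ≤⟨ +-mono-≤ W-small ∑-missed≤M ⟩
          p + M                          ≡⟨ +-comm p M ⟩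
          M + p                          ≤⟨ M+p≤D ⟩
          dD                             ∎)
          where open ≤-Reasoning

        misses? : ∀ y → Dec (∃[ i ] G (x i) y ≡ false)
        misses? y = 𝔽.any? (λ i → G (x i) y 𝔹.≟ false)

        assign : ∀ y → Dec (∃[ i ] G (x i) y ≡ false) → Fin (suc r)
        assign y (yes (i , _)) = fsuc i
        assign y (no _)        = fzero

        -- A vertex of `D` joins the class of the one representative that misses it; vertices seen
        -- by all representatives become the final `W`.
        relabel : Fin n → Fin (suc r) → Fin (suc r)
        relabel y fzero    = assign y (misses? y)
        relabel y (fsuc i) = fsuc i

        abstract
          part : Fin n → Fin (suc r)
          part y = relabel y (ℓ y)

          part-relabel : ∀ y → part y ≡ relabel y (ℓ y)
          part-relabel y = refl

        missed-unique : ∀ {y i j} → D y ≡ true → G (x i) y ≡ false → G (x j) y ≡ false → i ≡ j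
        missed-unique {y} {i} {j} Dy ei ej = #≤1⇒unique (λ i → D y ∧ not (G (x i) y))
          (≤-trans (m≤n+m (missed y) (ι (W y))) (≤-trans (D-partition y) (ι≤1 (D y)))) i j (∧-intro Dy (cong not ei)) (∧-intro Dy (cong not ej))

        relabel-W : ∀ y k → ℓ y ≡ k → ⌊ relabel y k ≟ fzero ⌋ ≡ W y
        relabel-W y (fsuc i) e = sym (cong (_∧ ⌊ 𝔽.all? (λ i → G (x i) y 𝔹.≟ true) ⌋) (D-S e))
        relabel-W y fzero e = trans (go (misses? y)) (cong (_∧ ⌊ 𝔽.all? (λ i → G (x i) y 𝔹.≟ true) ⌋) (sym (⌊⌋⁺ (ℓ y ≟ fzero) e)))
          where
          go : ∀ h → ⌊ assign y h ≟ fzero ⌋ ≡ ⌊ 𝔽.all? (λ i → G (x i) y 𝔹.≟ true) ⌋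
          go (yes (i , h)) = sym (⌊⌋⁺′ (𝔽.all? (λ i → G (x i) y 𝔹.≟ true)) (λ all → true≢false (all i) h))
          go (no ¬h) = sym (⌊⌋⁺ (𝔽.all? (λ i → G (x i) y 𝔹.≟ true)) (λ i → trans (sym (𝔹.not-involutive _)) (cong not (not-true (λ e → ¬h (i , trans (sym (𝔹.not-involutive _)) (cong not e)))))))

        -- On `D` such a vertex copies its representative, whose non-neighbours there were moved
        -- into class `i`; elsewhere it misses only its own class.
        perfect⁺ : ∀ i v → (S i v ∧ like (x i) v) ≡ true → cross v ≡ 0 → perfect G part i v ≡ true
        perfect⁺ i v Sv c0 = ⌊⌋⁺ (𝔽.all? (λ u → G v u 𝔹.≟ not ⌊ part u ≟ fsuc i ⌋)) (λ u → trans (nb u (ℓ u) refl) (cong (λ k → not ⌊ k ≟ fsuc i ⌋) (sym (part-relabel u))))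
          where
          ev : ℓ v ≡ fsuc i
          ev = S⁻ {i} (proj₁ (∧-elim {S i v} Sv))
          nocross : ∀ u → crossPair v u ≡ false
          nocross u = not-true λ e → 1+n≰n (≤-trans (≤-trans (≤-reflexive (cong ι (sym e))) (term≤∑ (λ u → ι (crossPair v u)) u)) (≤-reflexive c0))
          nb : ∀ u k → ℓ u ≡ k → G v u ≡ not ⌊ relabel u k ≟ fsuc i ⌋
          nb u (fsuc j) eu with j ≟ i
          ... | yes refl = indep v u i ev eu
          ... | no ne = crossPair⁻ {v} {u} ev eu (ne ∘ sym) (nocross u)
          nb u fzero eu = trans (like⁻ {x i} {v} {u} (proj₂ (∧-elim {S i v} Sv)) Du) (go (misses? u))
            where
            Du : D u ≡ true
            Du = ⌊⌋⁺ (ℓ u ≟ fzero) eu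
            go : ∀ h → G (x i) u ≡ not ⌊ assign u h ≟ fsuc i ⌋
            go (no ¬h) = trans (sym (𝔹.not-involutive _)) (cong not (not-true (λ e → ¬h (i , trans (sym (𝔹.not-involutive _)) (cong not e)))))
            go (yes (j , h)) with j ≟ i
            ... | yes refl = h
            ... | no ne = trans (sym (𝔹.not-involutive _)) (cong not (not-true (λ e → ne (missed-unique Du h (trans (sym (𝔹.not-involutive _)) (cong not e))))))

        -- Each imperfect vertex alike to `x i` has a missing cross pair, and `Crs ≤ E` allows at
        -- most `E` of them.
        perfect-many : ∀ i → suc t ≤ # (perfect G part i)
        perfect-many i = +-cancelʳ-≤ E _ _ (begin
          suc t + E                                    ≡⟨ cong suc (+-comm t E) ⟩
          suc (E + t)                                  ≤⟨ s≤s (m≤n+m (E + t) T₁) ⟩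
          suc (T₂ E)                                       ≤⟨ like-many i ⟩
          # (λ v → S i v ∧ like (x i) v)               ≤⟨ ∑-mono pw ⟩
          ∑ (λ v → ι (perfect G part i v) + ι (S i v) * cross v) ≡⟨ ∑-distrib-+ (ι ∘ perfect G part i) (λ v → ι (S i v) * cross v) ⟩
          # (perfect G part i) + over cross i          ≤⟨ +-monoʳ-≤ (# (perfect G part i)) (≤-trans (term≤∑ (over cross) i) Crs≤E) ⟩
          # (perfect G part i) + E                     ∎)
          where
          open ≤-Reasoning
          pw : ∀ v → ι (S i v ∧ like (x i) v) ≤ ι (perfect G part i v) + ι (S i v) * cross v
          pw v = go (S i v ∧ like (x i) v) refl (cross v) refl
            where
            go : ∀ b → (S i v ∧ like (x i) v) ≡ b → ∀ k → cross v ≡ k → ι b ≤ ι (perfect G part i v) + ι (S i v) * k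
            go false _ _ _ = z≤n
            go true e zero c0 = ≤-trans (≤-reflexive (cong ι (sym (perfect⁺ i v e c0)))) (m≤m+n _ _)
            go true e (suc k) _ = ≤-trans (≤-trans (s≤s z≤n) (≤-reflexive (cong (λ b → ι b * suc k) (sym (proj₁ (∧-elim {S i v} e)))))) (m≤n+m _ (ι (perfect G part i v)))

        part-W : ∀ y → ⌊ part y ≟ fzero ⌋ ≡ W y
        part-W y = trans (cong (λ k → ⌊ k ≟ fzero ⌋) (part-relabel y)) (relabel-W y (ℓ y) refl)

        part-size : # (λ y → ⌊ part y ≟ fzero ⌋) ≡ p
        part-size = trans (∑-cong (λ y → cong ι (part-W y))) W-size

        perfectPartition : PerfectPartition G r p t part
        perfectPartition = part-size , perfect-many

-- `c` is the degree slack and `C₁` the allowed shortfall of the degree sum. The upper bound is a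
-- separate part because it is what later yields the degree condition for extremal graphs.
StructureTheorem : (r₂ c t p C₁ : ℕ) → Set
StructureTheorem r₂ c t p C₁ = let r₁ = suc r₂ ; r = suc r₁ in
  ∃[ n₀ ] ∃[ C₂ ] ∀ n → n₀ ≤ n → (G : Graph n) → IsSimple G → (∀ v → r₁ * n ≤ r * deg G v + c) →
  ¬ ((Empty (suc p) ⊗ Turan (t * r) r) ⊆ᴳ G) → ¬ ((copies t K2 ⊗ Turan (t * r₁) r₁) ⊆ᴳ G) →
  r * degSum G ≤ r₁ * (n * n) + 2 * (n * p) + C₂ ×
  (r₁ * (n * n) + 2 * (n * p) ≤ r * degSum G + C₁ → Σ (Fin n → Fin (suc r)) (PerfectPartition G r p t))

structure-from : ∀ r₂ c t p C₁ → NearColourable r₂ c t p → StructureTheorem r₂ c t p C₁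
structure-from r₂ c t p C₁ (n₁ , d , colour) = n₁ + size₁ Θ₁ + size₁ (suc (T₂ E) * 2 ^ d + E) + suc E , CA Θ₁ , build
  where
  open Constants (suc r₂) c t d
  r₁ E : ℕ
  r₁ = suc r₂
  E = CA Θ₁ + C₁
  build : ∀ n → n₁ + size₁ Θ₁ + size₁ (suc (T₂ E) * 2 ^ d + E) + suc E ≤ n → (G : Graph n) → IsSimple G → (∀ v → r₁ * n ≤ suc r₁ * deg G v + c) →
    ¬ ((Empty (suc p) ⊗ Turan (t * suc r₁) (suc r₁)) ⊆ᴳ G) → ¬ ((copies t K2 ⊗ Turan (t * r₁) r₁) ⊆ᴳ G) →
    suc r₁ * degSum G ≤ r₁ * (n * n) + 2 * (n * p) + CA Θ₁ ×
    (r₁ * (n * n) + 2 * (n * p) ≤ suc r₁ * degSum G + C₁ → Σ (Fin n → Fin (suc (suc r₁))) (PerfectPartition G (suc r₁) p t))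
  build n n≥ G sG δ noX₀ noX₁ = go (colour n (≤-trans (≤-trans (m≤m+n n₁ _) ≤₂) ≤₁) G sG δ noX₀ noX₁)
    where
    ≤₁ : n₁ + size₁ Θ₁ + size₁ (suc (T₂ E) * 2 ^ d + E) ≤ n
    ≤₁ = ≤-trans (m≤m+n _ (suc E)) n≥
    ≤₂ : n₁ + size₁ Θ₁ ≤ n₁ + size₁ Θ₁ + size₁ (suc (T₂ E) * 2 ^ d + E)
    ≤₂ = m≤m+n _ _
    large₁ : size₁ Θ₁ ≤ n
    large₁ = ≤-trans (m≤n+m _ n₁) (≤-trans ≤₂ ≤₁)
    large₂ : size₁ (suc (T₂ E) * 2 ^ d + E) ≤ n
    large₂ = ≤-trans (m≤n+m _ (n₁ + size₁ Θ₁)) ≤₁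
    noX₀′ : ∀ (f : Fin (suc p) → Fin n) (B : Fin (suc r₁) → Fin t → Fin n) → Injective _≡_ _≡_ f →
      KPart G (suc r₁) t B → (∀ a i b → G (f a) (B i b) ≡ true) → ⊥
    noX₀′ f B fi kB adj = noX₀ (⊗Turan-embed {H = Empty (suc p)} G sG (Empty-embed {G = G} f fi) B kB adj)
    go : (Σ (Fin n → Fin (suc (suc r₁))) λ ℓ → # (λ v → ⌊ ℓ v ≟ fzero ⌋) ≤ d ×
        (∀ x y i → ℓ x ≡ fsuc i → ℓ y ≡ fsuc i → G x y ≡ false)) →
      suc r₁ * degSum G ≤ r₁ * (n * n) + 2 * (n * p) + CA Θ₁ ×
      (r₁ * (n * n) + 2 * (n * p) ≤ suc r₁ * degSum G + C₁ → Σ (Fin n → Fin (suc (suc r₁))) (PerfectPartition G (suc r₁) p t))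
    go (ℓ , fewD , indep) =
      Structure.Conclusion.degSum-upper G sG r₁ c p t d δ noX₀′ ℓ fewD indep large₁ ,
      λ dense → _ , Structure.Conclusion.Extremal.perfectPartition G sG r₁ c p t d δ noX₀′ ℓ fewD indep large₁ C₁ dense
        large₂ (≤-trans (m≤n+m (suc E) _) n≥)

structure : ∀ r₂ c t p C₁ → StructureTheorem r₂ c t p C₁
structure r₂ c t p C₁ = structure-from r₂ c t p C₁ (near-colouring r₂ c t p)

-- A dense host-free graph

∑-++ : ∀ m {n} (f : Fin (m + n) → ℕ) → ∑ f ≡ ∑ (λ i → f (i ↑ˡ n)) + ∑ (λ j → f (m ↑ʳ j))
∑-++ zero f = refl
∑-++ (suc m) f = trans (cong (f fzero +_) (∑-++ m (f ∘ fsuc))) (sym (+-assoc (f fzero) _ _))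

∑-combine : ∀ m {n} (f : Fin (m * n) → ℕ) → ∑ f ≡ ∑ (λ i → ∑ (λ j → f (combine {m} i j)))
∑-combine zero f = refl
∑-combine (suc m) {n} f = trans (∑-++ n f) (cong (∑ (λ j → f (j ↑ˡ m * n)) +_) (∑-combine m (λ z → f (n ↑ʳ z))))

multipartite : ∀ {n m} → (Fin n → Fin m) → Graph n
multipartite L u v = not ⌊ L u ≟ L v ⌋

multipartite-simple : ∀ {n m} (L : Fin n → Fin m) → IsSimple (multipartite L)
multipartite-simple L = (λ i j → cong not (≟-comm (L i) (L j))) , λ i → cong not (⌊⌋⁺ (L i ≟ L i) refl)

multipartite-degSum : ∀ {n m} (L : Fin n → Fin m) →
  degSum (multipartite L) + ∑ (λ k → # (λ v → ⌊ L v ≟ k ⌋) * # (λ v → ⌊ L v ≟ k ⌋)) ≡ n * n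
multipartite-degSum {n} L = begin
  degSum (multipartite L) + ∑ (λ k → size k * size k)
    ≡⟨ cong (degSum (multipartite L) +_) squares ⟩
  degSum (multipartite L) + ∑ (λ u → size (L u))
    ≡⟨ sym (∑-distrib-+ (deg (multipartite L)) (λ u → size (L u))) ⟩
  ∑ (λ u → deg (multipartite L) u + size (L u))
    ≡⟨ ∑-cong (λ u → trans (+-comm (deg (multipartite L) u) (size (L u))) (trans (cong (_+ deg (multipartite L) u) (∑-cong (λ v → cong ι (≟-comm (L v) (L u))))) (#-compl (λ v → ⌊ L u ≟ L v ⌋)))) ⟩
  ∑ {n} (λ _ → n)
    ≡⟨ ∑-const n n ⟩
  n * n ∎
  where
  open ≡-Reasoning
  size : _ → ℕ
  size k = # (λ v → ⌊ L v ≟ k ⌋)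
  squares : ∑ (λ k → size k * size k) ≡ ∑ (λ u → size (L u))
  squares = trans (∑-cong (λ k → trans (sym (∑-*ʳ (size k) (λ v → ι ⌊ L v ≟ k ⌋))) (∑-cong (λ v → pw v k)))) (∑-classes L (λ u → size (L u)))
    where
    pw : ∀ v k → ι ⌊ L v ≟ k ⌋ * size k ≡ ι ⌊ L v ≟ k ⌋ * size (L v)
    pw v k with L v ≟ k
    ... | yes refl = refl
    ... | no _ = refl

-- The complete multipartite graph with one part of size `p`, one of size `j + k` and `r₁` of size
-- `k`. Putting the whole remainder `j` in one part costs `r₁ * (j * j)`, a constant once `j ≤ r₁`.
module LowerBound (p j r₁ k : ℕ) where

  r n : ℕ
  r = suc r₁
  n = p + (j + r * k)

  place : Fin (j + r * k) → Fin r
  place w = [ (λ _ → fzero) , (λ z → proj₁ (remQuot {r} k z)) ]′ (splitAt j w)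

  role : Fin n → Fin p ⊎ Fin (j + r * k)
  role = splitAt p

  part-of : Fin p ⊎ Fin (j + r * k) → Fin (suc r)
  part-of (inj₁ _) = fzero
  part-of (inj₂ w) = fsuc (place w)

  L : Fin n → Fin (suc r)
  L v = part-of (role v)

  H : Graph n
  H = multipartite L

  size-0 : # (λ v → ⌊ L v ≟ fzero ⌋) ≡ p
  size-0 = trans (∑-++ p (λ v → ι ⌊ L v ≟ fzero ⌋)) (trans (cong₂ _+_
    (trans (∑-cong (λ i → cong (λ z → ι ⌊ part-of z ≟ fzero ⌋) (𝔽.splitAt-↑ˡ p i (j + r * k)))) (trans (∑-const p 1) (*-identityʳ p)))
    (trans (∑-cong (λ w → cong (λ z → ι ⌊ part-of z ≟ fzero ⌋) (𝔽.splitAt-↑ʳ p (j + r * k) w))) (trans (∑-const (j + r * k) 0) (*-zeroʳ (j + r * k))))) (+-identityʳ p))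

  size-suc : ∀ i → # (λ v → ⌊ L v ≟ fsuc i ⌋) ≡ ι ⌊ i ≟ fzero ⌋ * j + k
  size-suc i = trans (∑-++ p (λ v → ι ⌊ L v ≟ fsuc i ⌋)) (trans (cong₂ _+_
    (trans (∑-cong (λ a → cong (λ z → ι ⌊ part-of z ≟ fsuc i ⌋) (𝔽.splitAt-↑ˡ p a (j + r * k)))) (trans (∑-const p 0) (*-zeroʳ p)))
    (trans (∑-cong (λ w → cong (λ z → ι ⌊ part-of z ≟ fsuc i ⌋) (𝔽.splitAt-↑ʳ p (j + r * k) w))) rest))
    refl)
    where
    fs : ∀ {m} (a b : Fin m) → ⌊ fsuc a ≟ fsuc b ⌋ ≡ ⌊ b ≟ a ⌋
    fs a b with b ≟ a
    ... | yes refl = ⌊⌋⁺ (fsuc a ≟ fsuc a) refl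
    ... | no ne = ⌊⌋⁺′ (fsuc a ≟ fsuc b) (ne ∘ sym ∘ 𝔽.suc-injective)
    pick-place : Fin j ⊎ Fin (r * k) → Fin r
    pick-place = [ (λ _ → fzero) , (λ z → proj₁ (remQuot {r} k z)) ]′
    rest : ∑ (λ w → ι ⌊ fsuc (place w) ≟ fsuc i ⌋) ≡ ι ⌊ i ≟ fzero ⌋ * j + k
    rest = trans (∑-++ j (λ w → ι ⌊ fsuc (place w) ≟ fsuc i ⌋)) (cong₂ _+_
      (trans (∑-cong (λ a → cong ι (trans (cong (λ z → ⌊ fsuc (pick-place z) ≟ fsuc i ⌋) (𝔽.splitAt-↑ˡ j a (r * k))) (fs fzero i))))
        (trans (∑-const j (ι ⌊ i ≟ fzero ⌋)) (*-comm j (ι ⌊ i ≟ fzero ⌋))))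
      (trans (∑-combine r (λ w → ι ⌊ fsuc (place (j ↑ʳ w)) ≟ fsuc i ⌋))
        (trans (∑-cong (λ a → trans (∑-cong (λ b → cong ι (trans (cong (λ z → ⌊ fsuc (pick-place z) ≟ fsuc i ⌋) (𝔽.splitAt-↑ʳ j (r * k) (combine a b)))
          (trans (fs (proj₁ (remQuot {r} k (combine a b))) i) (trans (cong (λ z → ⌊ i ≟ proj₁ z ⌋) (𝔽.remQuot-combine a b)) (≟-comm i a)))))) (trans (∑-const k (ι ⌊ a ≟ i ⌋)) (*-comm k (ι ⌊ a ≟ i ⌋))))) (∑-≟ i k))))

  H-dense : r₁ * (n * n) + 2 * (n * p) + r₁ * (j * j) ≤ r * degSum H + suc r * (p * p) + 2 * (r₁ * (j * j))
  H-dense = lin 0 (≤-reflexive (cong (r *_) total)) (alg p j r₁ k (degSum H))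
    where
    total : n * n ≡ degSum H + (p * p + ((j + k) * (j + k) + r₁ * (k * k)))
    total = trans (sym (multipartite-degSum L)) (cong (degSum H +_) (cong₂ _+_ (cong₂ _*_ size-0 size-0)
      (cong₂ _+_ (trans (cong₂ _*_ (size-suc fzero) (size-suc fzero)) (cong (λ z → (z + k) * (z + k)) (+-identityʳ j)))
        (trans (∑-cong (λ i → cong₂ _*_ (size-suc (fsuc i)) (size-suc (fsuc i)))) (∑-const r₁ (k * k))))))
    alg : ∀ p j r₁ k D → let r = suc r₁ ; n = p + (j + r * k) in
      r₁ * (n * n) + 2 * (n * p) + r₁ * (j * j) + r * (D + (p * p + ((j + k) * (j + k) + r₁ * (k * k)))) + 0
      ≡ r * D + suc r * (p * p) + 2 * (r₁ * (j * j)) + r * (n * n)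
    alg = solve-∀

  -- Vertex `a` of `F` goes to slot `a` of its class, so `t` slots per class avoid collisions. As
  -- `p < q`, no member of the family embeds in the target, hence none in `H`.
  H-embed : ∀ {m t} (F : Graph m) → m ≤ t → F ⊆ᴳ H → F ⊆ᴳ (Empty p ⊗ Turan (t * r) r)
  H-embed {m} {t} F m≤t (f , fi , fe) = g , gi , ge
    where
    spot : Fin m → Fin p ⊎ Fin (j + r * k) → Fin (p + t * r)
    spot a (inj₁ w) = w ↑ˡ (t * r)
    spot a (inj₂ w) = p ↑ʳ combine (inject≤ a m≤t) (place w)
    g : Fin m → Fin (p + t * r)
    g a = spot a (role (f a))
    spot-injective : ∀ a b x y → spot a x ≡ spot b y → role (f a) ≡ x → role (f b) ≡ y → a ≡ b
    spot-injective a b (inj₁ w) (inj₁ w′) e ea eb with 𝔽.↑ˡ-injective (t * r) w w′ e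
    ... | refl = fi (trans (sym (𝔽.splitAt⁻¹-↑ˡ ea)) (𝔽.splitAt⁻¹-↑ˡ eb))
    spot-injective a b (inj₁ w) (inj₂ w′) e ea eb with trans (sym (𝔽.splitAt-↑ˡ p w (t * r))) (trans (cong (splitAt p) e) (𝔽.splitAt-↑ʳ p (t * r) _))
    ... | ()
    spot-injective a b (inj₂ w) (inj₁ w′) e ea eb with trans (sym (𝔽.splitAt-↑ʳ p (t * r) _)) (trans (cong (splitAt p) e) (𝔽.splitAt-↑ˡ p w′ (t * r)))
    ... | ()
    spot-injective a b (inj₂ w) (inj₂ w′) e ea eb =
      𝔽.inject≤-injective m≤t m≤t a b (𝔽.combine-injectiveˡ (inject≤ a m≤t) (place w) (inject≤ b m≤t) (place w′) (𝔽.↑ʳ-injective p _ _ e))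
    gi : Injective _≡_ _≡_ g
    gi {a} {b} e = spot-injective a b (role (f a)) (role (f b)) e refl refl
    spot-edge : ∀ a b x y → not ⌊ part-of x ≟ part-of y ⌋ ≡ true → (Empty p ⊗ Turan (t * r) r) (spot a x) (spot b y) ≡ true
    spot-edge a b (inj₁ w) (inj₁ w′) ()
    spot-edge a b (inj₁ w) (inj₂ w′) h rewrite 𝔽.splitAt-↑ˡ p w (t * r) | 𝔽.splitAt-↑ʳ p (t * r) (combine (inject≤ b m≤t) (place w′)) = refl
    spot-edge a b (inj₂ w) (inj₁ w′) h rewrite 𝔽.splitAt-↑ˡ p w′ (t * r) | 𝔽.splitAt-↑ʳ p (t * r) (combine (inject≤ a m≤t) (place w)) = refl
    spot-edge a b (inj₂ w) (inj₂ w′) h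
      rewrite 𝔽.splitAt-↑ʳ p (t * r) (combine (inject≤ a m≤t) (place w)) | 𝔽.splitAt-↑ʳ p (t * r) (combine (inject≤ b m≤t) (place w′))
      = cong not (≡ᵇ-false _ _ λ e → true≢false h (cong not (⌊⌋⁺ (fsuc (place w) ≟ fsuc (place w′))
          (cong fsuc (𝔽.toℕ-injective (trans (sym (res (inject≤ a m≤t) (place w))) (trans e (res (inject≤ b m≤t) (place w′)))))))))
      where
      res : ∀ (a : Fin t) (i : Fin r) → toℕ (combine a i) % r ≡ toℕ i
      res a i = trans (residue t r₁ (combine a i)) (cong (toℕ ∘ proj₂) (𝔽.remQuot-combine a i))
      ≡ᵇ-false : ∀ a b → a ≢ b → (a ≡ᵇ b) ≡ false
      ≡ᵇ-false zero zero ne = ⊥-elim (ne refl)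
      ≡ᵇ-false zero (suc b) ne = refl
      ≡ᵇ-false (suc a) zero ne = refl
      ≡ᵇ-false (suc a) (suc b) ne = ≡ᵇ-false a b (ne ∘ cong suc)
    ge : ∀ a b → F a b ≡ true → (Empty p ⊗ Turan (t * r) r) (g a) (g b) ≡ true
    ge a b h = spot-edge a b (role (f a)) (role (f b)) (fe a b h)

DenseHostFree : (p r₁ n : ℕ) → Set
DenseHostFree p r₁ n = Σ (Graph n) λ H → IsSimple H ×
  (∀ {m t} (F : Graph m) → m ≤ t → F ⊆ᴳ H → F ⊆ᴳ (Empty p ⊗ Turan (t * suc r₁) (suc r₁))) ×
  r₁ * (n * n) + 2 * (n * p) ≤ suc r₁ * degSum H + (suc (suc r₁) * (p * p) + r₁ * (r₁ * r₁))

dense-host-free : ∀ p r₁ n → p ≤ n → DenseHostFree p r₁ n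
dense-host-free p r₁ n p≤n = subst (DenseHostFree p r₁) decomp
  (LB.H , multipartite-simple LB.L , LB.H-embed , lin 0 (+-mono-≤ LB.H-dense (*-monoʳ-≤ r₁ (*-mono-≤ j≤ j≤))) (alg _ (suc r₁ * degSum LB.H) (suc (suc r₁) * (p * p)) r₁ j))
  where
  j k : ℕ
  j = (n ∸ p) % suc r₁
  k = (n ∸ p) / suc r₁
  j≤ : j ≤ r₁
  j≤ = s≤s⁻¹ (m%n<n (n ∸ p) (suc r₁))
  module LB = LowerBound p j r₁ k
  alg : ∀ X g P r₁ j → X + (g + P + 2 * (r₁ * (j * j)) + r₁ * (r₁ * r₁)) + 0 ≡ g + (P + r₁ * (r₁ * r₁)) + (X + r₁ * (j * j) + r₁ * (j * j))
  alg = solve-∀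
  decomp : p + (j + suc r₁ * k) ≡ n
  decomp = trans (cong (p +_) (trans (cong (j +_) (*-comm (suc r₁) k)) (sym (m≡m%n+[m/n]*n (n ∸ p) (suc r₁))))) (m+[n∸m]≡n p≤n)

-- From a perfect partition to the balanced one

quotient-unique : ∀ a N r₁ → suc r₁ * a ≤ N → N < suc r₁ * suc a → N / suc r₁ ≡ a
quotient-unique a N r₁ lo hi = ≤-antisym
  (s≤s⁻¹ (m<n*o⇒m/o<n (≤-trans hi (≤-reflexive (*-comm (suc r₁) (suc a))))))
  (≤-trans (≤-reflexive (sym (m*n/n≡m a (suc r₁)))) (/-monoˡ-≤ (suc r₁) (≤-trans (≤-reflexive (*-comm a (suc r₁))) lo)))

-- A size with none smaller is the floor of the average; otherwise `s i` is a maximum with a smaller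
-- size present, hence the ceiling.
balanced : ∀ {r₁} (s : Fin (suc r₁) → ℕ) → (∀ i j → s i ≤ suc (s j)) → ∀ i →
  s i ≡ ∑ s / suc r₁ ⊎ s i ≡ (∑ s + r₁) / suc r₁
balanced {r₁} s bal i with 𝔽.any? (λ j → suc (s j) ≤? s i)
... | no ¬smaller = inj₁ (sym (quotient-unique (s i) (∑ s) r₁ (∑-lower (λ j → ≮⇒≥ (λ h → ¬smaller (j , h)))) (begin
    suc (∑ s)                         ≡⟨ +-comm 1 (∑ s) ⟩
    ∑ s + 1                           ≡⟨ cong (∑ s +_) (sym (#-≟ i)) ⟩
    ∑ s + # (λ k → ⌊ k ≟ i ⌋)         ≡⟨ sym (∑-distrib-+ s (λ k → ι ⌊ k ≟ i ⌋)) ⟩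
    ∑ (λ k → s k + ι ⌊ k ≟ i ⌋)       ≤⟨ ∑-bound pw ⟩
    suc r₁ * suc (s i)                ∎)))
  where
  open ≤-Reasoning
  pw : ∀ k → s k + ι ⌊ k ≟ i ⌋ ≤ suc (s i)
  pw k with k ≟ i
  ... | yes refl = ≤-reflexive (+-comm (s k) 1)
  ... | no _ = ≤-trans (≤-reflexive (+-identityʳ (s k))) (bal k i)
... | yes (j , sj<si) = inj₂ (sym (quotient-unique (s i) (∑ s + r₁) r₁
    (lin 0 lower (alg₁ r₁ (s i) (∑ s)))
    (≤-trans (s≤s (+-monoˡ-≤ r₁ (∑-bound (λ k → ≤-trans (bal k j) sj<si)))) (≤-reflexive (alg₂ r₁ (s i))))))
  where
  alg₁ : ∀ r s S → suc r * s + (suc r * 1 + S) + 0 ≡ S + r + (suc r * s + 1)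
  alg₁ = solve-∀
  alg₂ : ∀ r s → suc (suc r * s + r) ≡ suc r * suc s
  alg₂ = solve-∀
  lower : suc r₁ * s i + 1 ≤ suc r₁ * 1 + ∑ s
  lower = begin
    suc r₁ * s i + 1                                ≡⟨ cong₂ _+_ (sym (∑-const (suc r₁) (s i))) (sym (#-≟ i)) ⟩
    ∑ {suc r₁} (λ _ → s i) + # (λ k → ⌊ k ≟ i ⌋)    ≡⟨ sym (∑-distrib-+ (λ _ → s i) (λ k → ι ⌊ k ≟ i ⌋)) ⟩
    ∑ (λ k → s i + ι ⌊ k ≟ i ⌋)                     ≤⟨ ∑-mono pw ⟩
    ∑ (λ k → 1 + s k)                               ≡⟨ ∑-distrib-+ (λ _ → 1) s ⟩
    ∑ {suc r₁} (λ _ → 1) + ∑ s                      ≡⟨ cong (_+ ∑ s) (∑-const (suc r₁) 1) ⟩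
    suc r₁ * 1 + ∑ s                                ∎
    where
    open ≤-Reasoning
    pw : ∀ k → s i + ι ⌊ k ≟ i ⌋ ≤ 1 + s k
    pw k with k ≟ i
    ... | yes refl = ≤-reflexive (+-comm (s k) 1)
    ... | no _ = ≤-trans (≤-reflexive (+-identityʳ (s i))) (bal i k)

glue-all : ∀ {a b n} {f : Fin a → Fin n} {g : Fin b → Fin n} (Q : Fin n → Set) →
  (∀ i → Q (f i)) → (∀ j → Q (g j)) → ∀ k → Q (glue f g k)
glue-all {a} Q qf qg k with splitAt a k
... | inj₁ i = qf i
... | inj₂ j = qg j

module FinalPartition {n} (G : Graph n) (sG : IsSimple G) (r₂ p t : ℕ)
  (part : Fin n → Fin (suc (suc (suc r₂)))) (W-size : # (λ v → ⌊ part v ≟ fzero ⌋) ≡ p)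
  (perfect-many : ∀ i → suc t ≤ # (perfect G part i))
  (noX₁ : ¬ ((copies t K2 ⊗ Turan (t * suc r₂) (suc r₂)) ⊆ᴳ G))
  (noX₂ : ¬ (((Kbip p t ∪ᴳ Kbip 1 t) ⊗ Turan (t * suc r₂) (suc r₂)) ⊆ᴳ G))
  (clone : ∀ x ν (P : Fin n → Bool) → ν x ≡ false → suc t ≤ # P →
    (∀ x′ → P x′ ≡ true → ∀ z → ν z ≡ true → G x′ z ≡ true) → # ν ≤ deg G x) where

  r₁ r : ℕ
  r₁ = suc r₂
  r = suc r₁

  S : Fin r → Fin n → Bool
  S i v = ⌊ part v ≟ fsuc i ⌋
  s : Fin r → ℕ
  s i = # (S i)

  perfect⁻ : ∀ {i v} → perfect G part i v ≡ true → ∀ u → G v u ≡ not (S i u)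
  perfect⁻ {i} {v} h = ⌊⌋⁻ (𝔽.all? (λ u → G v u 𝔹.≟ not (S i u))) h

  perfect⇒S : ∀ {i v} → perfect G part i v ≡ true → S i v ≡ true
  perfect⇒S {i} {v} h = trans (sym (𝔹.not-involutive _)) (cong not (trans (sym (perfect⁻ h v)) (proj₂ sG v)))

  S-disjoint : ∀ {i j v} → S i v ≡ true → i ≢ j → S j v ≡ false
  S-disjoint {i} {j} {v} h ne = ⌊⌋⁺′ (part v ≟ fsuc j) (λ e → ne (𝔽.suc-injective (trans (sym (⌊⌋⁻ (part v ≟ fsuc i) h)) e)))

  size-total : ∑ s + p ≡ n
  size-total = trans (+-comm (∑ s) p) (trans (cong₂ _+_ (trans (sym W-size) (∑-cong (λ v → sym (*-identityʳ (ι ⌊ part v ≟ fzero ⌋)))))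
    (∑-cong (λ i → ∑-cong (λ v → sym (*-identityʳ (ι (S i v)))))))
    (trans (∑-classes part (λ _ → 1)) (trans (∑-const n 1) (*-identityʳ n))))

  -- Rewiring x to the neighbourhood of the perfect vertices of S i creates no forbidden subgraph.
  clone-degree : ∀ x i → n ≤ deg G x + s i + ι (not (S i x))
  clone-degree x i = begin
    n                                          ≡⟨ sym (#-compl (S i)) ⟩
    s i + # (not ∘ S i)                        ≤⟨ +-monoʳ-≤ (s i) (∑-mono pw) ⟩
    s i + ∑ (λ u → ι (ν u) + ι ⌊ u ≟ x ⌋ * b)  ≡⟨ cong (s i +_) (trans (∑-distrib-+ (ι ∘ ν) (λ u → ι ⌊ u ≟ x ⌋ * b)) (cong (# ν +_) (∑-≟ x b))) ⟩
    s i + (# ν + b)                            ≤⟨ +-monoʳ-≤ (s i) (+-monoˡ-≤ b (clone x ν (perfect G part i) νx (perfect-many i) twin)) ⟩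
    s i + (deg G x + b)                        ≡⟨ alg (s i) (deg G x) b ⟩
    deg G x + s i + b                          ∎
    where
    open ≤-Reasoning
    b = ι (not (S i x))
    alg : ∀ s g b → s + (g + b) ≡ g + s + b
    alg = solve-∀
    ν : Fin n → Bool
    ν u = not (S i u) ∧ not ⌊ u ≟ x ⌋
    νx : ν x ≡ false
    νx = trans (cong (λ z → not (S i x) ∧ not z) (⌊⌋⁺ (x ≟ x) refl)) (𝔹.∧-zeroʳ (not (S i x)))
    twin : ∀ x′ → perfect G part i x′ ≡ true → ∀ z → ν z ≡ true → G x′ z ≡ true
    twin x′ h z νz = trans (perfect⁻ h z) (proj₁ (∧-elim νz))
    pw : ∀ u → ι (not (S i u)) ≤ ι (ν u) + ι ⌊ u ≟ x ⌋ * b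
    pw u with u ≟ x
    ... | yes refl = ≤-trans (≤-reflexive (sym (+-identityʳ b))) (m≤n+m (b + 0) (ι (not (S i u) ∧ false)))
    ... | no _ = ≤-trans (≤-reflexive (cong ι (sym (𝔹.∧-identityʳ (not (S i u)))))) (m≤m+n (ι (not (S i u) ∧ true)) 0)

  -- A perfect vertex of class `i` has degree `n − s i`; giving it the neighbourhood of a perfect
  -- vertex of class `j` must not gain edges.
  sizes-close : ∀ i j → s i ≤ suc (s j)
  sizes-close i j with #-witness (perfect G part i) (≤-trans (s≤s z≤n) (perfect-many i))
  ... | x , h = lin (1 ∸ ι (not (S j x))) (+-mono-≤ (clone-degree x j) (≤-reflexive eq)) (trans (alg₁ (s i) (deg G x) (s j) (ι (not (S j x))) n (1 ∸ ι (not (S j x)))) (trans (cong (λ z → s i + deg G x + s j + n + z) (m+[n∸m]≡n (ι≤1 (not (S j x))))) (alg₂ (s i) (deg G x) (s j) n)))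
    where
    eq : deg G x + s i ≡ n
    eq = trans (+-comm (deg G x) (s i)) (trans (cong (s i +_) (∑-cong (λ u → cong ι (perfect⁻ h u)))) (#-compl (S i)))
    alg₁ : ∀ a g c b n y → a + (g + c + b + n) + y ≡ a + g + c + n + (b + y)
    alg₁ = solve-∀
    alg₂ : ∀ a g c n → a + g + c + n + 1 ≡ suc c + (n + (g + a))
    alg₂ = solve-∀

  -- All neighbours lie outside `S i`, and `clone-degree` shows that there are as many of them as
  -- vertices outside.
  isolated⇒perfect : ∀ x i → S i x ≡ true → nonIsolated G (S i) x ≡ false → perfect G part i x ≡ true
  isolated⇒perfect x i Sx iso = ⌊⌋⁺ (𝔽.all? (λ u → G x u 𝔹.≟ not (S i u))) same
    where
    outside : ∀ u → G x u ≡ true → not (S i u) ≡ true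
    outside u e with S i u in Su
    ... | false = refl
    ... | true = ⊥-elim (true≢false (nonIsolated⁺ G (S i) Sx Su e) iso)
    total : # (not ∘ S i) ≤ deg G x
    total = +-cancelˡ-≤ (s i) _ _ (begin
      s i + # (not ∘ S i)                ≡⟨ #-compl (S i) ⟩
      n                                  ≤⟨ clone-degree x i ⟩
      deg G x + s i + ι (not (S i x))    ≡⟨ trans (cong (λ b → deg G x + s i + ι (not b)) Sx) (trans (+-identityʳ _) (+-comm (deg G x) (s i))) ⟩
      s i + deg G x                      ∎)
      where open ≤-Reasoning
    same : ∀ u → G x u ≡ not (S i u)
    same u = ι-≡ (ι-mono (outside u)) (∑-tight (λ u → ι-mono (outside u)) total u)
      where
      ι-≡ : ∀ {a b} → ι a ≤ ι b → ι b ≤ ι a → a ≡ b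
      ι-≡ {false} {false} _ _ = refl
      ι-≡ {true} {true} _ _ = refl
      ι-≡ {false} {true} _ ()
      ι-≡ {true} {false} () _

  chosen : ∀ i → Σ (Fin t → Fin n) λ f → Injective _≡_ _≡_ f × (∀ b → perfect G part i (f b) ≡ true)
  chosen i = pick (perfect G part i) t (≤-trans (n≤1+n t) (perfect-many i))

  others : Fin r → Fin r₁ → Fin t → Fin n
  others i j = proj₁ (chosen (punchIn i j))

  others-perfect : ∀ i j b → perfect G part (punchIn i j) (others i j b) ≡ true
  others-perfect i j b = proj₂ (proj₂ (chosen (punchIn i j))) b

  others-KPart : ∀ i → KPart G r₁ t (others i)
  others-KPart i = (λ j → proj₁ (proj₂ (chosen (punchIn i j)))) , λ j k a b ne →
    trans (perfect⁻ (others-perfect i j a) (others i k b))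
      (cong not (S-disjoint (perfect⇒S (others-perfect i k b)) (ne ∘ sym ∘ 𝔽.punchIn-injective i k j)))

  others-adj : ∀ i {v} → (∀ j → S (punchIn i j) v ≡ false) → ∀ j b → G v (others i j b) ≡ true
  others-adj i {v} off j b = trans (proj₁ sG v _) (trans (perfect⁻ (others-perfect i j b) v) (cong not (off j)))

  S-off : ∀ i {v} → S i v ≡ true → ∀ j → S (punchIn i j) v ≡ false
  S-off i h j = S-disjoint h (𝔽.punchInᵢ≢i i j ∘ sym)

  noMatch : ∀ i → ¬ Match G (S i) t
  noMatch i m with Match-embed G sG t (S i) m
  ... | e , inS = noX₁ (⊗Turan-embed {H = copies t K2} G sG e (others i) (others-KPart i) (λ k → others-adj i (S-off i (inS k))))

  -- The star at `u`, the complete bipartite graph between part 0 and `t` perfect vertices of `S i`,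
  -- and `t` perfect vertices from each other class would form the host of `F₂`.
  degree-inside : ∀ i u → S i u ≡ true → 1 ≤ t → # (λ v → S i v ∧ G u v) < t
  degree-inside i u Su t≥1 = ≰⇒> λ big → no-star (pick (λ v → S i v ∧ G u v) t big) (pick (λ v → ⌊ part v ≟ fzero ⌋) p (≤-reflexive (sym W-size)))
   where
   no-star : (Σ (Fin t → Fin n) λ f → Injective _≡_ _≡_ f × (∀ b → S i (f b) ∧ G u (f b) ≡ true)) →
     (Σ (Fin p → Fin n) λ w → Injective _≡_ _≡_ w × (∀ a → ⌊ part (w a) ≟ fzero ⌋ ≡ true)) → ⊥
   no-star (leaf , leaf-inj , leaf-ok) (w , w-inj , w-ok) =
    noX₂ (⊗Turan-embed {H = Kbip p t ∪ᴳ Kbip 1 t} G sG e (others i) (others-KPart i) (λ k → others-adj i (off k)))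
    where
    base : Fin t → Fin n
    base = proj₁ (chosen i)
    base-perfect : ∀ b → perfect G part i (base b) ≡ true
    base-perfect = proj₂ (proj₂ (chosen i))
    W⇒¬S : ∀ a j → S j (w a) ≡ false
    W⇒¬S a j = ⌊⌋⁺′ (part (w a) ≟ fsuc j) (λ e → 𝔽.0≢1+n (trans (sym (⌊⌋⁻ (part (w a) ≟ fzero) (w-ok a))) e))
    leafS : ∀ b → S i (leaf b) ≡ true
    leafS b = proj₁ (∧-elim (leaf-ok b))
    star : Fin 1 → Fin n
    star _ = u
    e₁ : Kbip p t ⊆ᴳ G
    e₁ = Kbip-embed {G = G} sG w base w-inj (proj₁ (proj₂ (chosen i))) (λ a b → trans (proj₁ sG _ _) (trans (perfect⁻ (base-perfect b) (w a)) (cong not (W⇒¬S a i))))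
    e₂ : Kbip 1 t ⊆ᴳ G
    e₂ = Kbip-embed {G = G} sG star leaf (λ { {fzero} {fzero} _ → refl }) leaf-inj (λ _ b → proj₂ (∧-elim {S i (leaf b)} (leaf-ok b)))
    w≢S : ∀ {v} a → S i v ≡ true → w a ≢ v
    w≢S a Sv refl = true≢false Sv (W⇒¬S a i)
    -- Perfect vertices have no neighbour inside `S i`, whereas the centre and the leaves have one.
    -- For the centre this takes a leaf, hence `1 ≤ t`.
    base≢ : ∀ {v} b z → S i z ≡ true → G v z ≡ true → base b ≢ v
    base≢ b z Sz e refl = true≢false e (trans (perfect⁻ (base-perfect b) z) (cong not Sz))
    disj : ∀ k l → proj₁ e₁ k ≢ proj₁ e₂ l
    disj = glue-all (λ v → ∀ l → v ≢ proj₁ e₂ l)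
      (λ a → glue-all (λ z → w a ≢ z) (λ _ → w≢S a Su) (λ b → w≢S a (leafS b)))
      (λ b → glue-all (λ z → base b ≢ z)
        (λ _ → base≢ b (leaf (fromℕ< t≥1)) (leafS _) (proj₂ (∧-elim {S i (leaf (fromℕ< t≥1))} (leaf-ok _))))
        (λ c → base≢ b u Su (trans (proj₁ sG _ _) (proj₂ (∧-elim {S i (leaf c)} (leaf-ok c))))))
    e : (Kbip p t ∪ᴳ Kbip 1 t) ⊆ᴳ G
    e = ∪ᴳ-embed {H₁ = Kbip p t} {H₂ = Kbip 1 t} {G = G} e₁ e₂ disj
    Off : Fin n → Set
    Off v = ∀ j → S (punchIn i j) v ≡ false
    off : ∀ k → Off (proj₁ e k)
    off = glue-all Off (glue-all Off (λ a j → W⇒¬S a (punchIn i j)) (λ b → S-off i (perfect⇒S (base-perfect b))))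
      (glue-all Off (λ _ → S-off i Su) (λ b → S-off i (leafS b)))

  -- With degrees below `t` inside `S i`, more than `t * (t − 1)` non-isolated vertices would give
  -- `t` disjoint edges, which `noMatch` excludes.
  few-imperfect : ∀ i → # (λ v → S i v ∧ not (perfect G part i v)) ≤ t * t
  few-imperfect i = ≤-trans (#-mono inside) (count-nonIsolated t refl)
    where
    inside : ∀ v → S i v ∧ not (perfect G part i v) ≡ true → nonIsolated G (S i) v ≡ true
    inside v h with nonIsolated G (S i) v in eq
    ... | true = refl
    ... | false with ∧-elim {S i v} h
    ...   | Sv , np = ⊥-elim (true≢false np (cong not (isolated⇒perfect v i Sv eq)))
    count-nonIsolated : ∀ k → t ≡ k → # (nonIsolated G (S i)) ≤ t * t
    count-nonIsolated zero e = ⊥-elim (noMatch i (subst (Match G (S i)) (sym e) tt))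
    count-nonIsolated (suc Δ) e = ≮⇒≥ λ h → noMatch i (subst (Match G (S i)) (sym e)
      (nonIsolated⇒Match G Δ sG Δ (S i) (λ u Su → s≤s⁻¹ (≤-trans (degree-inside i u Su (subst (1 ≤_) (sym e) (s≤s z≤n))) (≤-reflexive e)))
        (≤-trans (s≤s (≤-trans (*-monoʳ-≤ (suc Δ) (n≤1+n Δ)) (≤-reflexive (cong₂ _*_ (sym e) (sym e))))) h)))

  goodPartition : GoodPartition n r t (suc p) G part
  goodPartition = trans (count≡# (λ v → ⌊ part v ≟ fzero ⌋)) W-size , sizes , λ i →
    perfect G part i , (λ v h → perfect⇒S h) ,
    ≤-trans (≤-reflexive (count≡# (λ v → S i v ∧ not (perfect G part i v)))) (few-imperfect i) ,
    λ v h u → mk⇔ (λ e → trans (sym (𝔹.not-involutive _)) (cong not (trans (sym (perfect⁻ h u)) e))) (λ e → trans (perfect⁻ h u) (cong not e))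
    where
    N≡ : ∑ s ≡ (n + 1) ∸ suc p
    N≡ = sym (trans (cong (λ z → (z + 1) ∸ suc p) (sym size-total)) (trans (cong (_∸ suc p) (alg (∑ s) p)) (m+n∸n≡m (∑ s) (suc p))))
      where
      alg : ∀ a p → a + p + 1 ≡ a + suc p
      alg = solve-∀
    sizes : ∀ i → (count (inS part i) ≡ ⌊ (n + 1) ∸ suc p / r ⌋ᶠ) ⊎ (count (inS part i) ≡ ⌈ (n + 1) ∸ suc p / r ⌉ᶜ)
    sizes i = [ (λ e → inj₁ (trans (count≡# (S i)) (trans e (cong (_/ r) N≡)))) ,
                (λ e → inj₂ (trans (count≡# (S i)) (trans e (cong (λ z → (z + r₁) / r) N≡)))) ]′ (balanced s sizes-close i)

-- Extremal graphs

maxOrder-upper : ∀ ℱ {m} {F : Graph m} → (m , F) ∈ ℱ → m ≤ maxOrder ℱ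
maxOrder-upper (x ∷ ℱ) (here refl) = m≤m⊔n _ _
maxOrder-upper (x ∷ ℱ) (there h)   = ≤-trans (maxOrder-upper ℱ h) (m≤n⊔m (proj₁ x) _)

free⇒no-host : ∀ {ℱ n k} {G : Graph n} (H : Graph k) → (∃[ m ] Σ (Graph m) λ F → (m , F) ∈ ℱ × (F ⊆ᴳ H)) →
  Free ℱ G → ¬ (H ⊆ᴳ G)
free⇒no-host {G = G} H (_ , F , F∈ , F⊆H) free H⊆G = free F F∈ (⊆ᴳ-trans {G = H} {H = G} F⊆H H⊆G)

∸-step : ∀ a k → a ∸ k ≤ suc (a ∸ suc k)
∸-step zero    k       = ≤-trans (≤-reflexive (0∸n≡0 k)) z≤n
∸-step (suc a) zero    = ≤-refl
∸-step (suc a) (suc k) = ∸-step a k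

-- The truncated term is a credit: on `n₁` vertices only the trivial bound is available, and each
-- deletion repays one unit, so the credit is gone once `k` reaches `r * (n₁ * n₁)`.
DegSumBound : (r₂ t p : ℕ) → Set
DegSumBound r₂ t p = let r₁ = suc r₂ ; r = suc r₁ in ∃[ n₁ ] ∃[ C₂ ] ∀ k (G : Graph (k + n₁)) → IsSimple G →
  ¬ ((Empty (suc p) ⊗ Turan (t * r) r) ⊆ᴳ G) → ¬ ((copies t K2 ⊗ Turan (t * r₁) r₁) ⊆ᴳ G) →
  r * degSum G ≤ r₁ * ((k + n₁) * (k + n₁)) + 2 * ((k + n₁) * p) + C₂ + (r * (n₁ * n₁) ∸ k)

-- Deleting vertices of small degree raises degSum relative to the quadratic, until the degree condition of structure holds.
degSum-bound : ∀ r₂ t p → DegSumBound r₂ t p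
-- With slack `r`, deleting a violating vertex raises φ by at least one: the linear terms in `n`
-- cancel and `r₁ < 2 * r`. Only the upper bound of the structure theorem is drawn on here.
degSum-bound r₂ t p = fromStructure (structure r₂ (suc (suc r₂)) t p 0)
  where
  r₁ r : ℕ
  r₁ = suc r₂
  r = suc r₁
  Host₀ : Graph (suc p + t * r)
  Host₀ = Empty (suc p) ⊗ Turan (t * r) r
  Host₁ : Graph (t * 2 + t * r₁)
  Host₁ = copies t K2 ⊗ Turan (t * r₁) r₁
  fromStructure : StructureTheorem r₂ r t p 0 → DegSumBound r₂ t p
  fromStructure (n₁ , C₂ , str) = n₁ , C₂ , bound
    where
    bound : ∀ k (G : Graph (k + n₁)) → IsSimple G → ¬ (Host₀ ⊆ᴳ G) → ¬ (Host₁ ⊆ᴳ G) →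
      r * degSum G ≤ r₁ * ((k + n₁) * (k + n₁)) + 2 * ((k + n₁) * p) + C₂ + (r * (n₁ * n₁) ∸ k)
    bound zero G sG _ _ = ≤-trans (*-monoʳ-≤ r (∑-bound (λ v → #≤n (G v)))) (m≤n+m _ (r₁ * (n₁ * n₁) + 2 * (n₁ * p) + C₂))
    bound (suc k) G sG no₀ no₁ = step (𝔽.all? (λ v → r₁ * n ≤? r * deg G v + r))
      where
      n = suc k + n₁
      step : Dec (∀ v → r₁ * n ≤ r * deg G v + r) → r * degSum G ≤ r₁ * (n * n) + 2 * (n * p) + C₂ + (r * (n₁ * n₁) ∸ suc k)
      step (yes δ) = ≤-trans (proj₁ (str n (m≤n+m n₁ (suc k)) G sG δ no₀ no₁)) (m≤m+n _ _)
      step (no ¬δ) with 𝔽.¬∀⟶∃¬ n _ (λ v → r₁ * n ≤? r * deg G v + r) ¬δ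
      ... | v , low = lin (r₁ + 2 * p + 3) (+-mono-≤ (+-mono-≤ (+-mono-≤ (bound k (delete G v) (delete-simple G v sG) (no₀ ∘ λ h → ⊆ᴳ-trans {G = delete G v} {H = G} h (delete-⊆ G v)) (no₁ ∘ λ h → ⊆ᴳ-trans {G = delete G v} {H = G} h (delete-⊆ G v)))
            (*-monoʳ-≤ 2 (≰⇒> low))) (≤-reflexive (cong (r *_) (degSum-delete G v sG)))) (∸-step (r * (n₁ * n₁)) k))
          (alg r₁ (degSum G) (degSum (delete G v)) (deg G v) (k + n₁) p C₂ (r * (n₁ * n₁) ∸ k) (r * (n₁ * n₁) ∸ suc k))
        where
        alg : ∀ r₁ D D′ g n p C x y → let r = suc r₁ in
          r * D + (r₁ * (n * n) + 2 * (n * p) + C + x + 2 * (r₁ * suc n) + r * (D′ + 2 * g) + suc y) + (r₁ + 2 * p + 3)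
          ≡ r₁ * (suc n * suc n) + 2 * (suc n * p) + C + y + (r * D′ + 2 * suc (r * g + r) + r * D + x)
        alg = solve-∀

module Extremality (ℱ : Family) (r₂ t p : ℕ) (t≡ : t ≡ maxOrder ℱ)
  (isQ : IsQ ℱ t (suc (suc r₂)) (suc p))
  (F₁ : ∃[ m ] Σ (Graph m) λ F₁ → (m , F₁) ∈ ℱ × (F₁ ⊆ᴳ (copies t K2 ⊗ Turan (t * suc r₂) (suc r₂))))
  (F₂ : ∃[ m ] Σ (Graph m) λ F₂ → (m , F₂) ∈ ℱ × (F₂ ⊆ᴳ ((Kbip p t ∪ᴳ Kbip 1 t) ⊗ Turan (t * suc r₂) (suc r₂)))) where

  r₁ r C₁ : ℕ
  r₁ = suc r₂
  r = suc r₁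
  C₁ = suc (suc r₁) * (p * p) + r₁ * (r₁ * r₁)

  Host₀ : Graph (suc p + t * r)
  Host₀ = Empty (suc p) ⊗ Turan (t * r) r
  Host₁ : Graph (t * 2 + t * r₁)
  Host₁ = copies t K2 ⊗ Turan (t * r₁) r₁
  Host₂ : Graph ((p + t) + (1 + t) + t * r₁)
  Host₂ = (Kbip p t ∪ᴳ Kbip 1 t) ⊗ Turan (t * r₁) r₁

  order≤t : ∀ {m} {F : Graph m} → (m , F) ∈ ℱ → m ≤ t
  order≤t {F = F} h = ≤-trans (maxOrder-upper ℱ {F = F} h) (≤-reflexive (sym t≡))

  module _ {n} (G : Graph n) (free : Free ℱ G) where
    no₀ : ¬ (Host₀ ⊆ᴳ G)
    no₀ = free⇒no-host {G = G} Host₀ (proj₁ isQ) free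
    no₁ : ¬ (Host₁ ⊆ᴳ G)
    no₁ = free⇒no-host {G = G} Host₁ F₁ free
    no₂ : ¬ (Host₂ ⊆ᴳ G)
    no₂ = free⇒no-host {G = G} Host₂ F₂ free

  degSum-maximal : ∀ {n} {G : Graph n} → InEX n ℱ G → ∀ H → IsSimple H → Free ℱ H → degSum H ≤ degSum G
  degSum-maximal {G = G} (sG , _ , maxi) H sH freeH =
    ≤-trans (≤-reflexive (handshake H sH)) (≤-trans (*-monoʳ-≤ 2 (maxi H sH freeH)) (≤-reflexive (sym (handshake G sG))))

  extremal-dense : ∀ {n} {G : Graph n} → p ≤ n → InEX n ℱ G → r₁ * (n * n) + 2 * (n * p) ≤ r * degSum G + C₁
  extremal-dense {n} {G} p≤n ex = compare (dense-host-free p r₁ n p≤n)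
    where
    compare : DenseHostFree p r₁ n → r₁ * (n * n) + 2 * (n * p) ≤ r * degSum G + C₁
    compare (H , sH , embed , dense) = ≤-trans dense (+-monoˡ-≤ C₁ (*-monoʳ-≤ r (degSum-maximal ex H sH
          (λ {m} F F∈ F⊆H → proj₂ isQ p ≤-refl (m , F , F∈ , embed F (order≤t F∈) F⊆H)))))

  -- Rewiring `x` keeps the graph free of the family, so maximality forbids a gain in degree.
  clone : ∀ {n} {G : Graph n} → InEX n ℱ G → ∀ x ν (P : Fin n → Bool) → ν x ≡ false → suc t ≤ # P →
    (∀ x′ → P x′ ≡ true → ∀ z → ν z ≡ true → G x′ z ≡ true) → # ν ≤ deg G x
  clone {n} {G} ex@(sG , free , _) x ν P νx many twin = *-cancelˡ-≤ 2 (+-cancelˡ-≤ (degSum G) _ _ (begin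
    degSum G + 2 * # ν                       ≡⟨ sym (degSum-rewire G x ν sG νx) ⟩
    degSum (rewire G x ν) + 2 * deg G x      ≤⟨ +-monoˡ-≤ (2 * deg G x) (degSum-maximal ex (rewire G x ν) (rewire-simple G x ν sG νx)
                                                  (λ F F∈ F⊆ → free F F∈ (rewire-embed F G x ν P sG νx (≤-trans (s≤s (order≤t F∈)) many) twin F⊆))) ⟩
    degSum G + 2 * deg G x                   ∎))
    where open ≤-Reasoning

  Conclusion : Set
  Conclusion = ∃[ n₀ ] ∀ (n : ℕ) → n₀ ≤ n → ∀ (G : Graph n) → InEX n ℱ G →
    Σ (Fin n → Fin (suc r)) λ part → GoodPartition n r t (suc p) G part

  module FromBound (n₁ C₂ : ℕ)
    (bound : ∀ k (G : Graph (k + n₁)) → IsSimple G → ¬ (Host₀ ⊆ᴳ G) → ¬ (Host₁ ⊆ᴳ G) →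
      r * degSum G ≤ r₁ * ((k + n₁) * (k + n₁)) + 2 * ((k + n₁) * p) + C₂ + (r * (n₁ * n₁) ∸ k)) where

    R c₂ : ℕ
    R = r * (n₁ * n₁)
    c₂ = C₁ + C₂ + r₁

    -- `2 * deg G v` is the difference of the degree sums of `G` and `G − v`. The first is bounded
    -- below by extremality, the second above by `bound`, whose credit vanishes because `R ≤ k`.
    min-degree : ∀ k → R ≤ k → p ≤ suc (k + n₁) → (G : Graph (suc (k + n₁))) → InEX _ ℱ G → ∀ v → r₁ * suc (k + n₁) ≤ r * deg G v + c₂
    min-degree k R≤k p≤n G ex@(sG , free , _) v = *-cancelˡ-≤ 2 (lin (C₁ + C₂ + 2 * p + r₁)
      (+-mono-≤ (+-mono-≤ (extremal-dense p≤n ex) bound′) (≤-reflexive (cong (r *_) (degSum-delete G v sG))))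
      (alg r₁ (degSum G) (degSum (delete G v)) (deg G v) (k + n₁) p C₁ C₂))
      where
      free′ : Free ℱ (delete G v)
      free′ F F∈ F⊆ = free F F∈ (⊆ᴳ-trans {F = F} {G = delete G v} {H = G} F⊆ (delete-⊆ G v))
      bound′ : r * degSum (delete G v) ≤ r₁ * ((k + n₁) * (k + n₁)) + 2 * ((k + n₁) * p) + C₂ + 0
      bound′ = ≤-trans (bound k (delete G v) (delete-simple G v sG) (no₀ (delete G v) free′) (no₁ (delete G v) free′)) (+-monoʳ-≤ _ (≤-reflexive (m≤n⇒m∸n≡0 R≤k)))
      alg : ∀ r₁ D D′ g n p C₁ C₂ → let r = suc r₁ in
        2 * (r₁ * suc n) + (r * D + C₁ + (r₁ * (n * n) + 2 * (n * p) + C₂ + 0) + r * (D′ + 2 * g)) + (C₁ + C₂ + 2 * p + r₁)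
        ≡ 2 * (r * g + (C₁ + C₂ + r₁)) + (r₁ * (suc n * suc n) + 2 * (suc n * p) + r * D′ + r * D)
      alg = solve-∀

    conclude : StructureTheorem r₂ c₂ t p C₁ → Conclusion
    conclude (n₂ , _ , str) = suc (R + n₁) + p + n₂ , λ n n≥ → build n n≥ (m≤n⇒∃[o]m+o≡n (≤-trans (≤-trans (m≤m+n (suc (R + n₁)) p) (m≤m+n _ n₂)) n≥))
      where
      build : ∀ n → suc (R + n₁) + p + n₂ ≤ n → ∃[ o ] suc (R + n₁) + o ≡ n → ∀ (G : Graph n) → InEX n ℱ G →
        Σ (Fin n → Fin (suc r)) λ part → GoodPartition n r t (suc p) G part
      build n n≥ (o , e) G ex@(sG , free , _) = finish (proj₂ (str n (≤-trans (m≤n+m n₂ _) n≥) G sG δ (no₀ G free) (no₁ G free)) (extremal-dense p≤n ex))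
        where
        p≤n : p ≤ n
        p≤n = ≤-trans (≤-trans (m≤n+m p (suc (R + n₁))) (m≤m+n _ n₂)) n≥
        δ-at : ∀ n → suc ((R + o) + n₁) ≡ n → p ≤ n → (G : Graph n) → InEX n ℱ G → ∀ v → r₁ * n ≤ r * deg G v + c₂
        δ-at _ refl = min-degree (R + o) (m≤m+n R o)
        δ : ∀ v → r₁ * n ≤ r * deg G v + c₂
        δ = δ-at n (trans (cong suc (trans (+-assoc R o n₁) (trans (cong (R +_) (+-comm o n₁)) (sym (+-assoc R n₁ o))))) e) p≤n G ex
        finish : Σ (Fin n → Fin (suc r)) (PerfectPartition G r p t) → Σ (Fin n → Fin (suc r)) λ part → GoodPartition n r t (suc p) G part
        finish (part , W-size , perfect-many) = part , FinalPartition.goodPartition G sG r₂ p t part W-size perfect-many (no₁ G free) (no₂ G free) (clone ex)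

  from-bound : DegSumBound r₂ t p → Conclusion
  from-bound (n₁ , C₂ , bound) = FromBound.conclude n₁ C₂ bound (structure r₂ (C₁ + C₂ + r₁) t p C₁)

  conclusion : Conclusion
  conclusion = from-bound (degSum-bound r₂ t p)

-- The Turán classes would colour a member of the family with `r` colours. Hence `q ≥ 1`, and `q`
-- may be written `suc p`.
¬QWitness-0 : ∀ ℱ r₁ t → MinChromatic ℱ (suc (suc r₁)) → ¬ QWitness ℱ t (suc r₁) 0
¬QWitness-0 ℱ r₁ t (¬col , _) (m , F , F∈ , f , _ , fe) =
  ¬col F F∈ ((λ a → proj₂ (remQuot {t} (suc r₁) (f a))) , λ i j e → Turan⇒≢ t r₁ (f i) (f j) (fe i j e))

theorem1p3 : (ℱ : Family) (r t q : ℕ) →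
    (∀ {m} (F : Graph m) → (m , F) ∈ ℱ → IsSimple F) →
    2 ≤ r →
    MinChromatic ℱ (suc r) →
    t ≡ maxOrder ℱ →
    IsQ ℱ t r q →
    (∃[ m ] Σ (Graph m) λ F₁ → (m , F₁) ∈ ℱ ×
    (F₁ ⊆ᴳ (copies t K2 ⊗ Turan (t * (r ∸ 1)) (r ∸ 1)))) →
    (∃[ m ] Σ (Graph m) λ F₂ → (m , F₂) ∈ ℱ ×
    (F₂ ⊆ᴳ ((Kbip (q ∸ 1) t ∪ᴳ Kbip 1 t) ⊗ Turan (t * (r ∸ 1)) (r ∸ 1)))) →
    ∃[ n₀ ] ∀ (n : ℕ) → n₀ ≤ n → ∀ (G : Graph n) → InEX n ℱ G →
    Σ (Fin n → Fin (suc r)) λ part → GoodPartition n r t q G part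
theorem1p3 ℱ (suc (suc r₂)) t zero _ _ chrom _ isQ _ _ = ⊥-elim (¬QWitness-0 ℱ (suc r₂) t chrom (proj₁ isQ))
theorem1p3 ℱ (suc (suc r₂)) t (suc p) _ _ _ t≡ isQ F₁ F₂ = Extremality.conclusion ℱ r₂ t p t≡ isQ F₁ F₂
theorem1p3 ℱ (suc zero) t q _ (s≤s ()) _ _ _ _ _
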